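{- Let $P(X)\in\mathbb{Z}[X]$ be a Borwein polynomial of degree at most $8$. If $P(X)$ divides (in $\mathbb{Z}[X]$) some Newman polynomial, then $P(X)$ also divides (in $\mathbb{Z}[X]$) some Littlewood polynomial.
   Context: A polynomial $P(X)=a_dX^d+\dots+a_1X+a_0\in\mathbb{Z}[X]$ is a Borwein polynomial if all $a_j\in\{ -1,0,1\}$, $a_d\neq 0$ and $P(0)=a_0\neq 0$. It is a Littlewood polynomial if all $a_j\in\{ -1,1\}$. It is a Newman polynomial if all $a_j\in\{0,1\}$, $a_d\ne 0$ and $P(0)=1$. -}

module Defs where

open import Data.Nat using (ℕ; zero; suc; _≤_)
open import Data.Integer using (ℤ; _+_; _*_; 0ℤ; 1ℤ; -1ℤ)
open import Data.List using (List; []; _∷_; map; length)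
open import Data.List.Relation.Unary.All using (All)
open import Data.Product using (∃; _×_)
open import Data.Sum using (_⊎_)
open import Relation.Binary.PropositionalEquality using (_≡_; _≢_)

-- A polynomial in ℤ[X] is represented by its list of coefficients
-- [a₀, a₁, …, a_d] (lowest degree first).  Trailing zeros are allowed in
-- general; two polynomials are equal iff all their coefficients agree.
Poly : Set
Poly = List ℤ

coeff : Poly → ℕ → ℤ
coeff []      _       = 0ℤ
coeff (a ∷ p) zero    = a
coeff (a ∷ p) (suc n) = coeff p n

lead : Poly → ℤ
lead []          = 0ℤ
lead (a ∷ [])    = a
lead (a ∷ b ∷ p) = lead (b ∷ p)

_+ₚ_ : Poly → Poly → Poly
[]      +ₚ q       = q
(a ∷ p) +ₚ []      = a ∷ p
(a ∷ p) +ₚ (b ∷ q) = (a + b) ∷ (p +ₚ q)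

_*ₚ_ : Poly → Poly → Poly
[]      *ₚ q = []
(a ∷ p) *ₚ q = map (a *_) q +ₚ (0ℤ ∷ (p *ₚ q))

_∣ₚ_ : Poly → Poly → Set
P ∣ₚ N = ∃ λ (Q : Poly) → ∀ n → coeff (P *ₚ Q) n ≡ coeff N n

Borwein : Poly → Set
Borwein P = All (λ a → a ≡ -1ℤ ⊎ a ≡ 0ℤ ⊎ a ≡ 1ℤ) P × lead P ≢ 0ℤ × coeff P 0 ≢ 0ℤ

-- Littlewood: all coefficients in {-1,1} (nonempty list, so a_d ≠ 0)
Littlewood : Poly → Set
Littlewood P = All (λ a → a ≡ -1ℤ ⊎ a ≡ 1ℤ) P × lead P ≢ 0ℤ

Newman : Poly → Set
Newman P = All (λ a → a ≡ 0ℤ ⊎ a ≡ 1ℤ) P × lead P ≢ 0ℤ × coeff P 0 ≡ 1ℤ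

-- degree of a polynomial given as a list with nonzero last entry is
-- length - 1; so "degree ≤ 8" is "length ≤ 9"
degree≤ : Poly → ℕ → Set
degree≤ P d = length P ≤ suc d

{-# OPTIONS --safe #-}

-- Up to sign and reversal, every Borwein polynomial P of degree at most 8 is settled in one of three ways.
--
--  * P, or a factor of it, changes sign on [0, 2].  It then has a positive root, whereas a Newman polynomial is at
--    least 1 on [0, ∞).
--  * P has an explicit Littlewood multiple L.  (If P ∣ L then L ≡ 1 + X + … modulo (2, P), so the length of L is a
--    multiple of a fixed period; given that, a search of the graph of remainders modulo P from both ends finds L.)
--  * P has a root a in the open unit disc such that reading the coefficients of a Newman multiple N from the constant
--    term upwards must fail.  After each coefficient, N/P is replaced by a pair V, n with P ∣ V + n, where deg V < deg P
--    and n is the unread 0/1 polynomial.  The values n(a) of all 0/1 polynomials lie in an explicit polygon, and V is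
--    hopeless if −V(a) lies outside it.  Only finitely many V survive, and 0, the only possible final state, is not
--    among them.
--
-- No exact roots are needed: it suffices that P takes arbitrarily small values at Gaussian rationals in a prescribed
-- region, since every multiple PQ then does so too.  Such points come from bisection on the real line and from a
-- simplified Newton iteration a ↦ a − c P(a) otherwise.  Complex size is measured by |Re| + |Im|, which is
-- submultiplicative and rational.
module Submission where

open import Defs
open import Algebra.Bundles using (CommutativeRing)
open import Algebra.Structures using (IsCommutativeRing)
import Algebra.Solver.Ring.AlmostCommutativeRing as ACR
import Algebra.Solver.Ring.Simple as RingSolver
open import Data.Bool using (Bool; true; false; _∧_; _∨_; T; not; if_then_else_)
open import Data.Bool.ListAction using (all; any)
open import Data.Empty using (⊥; ⊥-elim)
open import Data.Integer as ℤ using (ℤ; +_; -[1+_]; 0ℤ; 1ℤ; -1ℤ)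
open import Data.Integer.DivMod using (_/ℕ_)
import Data.Integer.Properties as ℤ
import Data.Integer.Solver as ℤ
open import Data.List using (List; []; _∷_; map; length; reverse; _++_; _∷ʳ_; replicate; [_]; drop; take)
open import Data.List.Membership.Propositional using (_∈_)
open import Data.List.Membership.Propositional.Properties using (∈-map⁺; ∈-++⁺ˡ; ∈-++⁺ʳ)
import Data.List.Properties as List
open import Data.List.Relation.Unary.All as All using (All; []; _∷_)
import Data.List.Relation.Unary.All.Properties as All
open import Data.List.Relation.Unary.Any using (here; there)
open import Data.Nat as ℕ using (ℕ; zero; suc; z≤n; s≤s)
import Data.Nat.DivMod as ℕ
import Data.Nat.Properties as ℕ
open import Data.Product using (∃; _×_; _,_; proj₁; proj₂)
open import Data.Rational as ℚ using (ℚ; 0ℚ; 1ℚ; ½; nonNegative)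
import Data.Rational.Properties as ℚ
import Data.Rational.Unnormalised as ℚᵘ
import Data.Rational.Unnormalised.Properties as ℚᵘ
open import Data.Sum as Sum using (_⊎_; inj₁; inj₂; [_,_]′)
open import Data.Unit using (⊤; tt)
open import Relation.Binary.Definitions using (DecidableEquality)
open import Relation.Binary.PropositionalEquality using (_≡_; _≢_; refl; sym; trans; cong; cong₂; subst; subst₂; isEquivalence; module ≡-Reasoning)
import Relation.Binary.Reasoning.Setoid as SetoidReasoning
open import Relation.Nullary using (yes; no)

-- The given Newman multiple is never transformed into a Littlewood one. Either it is ignored,
-- because a Littlewood multiple of P is listed outright, or it is contradicted, because P has no
-- Newman multiple at all. That one of the two always happens up to degree 8 is an outcome of
-- computation, not of a uniform argument. The tests are evaluated by the type checker, which
-- dictates their form: they involve integers only, complex numbers being scaled by `S` and rounded,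
-- each with an explicit error. Rational numbers occur only in the soundness proofs. The values n(a)
-- have to be bounded for 0/1 polynomials n of every length, which needs |a| < 1; a root outside the
-- disc is used through the reversed polynomial, whose roots are the reciprocals. Even then |Re a| +
-- |Im a| may exceed 1, so the bound rests on a higher power of a, of size at most 1/2, and is
-- obtained by bounding n(a) in terms of shorter polynomials of the same kind.

infix 4 _≋_

_≋_ : Poly → Poly → Set
p ≋ q = ∀ n → coeff p n ≡ coeff q n

-- Evaluation at Gaussian rationals and approximate roots

module Analysis where

  open import Data.Rational using (_+_; _*_; -_; _-_; _≤_; ∣_∣)
  open import Data.Rational.Properties using (module ≤-Reasoning)
  open import Data.Rational.Solver using (module +-*-Solver)

  -- Abstract, since unification would otherwise unfold the normalisation of fractions.
  abstract
    κ : ℤ → ℚ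
    κ i = i ℚ./ 1

    toℚᵘ-κ : ∀ i → ℚ.toℚᵘ (κ i) ℚᵘ.≃ ℚᵘ.mkℚᵘ i 0
    toℚᵘ-κ i = ℚ.toℚᵘ-fromℚᵘ (ℚᵘ.mkℚᵘ i 0)

    κ-+ : ∀ i j → κ (i ℤ.+ j) ≡ κ i + κ j
    κ-+ i j = ℚ.toℚᵘ-injective (begin
      ℚ.toℚᵘ (κ (i ℤ.+ j))                  ≈⟨ toℚᵘ-κ (i ℤ.+ j) ⟩
      ℚᵘ.mkℚᵘ (i ℤ.+ j) 0                   ≈⟨ ℚᵘ.*≡* (ℤ.+-*-Solver.solve 2 (λ a b → (a ⊕ b) ⊗ con 1ℤ ⊜ (a ⊗ con 1ℤ ⊕ b ⊗ con 1ℤ) ⊗ con 1ℤ) refl i j) ⟩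
      ℚᵘ.mkℚᵘ i 0 ℚᵘ.+ ℚᵘ.mkℚᵘ j 0          ≈⟨ ℚᵘ.+-cong (toℚᵘ-κ i) (toℚᵘ-κ j) ⟨
      ℚ.toℚᵘ (κ i) ℚᵘ.+ ℚ.toℚᵘ (κ j)        ≈⟨ ℚ.toℚᵘ-homo-+ (κ i) (κ j) ⟨
      ℚ.toℚᵘ (κ i + κ j)                    ∎)
      where
      open SetoidReasoning ℚᵘ.≃-setoid
      open ℤ.+-*-Solver using (con) renaming (_:+_ to _⊕_; _:*_ to _⊗_; _:=_ to _⊜_)

    κ-* : ∀ i j → κ (i ℤ.* j) ≡ κ i * κ j
    κ-* i j = ℚ.toℚᵘ-injective (begin
      ℚ.toℚᵘ (κ (i ℤ.* j))                  ≈⟨ toℚᵘ-κ (i ℤ.* j) ⟩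
      ℚᵘ.mkℚᵘ i 0 ℚᵘ.* ℚᵘ.mkℚᵘ j 0          ≈⟨ ℚᵘ.*-cong (toℚᵘ-κ i) (toℚᵘ-κ j) ⟨
      ℚ.toℚᵘ (κ i) ℚᵘ.* ℚ.toℚᵘ (κ j)        ≈⟨ ℚ.toℚᵘ-homo-* (κ i) (κ j) ⟨
      ℚ.toℚᵘ (κ i * κ j)                    ∎)
      where open SetoidReasoning ℚᵘ.≃-setoid

    κ-neg : ∀ i → κ (ℤ.- i) ≡ - κ i
    κ-neg (+ zero)    = refl
    κ-neg (+ (suc n)) = refl
    κ-neg -[1+ n ]    = solve 1 (λ a → a := :- (:- a)) refl (κ (+ suc n))
      where open +-*-Solver

    κ-mono : ∀ {i j} → i ℤ.≤ j → κ i ≤ κ j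
    κ-mono {i} {j} i≤j = ℚ.toℚᵘ-cancel-≤ (begin
      ℚ.toℚᵘ (κ i)   ≃⟨ toℚᵘ-κ i ⟩
      ℚᵘ.mkℚᵘ i 0    ≤⟨ ℚᵘ.*≤* (ℤ.*-monoʳ-≤-nonNeg 1ℤ i≤j) ⟩
      ℚᵘ.mkℚᵘ j 0    ≃⟨ toℚᵘ-κ j ⟨
      ℚ.toℚᵘ (κ j)   ∎)
      where open ℚᵘ.≤-Reasoning

    κ-abs : ∀ i → ∣ κ i ∣ ≡ κ (+ ℤ.∣ i ∣)
    κ-abs (+ n)    = ℚ.0≤p⇒∣p∣≡p (κ-mono {+ 0} {+ n} (ℤ.+≤+ ℕ.z≤n))
    κ-abs -[1+ n ] = trans (ℚ.∣-p∣≡∣p∣ (κ (+ suc n))) (κ-abs (+ suc n))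

    -- Outside the `abstract` block this and `κ-1` no longer hold by computation, hence the named
    -- equations.
    κ-0 : κ 0ℤ ≡ 0ℚ
    κ-0 = refl

    κ-1 : κ 1ℤ ≡ 1ℚ
    κ-1 = refl

  -- Gaussian rationals as a commutative ring

  infix 4 _+i_
  record ℂ : Set where
    constructor _+i_
    field re im : ℚ
  open ℂ public

  infixl 6 _⊕_ _⊖_
  infixl 7 _⊛_

  _⊕_ _⊖_ _⊛_ : ℂ → ℂ → ℂ
  (a +i b) ⊕ (c +i d) = a + c +i b + d
  (a +i b) ⊛ (c +i d) = a * c - b * d +i a * d + b * c

  ⊝_ : ℂ → ℂ
  ⊝ (a +i b) = - a +i - b

  x ⊖ y = x ⊕ ⊝ y

  0ℂ 1ℂ : ℂ
  0ℂ = 0ℚ +i 0ℚ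
  1ℂ = 1ℚ +i 0ℚ

  module _ where
    open +-*-Solver

    ⊛-assoc : ∀ x y z → (x ⊛ y) ⊛ z ≡ x ⊛ (y ⊛ z)
    ⊛-assoc (a +i b) (c +i d) (e +i f) = cong₂ _+i_
      (solve 6 (λ a b c d e f → (a :* c :- b :* d) :* e :- (a :* d :+ b :* c) :* f := a :* (c :* e :- d :* f) :- b :* (c :* f :+ d :* e)) refl a b c d e f)
      (solve 6 (λ a b c d e f → (a :* c :- b :* d) :* f :+ (a :* d :+ b :* c) :* e := a :* (c :* f :+ d :* e) :+ b :* (c :* e :- d :* f)) refl a b c d e f)

    ⊛-comm : ∀ x y → x ⊛ y ≡ y ⊛ x
    ⊛-comm (a +i b) (c +i d) = cong₂ _+i_
      (solve 4 (λ a b c d → a :* c :- b :* d := c :* a :- d :* b) refl a b c d)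
      (solve 4 (λ a b c d → a :* d :+ b :* c := c :* b :+ d :* a) refl a b c d)

    ⊛-identityˡ : ∀ x → 1ℂ ⊛ x ≡ x
    ⊛-identityˡ (a +i b) = cong₂ _+i_
      (solve 2 (λ a b → con 1ℚ :* a :- con 0ℚ :* b := a) refl a b)
      (solve 2 (λ a b → con 1ℚ :* b :+ con 0ℚ :* a := b) refl a b)

    ⊛-distribˡ : ∀ x y z → x ⊛ (y ⊕ z) ≡ x ⊛ y ⊕ x ⊛ z
    ⊛-distribˡ (a +i b) (c +i d) (e +i f) = cong₂ _+i_
      (solve 6 (λ a b c d e f → a :* (c :+ e) :- b :* (d :+ f) := a :* c :- b :* d :+ (a :* e :- b :* f)) refl a b c d e f)
      (solve 6 (λ a b c d e f → a :* (d :+ f) :+ b :* (c :+ e) := a :* d :+ b :* c :+ (a :* f :+ b :* e)) refl a b c d e f)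

  ⊛-⊕-isCommutativeRing : IsCommutativeRing _≡_ _⊕_ _⊛_ ⊝_ 0ℂ 1ℂ
  ⊛-⊕-isCommutativeRing = record
    { isRing = record
      { +-isAbelianGroup = record
        { isGroup = record
          { isMonoid = record
            { isSemigroup = record
              { isMagma = record { isEquivalence = isEquivalence ; ∙-cong = cong₂ _⊕_ }
              ; assoc = λ x y z → cong₂ _+i_ (ℚ.+-assoc (re x) (re y) (re z)) (ℚ.+-assoc (im x) (im y) (im z)) }
            ; identity = (λ x → cong₂ _+i_ (ℚ.+-identityˡ (re x)) (ℚ.+-identityˡ (im x)))
                       , (λ x → cong₂ _+i_ (ℚ.+-identityʳ (re x)) (ℚ.+-identityʳ (im x))) }
          ; inverse = (λ x → cong₂ _+i_ (ℚ.+-inverseˡ (re x)) (ℚ.+-inverseˡ (im x)))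
                    , (λ x → cong₂ _+i_ (ℚ.+-inverseʳ (re x)) (ℚ.+-inverseʳ (im x)))
          ; ⁻¹-cong = cong ⊝_ }
        ; comm = λ x y → cong₂ _+i_ (ℚ.+-comm (re x) (re y)) (ℚ.+-comm (im x) (im y)) }
      ; *-cong = cong₂ _⊛_
      ; *-assoc = ⊛-assoc
      ; *-identity = ⊛-identityˡ , λ x → trans (⊛-comm x 1ℂ) (⊛-identityˡ x)
      ; distrib = ⊛-distribˡ
                , λ x y z → trans (⊛-comm (y ⊕ z) x) (trans (⊛-distribˡ x y z) (cong₂ _⊕_ (⊛-comm x y) (⊛-comm x z))) }
    ; *-comm = ⊛-comm }

  ℂ-ring : CommutativeRing _ _
  ℂ-ring = record { isCommutativeRing = ⊛-⊕-isCommutativeRing }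

  _≟ℂ_ : DecidableEquality ℂ
  (a +i b) ≟ℂ (c +i d) with a ℚ.≟ c | b ℚ.≟ d
  ... | yes refl | yes refl = yes refl
  ... | no a≢c   | _        = no λ { refl → a≢c refl }
  ... | _        | no b≢d   = no λ { refl → b≢d refl }

  module ℂ-Solver = RingSolver (ACR.fromCommutativeRing ℂ-ring) _≟ℂ_

  -- Inequalities and the norm

  *-monoʳ₀ : ∀ {p q r} → 0ℚ ≤ r → p ≤ q → p * r ≤ q * r
  *-monoʳ₀ {r = r} 0≤r = ℚ.*-monoʳ-≤-nonNeg r {{nonNegative 0≤r}}

  *-monoˡ₀ : ∀ {p q r} → 0ℚ ≤ r → p ≤ q → r * p ≤ r * q
  *-monoˡ₀ {r = r} 0≤r = ℚ.*-monoˡ-≤-nonNeg r {{nonNegative 0≤r}}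

  *-mono₀ : ∀ {p q r s} → 0ℚ ≤ r → 0ℚ ≤ q → p ≤ q → r ≤ s → p * r ≤ q * s
  *-mono₀ 0≤r 0≤q p≤q r≤s = ℚ.≤-trans (*-monoʳ₀ 0≤r p≤q) (*-monoˡ₀ 0≤q r≤s)

  0≤+ : ∀ {p q} → 0ℚ ≤ p → 0ℚ ≤ q → 0ℚ ≤ p + q
  0≤+ {p} {q} 0≤p 0≤q = subst (_≤ p + q) (ℚ.+-identityˡ 0ℚ) (ℚ.+-mono-≤ 0≤p 0≤q)

  0≤* : ∀ {p q} → 0ℚ ≤ p → 0ℚ ≤ q → 0ℚ ≤ p * q
  0≤* {p} {q} 0≤p 0≤q = subst (_≤ p * q) (ℚ.*-zeroˡ q) (*-monoʳ₀ 0≤q 0≤p)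

  κ-pos : ∀ n → 0ℚ ≤ κ (+ n)
  κ-pos n = subst (_≤ κ (+ n)) κ-0 (κ-mono (ℤ.+≤+ ℕ.z≤n))

  p≤∣p∣ : ∀ p → p ≤ ∣ p ∣
  p≤∣p∣ p with ℚ.≤-total 0ℚ p
  ... | inj₁ 0≤p = ℚ.≤-reflexive (sym (ℚ.0≤p⇒∣p∣≡p 0≤p))
  ... | inj₂ p≤0 = ℚ.≤-trans p≤0 (ℚ.0≤∣p∣ p)

  ‖_‖ : ℂ → ℚ
  ‖ z ‖ = ∣ re z ∣ + ∣ im z ∣

  0≤‖_‖ : ∀ z → 0ℚ ≤ ‖ z ‖
  0≤‖ z ‖ = 0≤+ (ℚ.0≤∣p∣ (re z)) (ℚ.0≤∣p∣ (im z))

  ‖⊕‖ : ∀ y z → ‖ y ⊕ z ‖ ≤ ‖ y ‖ + ‖ z ‖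
  ‖⊕‖ (a +i b) (c +i d) = begin
    ∣ a + c ∣ + ∣ b + d ∣                     ≤⟨ ℚ.+-mono-≤ (ℚ.∣p+q∣≤∣p∣+∣q∣ a c) (ℚ.∣p+q∣≤∣p∣+∣q∣ b d) ⟩
    ∣ a ∣ + ∣ c ∣ + (∣ b ∣ + ∣ d ∣)           ≡⟨ solve 4 (λ a b c d → a :+ c :+ (b :+ d) := a :+ b :+ (c :+ d)) refl (∣ a ∣) (∣ b ∣) (∣ c ∣) (∣ d ∣) ⟩
    ∣ a ∣ + ∣ b ∣ + (∣ c ∣ + ∣ d ∣)           ∎
    where
    open ≤-Reasoning
    open +-*-Solver

  ‖⊝‖ : ∀ z → ‖ ⊝ z ‖ ≡ ‖ z ‖
  ‖⊝‖ (a +i b) = cong₂ _+_ (ℚ.∣-p∣≡∣p∣ a) (ℚ.∣-p∣≡∣p∣ b)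

  ‖⊛‖ : ∀ y z → ‖ y ⊛ z ‖ ≤ ‖ y ‖ * ‖ z ‖
  ‖⊛‖ (a +i b) (c +i d) = begin
    ∣ a * c - b * d ∣ + ∣ a * d + b * c ∣
      ≤⟨ ℚ.+-mono-≤ (ℚ.∣p-q∣≤∣p∣+∣q∣ (a * c) (b * d)) (ℚ.∣p+q∣≤∣p∣+∣q∣ (a * d) (b * c)) ⟩
    ∣ a * c ∣ + ∣ b * d ∣ + (∣ a * d ∣ + ∣ b * c ∣)
      ≡⟨ cong₂ _+_ (cong₂ _+_ (ℚ.∣p*q∣≡∣p∣*∣q∣ a c) (ℚ.∣p*q∣≡∣p∣*∣q∣ b d)) (cong₂ _+_ (ℚ.∣p*q∣≡∣p∣*∣q∣ a d) (ℚ.∣p*q∣≡∣p∣*∣q∣ b c)) ⟩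
    ∣ a ∣ * ∣ c ∣ + ∣ b ∣ * ∣ d ∣ + (∣ a ∣ * ∣ d ∣ + ∣ b ∣ * ∣ c ∣)
      ≡⟨ solve 4 (λ a b c d → a :* c :+ b :* d :+ (a :* d :+ b :* c) := (a :+ b) :* (c :+ d)) refl (∣ a ∣) (∣ b ∣) (∣ c ∣) (∣ d ∣) ⟩
    (∣ a ∣ + ∣ b ∣) * (∣ c ∣ + ∣ d ∣) ∎
    where
    open ≤-Reasoning
    open +-*-Solver

  ⊕-bound : ∀ y z {p q} → ‖ y ‖ ≤ p → ‖ z ‖ ≤ q → ‖ y ⊕ z ‖ ≤ p + q
  ⊕-bound y z y≤ z≤ = ℚ.≤-trans (‖⊕‖ y z) (ℚ.+-mono-≤ y≤ z≤)

  ⊛-bound : ∀ y z {p q} → ‖ y ‖ ≤ p → ‖ z ‖ ≤ q → ‖ y ⊛ z ‖ ≤ p * q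
  ⊛-bound y z y≤ z≤ = ℚ.≤-trans (‖⊛‖ y z) (*-mono₀ 0≤‖ z ‖ (ℚ.≤-trans 0≤‖ y ‖ y≤) y≤ z≤)

  ι : ℤ → ℂ
  ι i = κ i +i 0ℚ

  ι-0 : ι 0ℤ ≡ 0ℂ
  ι-0 = cong (_+i 0ℚ) κ-0

  ι-+ : ∀ i j → ι (i ℤ.+ j) ≡ ι i ⊕ ι j
  ι-+ i j = cong₂ _+i_ (κ-+ i j) refl

  ι-* : ∀ i j → ι (i ℤ.* j) ≡ ι i ⊛ ι j
  ι-* i j = cong₂ _+i_
    (trans (κ-* i j) (solve 2 (λ a b → a :* b := a :* b :- con 0ℚ :* con 0ℚ) refl (κ i) (κ j)))
    (solve 2 (λ a b → con 0ℚ := a :* con 0ℚ :+ con 0ℚ :* b) refl (κ i) (κ j))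
    where open +-*-Solver

  ‖ι⊛‖ : ∀ i z → ‖ ι i ⊛ z ‖ ≡ κ (+ ℤ.∣ i ∣) * ‖ z ‖
  ‖ι⊛‖ i (a +i b) = begin
    ∣ κ i * a - 0ℚ * b ∣ + ∣ κ i * b + 0ℚ * a ∣
      ≡⟨ cong₂ (λ x y → ∣ x ∣ + ∣ y ∣) (solve 3 (λ k a b → k :* a :- con 0ℚ :* b := k :* a) refl (κ i) a b)
           (solve 3 (λ k a b → k :* b :+ con 0ℚ :* a := k :* b) refl (κ i) a b) ⟩
    ∣ κ i * a ∣ + ∣ κ i * b ∣
      ≡⟨ cong₂ _+_ (ℚ.∣p*q∣≡∣p∣*∣q∣ (κ i) a) (ℚ.∣p*q∣≡∣p∣*∣q∣ (κ i) b) ⟩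
    ∣ κ i ∣ * ∣ a ∣ + ∣ κ i ∣ * ∣ b ∣
      ≡⟨ ℚ.*-distribˡ-+ (∣ κ i ∣) (∣ a ∣) (∣ b ∣) ⟨
    ∣ κ i ∣ * (∣ a ∣ + ∣ b ∣)
      ≡⟨ cong (_* (∣ a ∣ + ∣ b ∣)) (κ-abs i) ⟩
    κ (+ ℤ.∣ i ∣) * (∣ a ∣ + ∣ b ∣) ∎
    where
    open ≡-Reasoning
    open +-*-Solver

  ‖ι‖ : ∀ i → ‖ ι i ‖ ≡ κ (+ ℤ.∣ i ∣)
  ‖ι‖ i = trans (ℚ.+-identityʳ _) (κ-abs i)

  -- Evaluation and divided differences

  ev : Poly → ℂ → ℂ
  ev []      x = 0ℂ
  ev (c ∷ p) x = ι c ⊕ x ⊛ ev p x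

  ev-+ₚ : ∀ p q x → ev (p +ₚ q) x ≡ ev p x ⊕ ev q x
  ev-+ₚ []      q       x = solve 1 (λ a → a := con 0ℂ :+ a) refl (ev q x)
    where open ℂ-Solver
  ev-+ₚ (c ∷ p) []      x = solve 1 (λ a → a := a :+ con 0ℂ) refl (ev (c ∷ p) x)
    where open ℂ-Solver
  ev-+ₚ (c ∷ p) (d ∷ q) x = trans (cong₂ (λ u v → u ⊕ x ⊛ v) (ι-+ c d) (ev-+ₚ p q x))
    (solve 5 (λ c d x p q → c :+ d :+ x :* (p :+ q) := c :+ x :* p :+ (d :+ x :* q)) refl (ι c) (ι d) x (ev p x) (ev q x))
    where open ℂ-Solver

  ev-map : ∀ c p x → ev (map (c ℤ.*_) p) x ≡ ι c ⊛ ev p x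
  ev-map c []      x = solve 1 (λ c → con 0ℂ := c :* con 0ℂ) refl (ι c)
    where open ℂ-Solver
  ev-map c (d ∷ p) x = trans (cong₂ (λ u v → u ⊕ x ⊛ v) (ι-* c d) (ev-map c p x))
    (solve 4 (λ c d x p → c :* d :+ x :* (c :* p) := c :* (d :+ x :* p)) refl (ι c) (ι d) x (ev p x))
    where open ℂ-Solver

  ev-*ₚ : ∀ p q x → ev (p *ₚ q) x ≡ ev p x ⊛ ev q x
  ev-*ₚ []      q x = solve 1 (λ a → con 0ℂ := con 0ℂ :* a) refl (ev q x)
    where open ℂ-Solver
  ev-*ₚ (c ∷ p) q x = trans (ev-+ₚ (map (c ℤ.*_) q) (0ℤ ∷ (p *ₚ q)) x)
    (trans (cong₂ _⊕_ (ev-map c q x) (cong₂ (λ u v → u ⊕ x ⊛ v) ι-0 (ev-*ₚ p q x)))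
      (solve 4 (λ c x p q → c :* q :+ (con 0ℂ :+ x :* (p :* q)) := (c :+ x :* p) :* q) refl (ι c) x (ev p x) (ev q x)))
    where open ℂ-Solver

  ev-zero : ∀ p x → p ≋ [] → ev p x ≡ 0ℂ
  ev-zero []      x p≋0 = refl
  ev-zero (c ∷ p) x p≋0 = trans (cong₂ (λ u v → u ⊕ x ⊛ v) (trans (cong ι (p≋0 0)) ι-0) (ev-zero p x (λ n → p≋0 (suc n))))
    (solve 1 (λ x → con 0ℂ :+ x :* con 0ℂ := con 0ℂ) refl x)
    where open ℂ-Solver

  ev-cong : ∀ p q x → p ≋ q → ev p x ≡ ev q x
  ev-cong []      q       x p≋q = sym (ev-zero q x (λ n → sym (p≋q n)))
  ev-cong (c ∷ p) []      x p≋q = ev-zero (c ∷ p) x p≋q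
  ev-cong (c ∷ p) (d ∷ q) x p≋q = cong₂ (λ u v → ι u ⊕ x ⊛ v) (p≋q 0) (ev-cong p q x (λ n → p≋q (suc n)))

  -- The divided difference (p(b) − p(a)) / (b − a).
  dd : Poly → ℂ → ℂ → ℂ
  dd []      a b = 0ℂ
  dd (c ∷ p) a b = ev p a ⊕ b ⊛ dd p a b

  ev-dd : ∀ p a b → ev p b ≡ ev p a ⊕ (b ⊖ a) ⊛ dd p a b
  ev-dd []      a b = solve 2 (λ a b → con 0ℂ := con 0ℂ :+ (b :- a) :* con 0ℂ) refl a b
    where open ℂ-Solver
  ev-dd (c ∷ p) a b = trans (cong (λ u → ι c ⊕ b ⊛ u) (ev-dd p a b))
    (solve 5 (λ c a b p d → c :+ b :* (p :+ (b :- a) :* d) := c :+ a :* p :+ (b :- a) :* (p :+ b :* d)) refl (ι c) a b (ev p a) (dd p a b))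
    where open ℂ-Solver

  derivative : Poly → Poly
  derivative []      = []
  derivative (c ∷ p) = p +ₚ (0ℤ ∷ derivative p)

  -- At the centre of a disc the divided difference thereby becomes the value of an integer
  -- polynomial, which a table of powers can supply.
  dd-diagonal : ∀ p a → dd p a a ≡ ev (derivative p) a
  dd-diagonal []      a = refl
  dd-diagonal (c ∷ p) a = sym (trans (ev-+ₚ p (0ℤ ∷ derivative p) a)
    (cong (ev p a ⊕_) (trans (cong₂ (λ u v → u ⊕ a ⊛ v) ι-0 (sym (dd-diagonal p a)))
      (solve 1 (λ x → con 0ℂ :+ x := x) refl (a ⊛ dd p a a)))))
    where open ℂ-Solver

  -- Horner recursions for bounds on the region `Small`, whose radius is the factor 2. The 2 before
  -- `ddBound` in `ddLip` is different: it counts the two arguments that move.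
  evBound ddBound ddLip : Poly → ℕ
  evBound []      = 0
  evBound (c ∷ p) = ℤ.∣ c ∣ ℕ.+ 2 ℕ.* evBound p
  ddBound []      = 0
  ddBound (c ∷ p) = evBound p ℕ.+ 2 ℕ.* ddBound p
  ddLip []      = 0
  ddLip (c ∷ p) = 2 ℕ.* ddBound p ℕ.+ 2 ℕ.* ddLip p

  κℕ-+ : ∀ m n → κ (+ (m ℕ.+ n)) ≡ κ (+ m) + κ (+ n)
  κℕ-+ m n = trans (cong κ (ℤ.pos-+ m n)) (κ-+ (+ m) (+ n))

  κℕ-* : ∀ m n → κ (+ (m ℕ.* n)) ≡ κ (+ m) * κ (+ n)
  κℕ-* m n = trans (cong κ (ℤ.pos-* m n)) (κ-* (+ m) (+ n))

  Small : ℂ → Set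
  Small a = ‖ a ‖ ≤ κ (+ 2)

  ‖ev‖ : ∀ p {a} → Small a → ‖ ev p a ‖ ≤ κ (+ evBound p)
  ‖ev‖ []      a≤2 = κ-pos 0
  ‖ev‖ (c ∷ p) {a} a≤2 = begin
    ‖ ι c ⊕ a ⊛ ev p a ‖                              ≤⟨ ⊕-bound (ι c) (a ⊛ ev p a) (ℚ.≤-reflexive (‖ι‖ c)) (⊛-bound a (ev p a) a≤2 (‖ev‖ p a≤2)) ⟩
    κ (+ ℤ.∣ c ∣) + κ (+ 2) * κ (+ evBound p)         ≡⟨ cong (λ u → κ (+ ℤ.∣ c ∣) + u) (κℕ-* 2 (evBound p)) ⟨
    κ (+ ℤ.∣ c ∣) + κ (+ (2 ℕ.* evBound p))           ≡⟨ κℕ-+ ℤ.∣ c ∣ (2 ℕ.* evBound p) ⟨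
    κ (+ evBound (c ∷ p))                             ∎
    where open ≤-Reasoning

  ‖dd‖ : ∀ p {a b} → Small a → Small b → ‖ dd p a b ‖ ≤ κ (+ ddBound p)
  ‖dd‖ []      a≤2 b≤2 = κ-pos 0
  ‖dd‖ (c ∷ p) {a} {b} a≤2 b≤2 = begin
    ‖ ev p a ⊕ b ⊛ dd p a b ‖                         ≤⟨ ⊕-bound (ev p a) (b ⊛ dd p a b) (‖ev‖ p a≤2) (⊛-bound b (dd p a b) b≤2 (‖dd‖ p a≤2 b≤2)) ⟩
    κ (+ evBound p) + κ (+ 2) * κ (+ ddBound p)       ≡⟨ cong (λ u → κ (+ evBound p) + u) (κℕ-* 2 (ddBound p)) ⟨
    κ (+ evBound p) + κ (+ (2 ℕ.* ddBound p))         ≡⟨ κℕ-+ (evBound p) (2 ℕ.* ddBound p) ⟨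
    κ (+ ddBound (c ∷ p))                             ∎
    where open ≤-Reasoning

  -- Induction along Horner's scheme: the change of `ev p` is (a - a₀) times a divided difference,
  -- and b D - a₀ D₀ splits as (b - a₀) D + a₀ (D - D₀).
  dd-Lipschitz : ∀ p {a₀ a b ρ} → Small a₀ → Small a → Small b → ‖ a ⊖ a₀ ‖ ≤ ρ → ‖ b ⊖ a₀ ‖ ≤ ρ →
    ‖ dd p a b ⊖ dd p a₀ a₀ ‖ ≤ κ (+ ddLip p) * ρ
  dd-Lipschitz [] {a₀} {a} {b} {ρ} s₀ s t a≈ b≈ = 0≤* (κ-pos 0) (ℚ.≤-trans 0≤‖ a ⊖ a₀ ‖ a≈)
  dd-Lipschitz (c ∷ p) {a₀} {a} {b} {ρ} s₀ s t a≈ b≈ = begin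
    ‖ ev p a ⊕ b ⊛ D ⊖ (ev p a₀ ⊕ a₀ ⊛ D₀) ‖          ≡⟨ cong ‖_‖ regroup ⟩
    ‖ (a ⊖ a₀) ⊛ D₁ ⊕ ((b ⊖ a₀) ⊛ D ⊕ a₀ ⊛ (D ⊖ D₀)) ‖
      ≤⟨ ⊕-bound ((a ⊖ a₀) ⊛ D₁) ((b ⊖ a₀) ⊛ D ⊕ a₀ ⊛ (D ⊖ D₀)) (⊛-bound (a ⊖ a₀) D₁ a≈ (‖dd‖ p s₀ s))
           (⊕-bound ((b ⊖ a₀) ⊛ D) (a₀ ⊛ (D ⊖ D₀)) (⊛-bound (b ⊖ a₀) D b≈ (‖dd‖ p s t))
             (⊛-bound a₀ (D ⊖ D₀) s₀ (dd-Lipschitz p s₀ s t a≈ b≈))) ⟩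
    ρ * β + (ρ * β + κ (+ 2) * (κ (+ ddLip p) * ρ))
      ≡⟨ trans (solve 4 (λ ρ β l t → ρ :* β :+ (ρ :* β :+ t :* (l :* ρ)) := ((con 1ℚ :+ con 1ℚ) :* β :+ t :* l) :* ρ) refl ρ β (κ (+ ddLip p)) (κ (+ 2)))
           (cong (λ u → (u * β + κ (+ 2) * κ (+ ddLip p)) * ρ) (sym (trans (κℕ-+ 1 1) (cong₂ _+_ κ-1 κ-1)))) ⟩
    (κ (+ 2) * β + κ (+ 2) * κ (+ ddLip p)) * ρ
      ≡⟨ cong (_* ρ) (trans (κℕ-+ (2 ℕ.* ddBound p) (2 ℕ.* ddLip p)) (cong₂ _+_ (κℕ-* 2 (ddBound p)) (κℕ-* 2 (ddLip p)))) ⟨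
    κ (+ ddLip (c ∷ p)) * ρ ∎
    where
    open ≤-Reasoning
    open +-*-Solver
    D₀ = dd p a₀ a₀
    D₁ = dd p a₀ a
    D = dd p a b
    β = κ (+ ddBound p)
    regroup : ev p a ⊕ b ⊛ D ⊖ (ev p a₀ ⊕ a₀ ⊛ D₀) ≡ (a ⊖ a₀) ⊛ D₁ ⊕ ((b ⊖ a₀) ⊛ D ⊕ a₀ ⊛ (D ⊖ D₀))
    regroup = trans (cong (λ u → u ⊕ b ⊛ D ⊖ (ev p a₀ ⊕ a₀ ⊛ D₀)) (ev-dd p a₀ a))
      (C.solve 7 (λ e a₀ a b d D D₀ → (e C.:+ (a C.:- a₀) C.:* d) C.:+ b C.:* D C.:- (e C.:+ a₀ C.:* D₀)
          C.:= (a C.:- a₀) C.:* d C.:+ ((b C.:- a₀) C.:* D C.:+ a₀ C.:* (D C.:- D₀))) refl (ev p a₀) a₀ a b D₁ D D₀)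
      where module C = ℂ-Solver

  -- Approximate roots

  κ-suc-positive : ∀ n → ℚ.Positive (κ (+ suc n))
  κ-suc-positive n = ℚ.positive (ℚ.<-≤-trans (ℚ.positive⁻¹ 1ℚ) (subst (_≤ κ (+ suc n)) κ-1 (κ-mono (ℤ.+≤+ (ℕ.s≤s ℕ.z≤n)))))

  κ-cancel : ∀ n {p q} → κ (+ suc n) * p ≤ κ (+ suc n) * q → p ≤ q
  κ-cancel n = ℚ.*-cancelˡ-≤-pos (κ (+ suc n)) {{κ-suc-positive n}}

  -- For scales such as 2^k and `S`, which are positive without being visibly successors.
  κ-cancel′ : ∀ m → 0 ℕ.< m → ∀ p q → κ (+ m) * p ≤ κ (+ m) * q → p ≤ q
  κ-cancel′ (suc m) _ p q = κ-cancel m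

  κ-inverse : ∀ n → ∃ λ v → κ (+ suc n) * v ≡ 1ℚ
  κ-inverse n = (ℚ.1/ κ (+ suc n)) {{nz}} , ℚ.*-inverseʳ (κ (+ suc n)) {{nz}}
    where nz = ℚ.pos⇒nonZero (κ (+ suc n)) {{κ-suc-positive n}}

  κ-2 : κ (+ 2) ≡ 1ℚ + 1ℚ
  κ-2 = trans (κℕ-+ 1 1) (cong₂ _+_ κ-1 κ-1)

  n≤2^n : ∀ n → n ℕ.≤ 2 ℕ.^ n
  n≤2^n zero    = ℕ.z≤n
  n≤2^n (suc n) = ℕ.+-mono-≤ (ℕ.m^n>0 2 n) (ℕ.≤-trans (n≤2^n n) (ℕ.m≤m+n (2 ℕ.^ n) 0))

  κ-2^-suc : ∀ k → κ (+ (2 ℕ.^ suc k)) ≡ (1ℚ + 1ℚ) * κ (+ (2 ℕ.^ k))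
  κ-2^-suc k = trans (κℕ-* 2 (2 ℕ.^ k)) (cong (_* κ (+ (2 ℕ.^ k))) κ-2)

  -- Stands in for a root in the closure of the region. The rate 2^k is the one that bisection and
  -- Newton iteration deliver; the constant `C` is free, so that it can absorb a cofactor.
  Approachable : Poly → (ℂ → Set) → Set
  Approachable P Region = ∃ λ C → ∀ k → ∃ λ a → Region a × Small a × κ (+ (2 ℕ.^ k)) * ‖ ev P a ‖ ≤ κ (+ C)

  approachable-∣ₚ : ∀ P M {Region} → P ∣ₚ M → Approachable P Region → Approachable M Region
  approachable-∣ₚ P M {Region} (Q , PQ≋M) (C , approach) = C ℕ.* evBound Q , λ k → extend k (approach k)
    where
    open ≤-Reasoning
    extend : ∀ k → (∃ λ a → Region a × Small a × κ (+ (2 ℕ.^ k)) * ‖ ev P a ‖ ≤ κ (+ C)) →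
      ∃ λ a → Region a × Small a × κ (+ (2 ℕ.^ k)) * ‖ ev M a ‖ ≤ κ (+ (C ℕ.* evBound Q))
    extend k (a , in-region , small , close) = a , in-region , small , (begin
      2^k * ‖ ev M a ‖                   ≡⟨ cong (λ u → 2^k * ‖ u ‖) (trans (sym (ev-cong (P *ₚ Q) M a PQ≋M)) (ev-*ₚ P Q a)) ⟩
      2^k * ‖ ev P a ⊛ ev Q a ‖          ≤⟨ *-monoˡ₀ (κ-pos (2 ℕ.^ k)) (⊛-bound (ev P a) (ev Q a) ℚ.≤-refl (‖ev‖ Q small)) ⟩
      2^k * (‖ ev P a ‖ * ε)             ≡⟨ ℚ.*-assoc 2^k (‖ ev P a ‖) ε ⟨
      (2^k * ‖ ev P a ‖) * ε             ≤⟨ *-monoʳ₀ (κ-pos (evBound Q)) close ⟩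
      κ (+ C) * ε                        ≡⟨ κℕ-* C (evBound Q) ⟨
      κ (+ (C ℕ.* evBound Q))            ∎)
      where
      2^k = κ (+ (2 ℕ.^ k))
      ε = κ (+ evBound Q)

  multiple-small : ∀ P {Region} → Approachable P Region → ∀ M → P ∣ₚ M → ∀ T →
    ∃ λ a → Region a × Small a × κ (+ T) * ‖ ev M a ‖ ≤ 1ℚ
  multiple-small P {Region} approach M P∣M T = shrink (approachable-∣ₚ P M P∣M approach)
    where
    open ≤-Reasoning
    open +-*-Solver
    shrink : Approachable M Region → ∃ λ a → Region a × Small a × κ (+ T) * ‖ ev M a ‖ ≤ 1ℚ
    shrink (C , approach′) = conclude (approach′ K)
      where
      -- With this exponent T C = K ≤ 2^K, so the error C / 2^K multiplied by T is at most 1.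
      K = T ℕ.* C
      2^k = κ (+ (2 ℕ.^ K))
      conclude : (∃ λ a → Region a × Small a × 2^k * ‖ ev M a ‖ ≤ κ (+ C)) → ∃ λ a → Region a × Small a × κ (+ T) * ‖ ev M a ‖ ≤ 1ℚ
      conclude (a , in-region , small , close) = a , in-region , small , κ-cancel′ (2 ℕ.^ K) (ℕ.m^n>0 2 K) (κ (+ T) * ‖ ev M a ‖) 1ℚ (begin
        2^k * (κ (+ T) * ‖ ev M a ‖)     ≡⟨ solve 3 (λ k t m → k :* (t :* m) := t :* (k :* m)) refl 2^k (κ (+ T)) (‖ ev M a ‖) ⟩
        κ (+ T) * (2^k * ‖ ev M a ‖)     ≤⟨ *-monoˡ₀ (κ-pos T) close ⟩
        κ (+ T) * κ (+ C)                ≡⟨ κℕ-* T C ⟨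
        κ (+ K)                          ≤⟨ κ-mono (ℤ.+≤+ (n≤2^n K)) ⟩
        2^k                              ≡⟨ ℚ.*-identityʳ 2^k ⟨
        2^k * 1ℚ                         ∎)

  -- As c stays fixed, `ev-dd` gives P(a') = (1 - c d) P(a) exactly, with d the divided difference
  -- of P at a and a', so `contract` halves the value at every step. The moves add up to at most ‖c‖
  -- (η + η/2 + ...) = 2 ‖c‖ η, which `room` keeps within ρ.
  module Newton (P : Poly) (a₀ c : ℂ) (η ρ : ℚ)
    (ball : ∀ a → ‖ a ⊖ a₀ ‖ ≤ ρ → Small a)
    (start : ‖ ev P a₀ ‖ ≤ η)
    (room : ‖ c ‖ * (η + η) ≤ ρ)
    (contract : ∀ a b → ‖ a ⊖ a₀ ‖ ≤ ρ → ‖ b ⊖ a₀ ‖ ≤ ρ → ‖ 1ℂ ⊖ c ⊛ dd P a b ‖ ≤ ½) where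

    record Iterate (k : ℕ) : Set where
      field
        point : ℂ
        bound : ℚ
        halved : κ (+ (2 ℕ.^ k)) * bound ≡ η
        value : ‖ ev P point ‖ ≤ bound
        -- The distance travelled so far plus the geometric series of all later moves: the total
        -- never increases, so no iterate leaves the disc.
        inside : ‖ point ⊖ a₀ ‖ + ‖ c ‖ * (bound + bound) ≤ ρ

      bound≥0 : 0ℚ ≤ bound
      bound≥0 = ℚ.≤-trans 0≤‖ ev P point ‖ value

      in-ball : ‖ point ⊖ a₀ ‖ ≤ ρ
      in-ball = ℚ.≤-trans (subst (_≤ ‖ point ⊖ a₀ ‖ + ‖ c ‖ * (bound + bound)) (ℚ.+-identityʳ _)
        (ℚ.+-monoʳ-≤ (‖ point ⊖ a₀ ‖) (0≤* 0≤‖ c ‖ (0≤+ bound≥0 bound≥0)))) inside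

    iterate : ∀ k → Iterate k
    iterate zero = record
      { point = a₀ ; bound = η
      ; halved = trans (cong (_* η) κ-1) (ℚ.*-identityˡ η)
      ; value = start
      ; inside = subst (_≤ ρ) (trans (sym (ℚ.+-identityˡ _)) (cong (λ u → ‖ u ‖ + ‖ c ‖ * (η + η)) (sym a₀⊖a₀))) room }
      where
      a₀⊖a₀ : a₀ ⊖ a₀ ≡ 0ℂ
      a₀⊖a₀ = solve 1 (λ a → a :- a := con 0ℂ) refl a₀
        where open ℂ-Solver
    iterate (suc k) = record
      { point = a' ; bound = ½ * t
      ; halved = trans (cong (_* (½ * t)) (κ-2^-suc k))
          (trans (solve 2 (λ p t → (con 1ℚ :+ con 1ℚ) :* p :* (con ½ :* t) := p :* t) refl (κ (+ (2 ℕ.^ k))) t) halved)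
      ; value = begin
          ‖ ev P a' ‖                       ≡⟨ cong ‖_‖ (trans (ev-dd P a a') factor) ⟩
          ‖ (1ℂ ⊖ c ⊛ dd P a a') ⊛ ev P a ‖ ≤⟨ ⊛-bound (1ℂ ⊖ c ⊛ dd P a a') (ev P a) (contract a a' in-ball a'-in) value ⟩
          ½ * t                             ∎
      ; inside = inside' }
      where
      open Iterate (iterate k) renaming (point to a; bound to t)
      open ≤-Reasoning
      open +-*-Solver
      module C = ℂ-Solver
      h = c ⊛ ev P a
      a' = a ⊖ h
      ‖h‖ : ‖ h ‖ ≤ ‖ c ‖ * t
      ‖h‖ = ⊛-bound c (ev P a) ℚ.≤-refl value
      factor : ev P a ⊕ (a' ⊖ a) ⊛ dd P a a' ≡ (1ℂ ⊖ c ⊛ dd P a a') ⊛ ev P a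
      factor = C.solve 4 (λ e a c d → e C.:+ ((a C.:- c C.:* e) C.:- a) C.:* d C.:= (C.con 1ℂ C.:- c C.:* d) C.:* e) refl (ev P a) a c (dd P a a')
      dist : ‖ a' ⊖ a₀ ‖ ≤ ‖ a ⊖ a₀ ‖ + ‖ c ‖ * t
      dist = subst (λ u → ‖ u ‖ ≤ ‖ a ⊖ a₀ ‖ + ‖ c ‖ * t)
        (C.solve 3 (λ a b h → (a C.:- b) C.:+ (C.:- h) C.:= (a C.:- h) C.:- b) refl a a₀ h)
        (⊕-bound (a ⊖ a₀) (⊝ h) ℚ.≤-refl (ℚ.≤-trans (ℚ.≤-reflexive (‖⊝‖ h)) ‖h‖))
      inside' : ‖ a' ⊖ a₀ ‖ + ‖ c ‖ * (½ * t + ½ * t) ≤ ρ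
      inside' = begin
        ‖ a' ⊖ a₀ ‖ + ‖ c ‖ * (½ * t + ½ * t)              ≤⟨ ℚ.+-monoˡ-≤ (‖ c ‖ * (½ * t + ½ * t)) dist ⟩
        ‖ a ⊖ a₀ ‖ + ‖ c ‖ * t + ‖ c ‖ * (½ * t + ½ * t)   ≡⟨ solve 3 (λ x c t → x :+ c :* t :+ c :* (con ½ :* t :+ con ½ :* t) := x :+ c :* (t :+ t)) refl (‖ a ⊖ a₀ ‖) (‖ c ‖) t ⟩
        ‖ a ⊖ a₀ ‖ + ‖ c ‖ * (t + t)                       ≤⟨ inside ⟩
        ρ                                                  ∎
      a'-in : ‖ a' ⊖ a₀ ‖ ≤ ρ
      a'-in = ℚ.≤-trans (subst (_≤ ‖ a' ⊖ a₀ ‖ + ‖ c ‖ * (½ * t + ½ * t)) (ℚ.+-identityʳ _)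
        (ℚ.+-monoʳ-≤ (‖ a' ⊖ a₀ ‖) (0≤* 0≤‖ c ‖ (0≤+ (0≤* (ℚ.nonNegative⁻¹ ½) bound≥0) (0≤* (ℚ.nonNegative⁻¹ ½) bound≥0))))) inside'

    approachable : ∀ C → η ≤ κ (+ C) → Approachable P (λ a → ‖ a ⊖ a₀ ‖ ≤ ρ)
    approachable C η≤C = C , λ k → let open Iterate (iterate k) in
      point , in-ball , ball point in-ball ,
      ℚ.≤-trans (*-monoˡ₀ (κ-pos _) value) (ℚ.≤-trans (ℚ.≤-reflexive halved) η≤C)

  -- Positive real roots

  real : ℚ → ℂ
  real x = x +i 0ℚ

  NonnegReal : ℂ → Set
  NonnegReal a = ∃ λ y → 0ℚ ≤ y × a ≡ real y

  im-ev-real : ∀ p x → im (ev p (real x)) ≡ 0ℚ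
  im-ev-real []      x = refl
  im-ev-real (c ∷ p) x = trans (cong (λ u → 0ℚ + (x * u + 0ℚ * re (ev p (real x)))) (im-ev-real p x))
    (solve 2 (λ x r → con 0ℚ :+ (x :* con 0ℚ :+ con 0ℚ :* r) := con 0ℚ) refl x (re (ev p (real x))))
    where open +-*-Solver

  re-ev-real : ∀ c p x → re (ev (c ∷ p) (real x)) ≡ κ c + x * re (ev p (real x))
  re-ev-real c p x = solve 4 (λ c x r i → c :+ (x :* r :- con 0ℚ :* i) := c :+ x :* r) refl (κ c) x (re (ev p (real x))) (im (ev p (real x)))
    where open +-*-Solver

  ∣re∣≤‖_‖ : ∀ z → ∣ re z ∣ ≤ ‖ z ‖
  ∣re∣≤‖ z ‖ = subst (_≤ ‖ z ‖) (ℚ.+-identityʳ _) (ℚ.+-monoʳ-≤ (∣ re z ∣) (ℚ.0≤∣p∣ (im z)))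

  -- The left ends serve as approximate roots: 0 ≤ f(lo) ≤ f(lo) - f(hi), and the divided difference
  -- bounds the right side by a constant times the width. No continuity argument is involved.
  module Bisection (P : Poly) (x : ℚ) (0≤x : 0ℚ ≤ x) (x≤2 : x ≤ κ (+ 2))
    (f0≥0 : 0ℚ ≤ re (ev P (real 0ℚ))) (fx≤0 : re (ev P (real x)) ≤ 0ℚ) where

    f : ℚ → ℚ
    f y = re (ev P (real y))

    record Bracket (k : ℕ) : Set where
      field
        lo δ : ℚ
        halved : κ (+ (2 ℕ.^ k)) * δ ≡ x
        lo≥0 : 0ℚ ≤ lo
        δ≥0 : 0ℚ ≤ δ
        hi≤2 : lo + δ ≤ κ (+ 2)
        flo≥0 : 0ℚ ≤ f lo
        fhi≤0 : f (lo + δ) ≤ 0ℚ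

    bisect : ∀ k → Bracket k
    bisect zero = record
      { lo = 0ℚ ; δ = x ; halved = trans (cong (_* x) κ-1) (ℚ.*-identityˡ x)
      ; lo≥0 = ℚ.≤-refl ; δ≥0 = 0≤x ; hi≤2 = subst (_≤ κ (+ 2)) (sym (ℚ.+-identityˡ x)) x≤2
      ; flo≥0 = f0≥0 ; fhi≤0 = subst (λ u → f u ≤ 0ℚ) (sym (ℚ.+-identityˡ x)) fx≤0 }
    bisect (suc k) with bisect k
    ... | record { lo = lo ; δ = δ ; halved = halved ; lo≥0 = lo≥0 ; δ≥0 = δ≥0 ; hi≤2 = hi≤2 ; flo≥0 = flo≥0 ; fhi≤0 = fhi≤0 } = choose (ℚ.≤-total (f mid) 0ℚ)
      where
      open +-*-Solver
      mid = lo + ½ * δ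
      half≥0 : 0ℚ ≤ ½ * δ
      half≥0 = 0≤* (ℚ.nonNegative⁻¹ ½) δ≥0
      halved' : κ (+ (2 ℕ.^ suc k)) * (½ * δ) ≡ x
      halved' = trans (cong (_* (½ * δ)) (κ-2^-suc k))
        (trans (solve 2 (λ p t → (con 1ℚ :+ con 1ℚ) :* p :* (con ½ :* t) := p :* t) refl (κ (+ (2 ℕ.^ k))) δ) halved)
      hi≡ : mid + ½ * δ ≡ lo + δ
      hi≡ = solve 2 (λ l d → l :+ con ½ :* d :+ con ½ :* d := l :+ d) refl lo δ
      mid≤hi : mid ≤ lo + δ
      mid≤hi = subst (mid ≤_) hi≡ (subst (_≤ mid + ½ * δ) (ℚ.+-identityʳ mid) (ℚ.+-monoʳ-≤ mid half≥0))
      choose : f mid ≤ 0ℚ ⊎ 0ℚ ≤ f mid → Bracket (suc k)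
      choose (inj₁ fmid≤0) = record
        { lo = lo ; δ = ½ * δ ; halved = halved' ; lo≥0 = lo≥0 ; δ≥0 = half≥0
        ; hi≤2 = ℚ.≤-trans mid≤hi hi≤2 ; flo≥0 = flo≥0 ; fhi≤0 = fmid≤0 }
      choose (inj₂ fmid≥0) = record
        { lo = mid ; δ = ½ * δ ; halved = halved' ; lo≥0 = 0≤+ lo≥0 half≥0 ; δ≥0 = half≥0
        ; hi≤2 = subst (_≤ κ (+ 2)) (sym hi≡) hi≤2 ; flo≥0 = fmid≥0 ; fhi≤0 = subst (λ u → f u ≤ 0ℚ) (sym hi≡) fhi≤0 }

    approachable : Approachable P NonnegReal
    -- From 2^k δ = x ≤ 2 and |P(lo)| ≤ δ · `ddBound P`.
    approachable = 2 ℕ.* ddBound P , λ k → close k (bisect k)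
      where
      small : ∀ {y} → 0ℚ ≤ y → y ≤ κ (+ 2) → Small (real y)
      small {y} 0≤y y≤2 = subst (_≤ κ (+ 2)) (sym (trans (ℚ.+-identityʳ _) (ℚ.0≤p⇒∣p∣≡p 0≤y))) y≤2
      close : ∀ k → Bracket k → ∃ λ a → NonnegReal a × Small a × κ (+ (2 ℕ.^ k)) * ‖ ev P a ‖ ≤ κ (+ (2 ℕ.* ddBound P))
      close k record { lo = lo ; δ = δ ; halved = halved ; lo≥0 = lo≥0 ; δ≥0 = δ≥0 ; hi≤2 = hi≤2 ; flo≥0 = flo≥0 ; fhi≤0 = fhi≤0 } =
        real lo , (lo , lo≥0 , refl) , lo-small , (begin
          2^k * ‖ ev P (real lo) ‖           ≤⟨ *-monoˡ₀ (κ-pos _) value ⟩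
          2^k * (δ * β)                      ≡⟨ trans (sym (ℚ.*-assoc 2^k δ β)) (cong (_* β) halved) ⟩
          x * β                              ≤⟨ *-monoʳ₀ (κ-pos (ddBound P)) x≤2 ⟩
          κ (+ 2) * β                        ≡⟨ κℕ-* 2 (ddBound P) ⟨
          κ (+ (2 ℕ.* ddBound P))            ∎)
        where
        open ≤-Reasoning
        2^k = κ (+ (2 ℕ.^ k))
        β = κ (+ ddBound P)
        lo-small = small lo≥0 (ℚ.≤-trans (subst (_≤ lo + δ) (ℚ.+-identityʳ lo) (ℚ.+-monoʳ-≤ lo δ≥0)) hi≤2)
        hi-small = small (0≤+ lo≥0 δ≥0) hi≤2
        D = dd P (real lo) (real (lo + δ))
        E = (real (lo + δ) ⊖ real lo) ⊛ D
        width : real (lo + δ) ⊖ real lo ≡ real δ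
        width = cong₂ _+i_ (solve 2 (λ l d → l :+ d :- l := d) refl lo δ) refl
          where open +-*-Solver
        value : ‖ ev P (real lo) ‖ ≤ δ * β
        value = begin
          ∣ f lo ∣ + ∣ im (ev P (real lo)) ∣  ≡⟨ cong₂ _+_ (ℚ.0≤p⇒∣p∣≡p flo≥0) (cong ∣_∣ (im-ev-real P lo)) ⟩
          f lo + 0ℚ                           ≡⟨ solve 2 (λ l e → l :+ con 0ℚ := (l :+ e) :+ :- e) refl (f lo) (re E) ⟩
          f lo + re E + - re E                ≡⟨ cong (λ u → re u + - re E) (ev-dd P (real lo) (real (lo + δ))) ⟨
          f (lo + δ) + - re E                 ≤⟨ ℚ.+-mono-≤ fhi≤0 (p≤∣p∣ (- re E)) ⟩
          0ℚ + ∣ - re E ∣                     ≡⟨ trans (ℚ.+-identityˡ _) (ℚ.∣-p∣≡∣p∣ (re E)) ⟩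
          ∣ re E ∣                            ≤⟨ ∣re∣≤‖ E ‖ ⟩
          ‖ E ‖                               ≡⟨ cong (λ u → ‖ u ⊛ D ‖) width ⟩
          ‖ real δ ⊛ D ‖                      ≤⟨ ⊛-bound (real δ) D (ℚ.≤-reflexive (trans (ℚ.+-identityʳ _) (ℚ.0≤p⇒∣p∣≡p δ≥0))) (‖dd‖ P lo-small hi-small) ⟩
          δ * β                               ∎
          where open +-*-Solver

  -- What is left of a Newman polynomial after its low coefficients have been read: possibly empty,
  -- with no condition at either end.
  ZeroOne : Poly → Set
  ZeroOne = All (λ c → c ≡ 0ℤ ⊎ c ≡ 1ℤ)

  ev-ZeroOne-nonneg : ∀ {n x} → ZeroOne n → 0ℚ ≤ x → 0ℚ ≤ re (ev n (real x))
  ev-ZeroOne-nonneg []                       0≤x = ℚ.≤-refl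
  ev-ZeroOne-nonneg {c ∷ n} {x} (c01 ∷ n01) 0≤x = subst (0ℚ ≤_) (sym (re-ev-real c n x))
    (0≤+ (c≥0 c01) (0≤* 0≤x (ev-ZeroOne-nonneg n01 0≤x)))
    where
    c≥0 : ∀ {c} → c ≡ 0ℤ ⊎ c ≡ 1ℤ → 0ℚ ≤ κ c
    c≥0 (inj₁ refl) = κ-pos 0
    c≥0 (inj₂ refl) = κ-pos 1

  positive-root⇒¬Newman : ∀ P → Approachable P NonnegReal → ∀ {N} → Newman N → P ∣ₚ N → ⊥
  positive-root⇒¬Newman P approach {[]}    (_ , _ , ()) _
  -- The argument 2 requests a value of size at most 1/2, below the lower bound 1.
  positive-root⇒¬Newman P approach {c ∷ n} (c01 ∷ n01 , _ , refl) P∣N = absurd (multiple-small P approach (1ℤ ∷ n) P∣N 2)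
    where
    open ≤-Reasoning
    one≤ : ∀ {y} → 0ℚ ≤ y → 1ℚ ≤ ‖ ev (1ℤ ∷ n) (real y) ‖
    one≤ {y} 0≤y = begin
      1ℚ                                  ≡⟨ ℚ.+-identityʳ 1ℚ ⟨
      1ℚ + 0ℚ                             ≤⟨ ℚ.+-mono-≤ (ℚ.≤-reflexive (sym κ-1)) (0≤* 0≤y (ev-ZeroOne-nonneg n01 0≤y)) ⟩
      κ 1ℤ + y * re (ev n (real y))       ≡⟨ re-ev-real 1ℤ n y ⟨
      re (ev (1ℤ ∷ n) (real y))           ≤⟨ p≤∣p∣ (re (ev (1ℤ ∷ n) (real y))) ⟩
      ∣ re (ev (1ℤ ∷ n) (real y)) ∣       ≤⟨ ∣re∣≤‖ ev (1ℤ ∷ n) (real y) ‖ ⟩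
      ‖ ev (1ℤ ∷ n) (real y) ‖            ∎
    absurd : (∃ λ a → NonnegReal a × Small a × κ (+ 2) * ‖ ev (1ℤ ∷ n) a ‖ ≤ 1ℚ) → ⊥
    absurd (_ , (y , 0≤y , refl) , _ , close) = ℚ.<-irrefl refl (begin-strict
      1ℚ                                  <⟨ ℚ.+-monoʳ-< 1ℚ (ℚ.positive⁻¹ 1ℚ) ⟩
      1ℚ + 1ℚ                             ≡⟨ trans (sym κ-2) (sym (ℚ.*-identityʳ (κ (+ 2)))) ⟩
      κ (+ 2) * 1ℚ                        ≤⟨ *-monoˡ₀ (κ-pos 2) (one≤ 0≤y) ⟩
      κ (+ 2) * ‖ ev (1ℤ ∷ n) (real y) ‖  ≤⟨ close ⟩
      1ℚ                                  ∎)

  -- s^(length p) · p(u / s)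
  homogeneous : ℤ → ℕ → Poly → ℤ
  homogeneous u s []      = 0ℤ
  homogeneous u s (c ∷ p) = c ℤ.* (+ (s ℕ.^ suc (length p))) ℤ.+ u ℤ.* homogeneous u s p

  -- Clearing denominators turns the sign of p at u / s into the sign of an integer.
  homogeneous-ev : ∀ u s p x → ι (+ s) ⊛ x ≡ ι u → ι (+ (s ℕ.^ length p)) ⊛ ev p x ≡ ι (homogeneous u s p)
  homogeneous-ev u s []      x sx≡u = trans (solve 1 (λ a → a :* con 0ℂ := con 0ℂ) refl (ι 1ℤ)) (sym ι-0)
    where open ℂ-Solver
  homogeneous-ev u s (c ∷ p) x sx≡u = begin
    ι (+ (s ℕ.* sᵈ)) ⊛ (ι c ⊕ x ⊛ ev p x)
      ≡⟨ cong (_⊛ (ι c ⊕ x ⊛ ev p x)) s^suc ⟩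
    ι (+ s) ⊛ ι (+ sᵈ) ⊛ (ι c ⊕ x ⊛ ev p x)
      ≡⟨ solve 5 (λ s d c x e → s :* d :* (c :+ x :* e) := c :* (s :* d) :+ (s :* x) :* (d :* e)) refl (ι (+ s)) (ι (+ sᵈ)) (ι c) x (ev p x) ⟩
    ι c ⊛ (ι (+ s) ⊛ ι (+ sᵈ)) ⊕ (ι (+ s) ⊛ x) ⊛ (ι (+ sᵈ) ⊛ ev p x)
      ≡⟨ cong₂ (λ v w → ι c ⊛ v ⊕ w) (sym s^suc) (cong₂ _⊛_ sx≡u (homogeneous-ev u s p x sx≡u)) ⟩
    ι c ⊛ ι (+ (s ℕ.* sᵈ)) ⊕ ι u ⊛ ι (homogeneous u s p)
      ≡⟨ trans (ι-+ _ _) (cong₂ _⊕_ (ι-* c _) (ι-* u _)) ⟨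
    ι (homogeneous u s (c ∷ p)) ∎
    where
    open ≡-Reasoning
    open ℂ-Solver
    sᵈ = s ℕ.^ length p
    s^suc : ι (+ (s ℕ.* sᵈ)) ≡ ι (+ s) ⊛ ι (+ sᵈ)
    s^suc = trans (cong ι (ℤ.pos-* s sᵈ)) (ι-* (+ s) (+ sᵈ))

  sign-change⇒approachable : ∀ p u s → u ℕ.≤ 2 ℕ.* suc s → homogeneous (+ u) (suc s) (1ℤ ∷ p) ℤ.≤ 0ℤ → Approachable (1ℤ ∷ p) NonnegReal
  sign-change⇒approachable p u s u≤2s H≤0 = Bisection.approachable P x 0≤x x≤2 f0≥0 fx≤0
    where
    P = 1ℤ ∷ p
    v = proj₁ (κ-inverse s)
    x = κ (+ u) * v
    sx≡u : κ (+ suc s) * x ≡ κ (+ u)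
    sx≡u = trans (solve 3 (λ s u v → s :* (u :* v) := u :* (s :* v)) refl (κ (+ suc s)) (κ (+ u)) v)
      (trans (cong (κ (+ u) *_) (proj₂ (κ-inverse s))) (ℚ.*-identityʳ _))
      where open +-*-Solver
    0≤x : 0ℚ ≤ x
    0≤x = κ-cancel s (subst₂ _≤_ (sym (ℚ.*-zeroʳ (κ (+ suc s)))) (sym sx≡u) (κ-pos u))
    x≤2 : x ≤ κ (+ 2)
    x≤2 = κ-cancel s (subst₂ _≤_ (sym sx≡u) (trans (κℕ-* 2 (suc s)) (ℚ.*-comm (κ (+ 2)) (κ (+ suc s)))) (κ-mono (ℤ.+≤+ u≤2s)))
    f0≥0 : 0ℚ ≤ re (ev P (real 0ℚ))
    f0≥0 = subst (0ℚ ≤_) (sym (trans (re-ev-real 1ℤ p 0ℚ) (cong (λ t → κ 1ℤ + t) (ℚ.*-zeroˡ (re (ev p (real 0ℚ))))))) (0≤+ (κ-pos 1) ℚ.≤-refl)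
    scale : ι (+ suc s) ⊛ real x ≡ ι (+ u)
    scale = cong₂ _+i_ (trans (solve 2 (λ a b → a :* b :- con 0ℚ :* con 0ℚ := a :* b) refl (κ (+ suc s)) x) sx≡u)
      (solve 2 (λ a b → a :* con 0ℚ :+ con 0ℚ :* b := con 0ℚ) refl (κ (+ suc s)) x)
      where open +-*-Solver
    fx≤0 : re (ev P (real x)) ≤ 0ℚ
    fx≤0 = κ-cancel′ M (ℕ.m^n>0 (suc s) (length P)) (re z) 0ℚ (begin
      κ (+ M) * re z                         ≡⟨ solve 3 (λ a b c → a :* b := a :* b :- con 0ℚ :* c) refl (κ (+ M)) (re z) (im z) ⟩
      re (ι (+ M) ⊛ z)                       ≡⟨ cong re (homogeneous-ev (+ u) (suc s) P (real x) scale) ⟩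
      κ (homogeneous (+ u) (suc s) P)        ≤⟨ κ-mono H≤0 ⟩
      κ 0ℤ                                   ≡⟨ trans κ-0 (sym (ℚ.*-zeroʳ (κ (+ M)))) ⟩
      κ (+ M) * 0ℚ                           ∎)
      where
      open ≤-Reasoning
      open +-*-Solver
      M = suc s ℕ.^ length P
      z = ev P (real x)

-- Products, reversal and sign changes of polynomials

module Polynomials where

  open import Data.Integer using (_+_; _*_; -_)
  open import Data.Integer.Solver using (module +-*-Solver)

  coeff-+ₚ : ∀ p q n → coeff (p +ₚ q) n ≡ coeff p n + coeff q n
  coeff-+ₚ []      q       n       = sym (ℤ.+-identityˡ _)
  coeff-+ₚ (a ∷ p) []      n       = sym (ℤ.+-identityʳ _)
  coeff-+ₚ (a ∷ p) (b ∷ q) zero    = refl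
  coeff-+ₚ (a ∷ p) (b ∷ q) (suc n) = coeff-+ₚ p q n

  coeff-map : ∀ c p n → coeff (map (c *_) p) n ≡ c * coeff p n
  coeff-map c []      n       = sym (ℤ.*-zeroʳ c)
  coeff-map c (a ∷ p) zero    = refl
  coeff-map c (a ∷ p) (suc n) = coeff-map c p n

  coeff-∷-*ₚ : ∀ a p q n → coeff ((a ∷ p) *ₚ q) n ≡ a * coeff q n + coeff (0ℤ ∷ (p *ₚ q)) n
  coeff-∷-*ₚ a p q n = trans (coeff-+ₚ (map (a *_) q) (0ℤ ∷ (p *ₚ q)) n) (cong (λ u → u + coeff (0ℤ ∷ (p *ₚ q)) n) (coeff-map a q n))

  tail : Poly → Poly
  tail []      = []
  tail (_ ∷ p) = p

  coeff-tail : ∀ p n → coeff (tail p) n ≡ coeff p (suc n)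
  coeff-tail []      n = refl
  coeff-tail (_ ∷ p) n = refl

  -- The product is defined by recursion on its left factor. Peeling the right factor instead
  -- exposes the quotient one coefficient at a time, as division from the constant term requires.
  coeff-*ₚ-tail : ∀ p q n → coeff (p *ₚ q) n ≡ coeff q 0 * coeff p n + coeff (0ℤ ∷ (p *ₚ tail q)) n
  coeff-*ₚ-tail []      q zero    = sym (trans (ℤ.+-identityʳ _) (ℤ.*-zeroʳ (coeff q 0)))
  coeff-*ₚ-tail []      q (suc n) = sym (trans (ℤ.+-identityʳ _) (ℤ.*-zeroʳ (coeff q 0)))
  coeff-*ₚ-tail (a ∷ p) q zero    = trans (coeff-∷-*ₚ a p q 0) (cong (_+ 0ℤ) (ℤ.*-comm a (coeff q 0)))
  coeff-*ₚ-tail (a ∷ p) q (suc n) = begin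
    coeff ((a ∷ p) *ₚ q) (suc n)                                              ≡⟨ coeff-∷-*ₚ a p q (suc n) ⟩
    a * coeff q (suc n) + coeff (p *ₚ q) n                                    ≡⟨ cong₂ (λ u v → a * u + v) (sym (coeff-tail q n)) (coeff-*ₚ-tail p q n) ⟩
    a * coeff (tail q) n + (coeff q 0 * coeff p n + coeff (0ℤ ∷ (p *ₚ tail q)) n)
      ≡⟨ solve 3 (λ x y z → x :+ (y :+ z) := y :+ (x :+ z)) refl (a * coeff (tail q) n) (coeff q 0 * coeff p n) (coeff (0ℤ ∷ (p *ₚ tail q)) n) ⟩
    coeff q 0 * coeff p n + (a * coeff (tail q) n + coeff (0ℤ ∷ (p *ₚ tail q)) n)
      ≡⟨ cong (λ u → coeff q 0 * coeff p n + u) (coeff-∷-*ₚ a p (tail q) n) ⟨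
    coeff q 0 * coeff p n + coeff ((a ∷ p) *ₚ tail q) n                       ∎
    where
    open ≡-Reasoning
    open +-*-Solver

  coeff-*ₚ-0 : ∀ p q → coeff (p *ₚ q) 0 ≡ coeff p 0 * coeff q 0
  coeff-*ₚ-0 p q = trans (coeff-*ₚ-tail p q 0) (trans (ℤ.+-identityʳ _) (ℤ.*-comm (coeff q 0) (coeff p 0)))

  *ₚ-congʳ : ∀ p q r → q ≋ r → (p *ₚ q) ≋ (p *ₚ r)
  *ₚ-congʳ []      q r q≋r n = refl
  *ₚ-congʳ (a ∷ p) q r q≋r n = trans (coeff-∷-*ₚ a p q n) (trans (cong₂ (λ u v → a * u + v) (q≋r n) (shift n)) (sym (coeff-∷-*ₚ a p r n)))
    where
    shift : ∀ n → coeff (0ℤ ∷ (p *ₚ q)) n ≡ coeff (0ℤ ∷ (p *ₚ r)) n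
    shift zero    = refl
    shift (suc n) = *ₚ-congʳ p q r q≋r n

  map-*ₚ : ∀ c p q n → coeff (map (c *_) p *ₚ q) n ≡ c * coeff (p *ₚ q) n
  map-*ₚ c []      q n = sym (ℤ.*-zeroʳ c)
  map-*ₚ c (a ∷ p) q n = begin
    coeff (map (c *_) (a ∷ p) *ₚ q) n                                 ≡⟨ coeff-∷-*ₚ (c * a) (map (c *_) p) q n ⟩
    (c * a) * coeff q n + coeff (0ℤ ∷ (map (c *_) p *ₚ q)) n          ≡⟨ cong₂ _+_ (ℤ.*-assoc c a (coeff q n)) (shift n) ⟩
    c * (a * coeff q n) + c * coeff (0ℤ ∷ (p *ₚ q)) n                 ≡⟨ ℤ.*-distribˡ-+ c (a * coeff q n) (coeff (0ℤ ∷ (p *ₚ q)) n) ⟨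
    c * (a * coeff q n + coeff (0ℤ ∷ (p *ₚ q)) n)                     ≡⟨ cong (c *_) (coeff-∷-*ₚ a p q n) ⟨
    c * coeff ((a ∷ p) *ₚ q) n                                        ∎
    where
    open ≡-Reasoning
    shift : ∀ n → coeff (0ℤ ∷ (map (c *_) p *ₚ q)) n ≡ c * coeff (0ℤ ∷ (p *ₚ q)) n
    shift zero    = sym (ℤ.*-zeroʳ c)
    shift (suc n) = map-*ₚ c p q n

  *ₚ-map : ∀ c p q n → coeff (p *ₚ map (c *_) q) n ≡ c * coeff (p *ₚ q) n
  *ₚ-map c []      q n = sym (ℤ.*-zeroʳ c)
  *ₚ-map c (a ∷ p) q n = begin
    coeff ((a ∷ p) *ₚ map (c *_) q) n                                 ≡⟨ coeff-∷-*ₚ a p (map (c *_) q) n ⟩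
    a * coeff (map (c *_) q) n + coeff (0ℤ ∷ (p *ₚ map (c *_) q)) n   ≡⟨ cong₂ (λ u v → a * u + v) (coeff-map c q n) (shift n) ⟩
    a * (c * coeff q n) + c * coeff (0ℤ ∷ (p *ₚ q)) n
      ≡⟨ solve 4 (λ a c x y → a :* (c :* x) :+ c :* y := c :* (a :* x :+ y)) refl a c (coeff q n) (coeff (0ℤ ∷ (p *ₚ q)) n) ⟩
    c * (a * coeff q n + coeff (0ℤ ∷ (p *ₚ q)) n)                     ≡⟨ cong (c *_) (coeff-∷-*ₚ a p q n) ⟨
    c * coeff ((a ∷ p) *ₚ q) n                                        ∎
    where
    open ≡-Reasoning
    open +-*-Solver
    shift : ∀ n → coeff (0ℤ ∷ (p *ₚ map (c *_) q)) n ≡ c * coeff (0ℤ ∷ (p *ₚ q)) n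
    shift zero    = sym (ℤ.*-zeroʳ c)
    shift (suc n) = *ₚ-map c p q n

  -- The theorem for a single P. It holds vacuously when P has no Newman multiple, which is how
  -- refutations enter.
  Lifts : Poly → Set
  Lifts P = (∃ λ N → Newman N × P ∣ₚ N) → ∃ λ L → Littlewood L × P ∣ₚ L

  negate : Poly → Poly
  negate = map (-1ℤ *_)

  -1*-1* : ∀ i → -1ℤ * (-1ℤ * i) ≡ i
  -1*-1* i = solve 1 (λ i → con -1ℤ :* (con -1ℤ :* i) := i) refl i
    where open +-*-Solver

  lifts-negate : ∀ P → Lifts (negate P) → Lifts P
  lifts-negate P lift (N , newman , Q , PQ≋N) with lift (N , newman , negate Q , λ n →
      trans (map-*ₚ -1ℤ P (negate Q) n) (trans (cong (-1ℤ *_) (*ₚ-map -1ℤ P Q n)) (trans (-1*-1* _) (PQ≋N n))))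
  ... | L , littlewood , Q' , eq = L , littlewood , negate Q' , λ n →
      trans (*ₚ-map -1ℤ P Q' n) (trans (sym (map-*ₚ -1ℤ P Q' n)) (eq n))

  -- Reversal of polynomials

  zeros : ℕ → Poly
  zeros n = replicate n 0ℤ

  coeff-++ : ∀ p q n → coeff (p ++ q) n ≡ coeff p n + coeff (zeros (length p) ++ q) n
  coeff-++ []      q n       = sym (ℤ.+-identityˡ _)
  coeff-++ (a ∷ p) q zero    = sym (ℤ.+-identityʳ a)
  coeff-++ (a ∷ p) q (suc n) = coeff-++ p q n

  coeff-zeros-[0] : ∀ k n → coeff (zeros k ++ [ 0ℤ ]) n ≡ 0ℤ
  coeff-zeros-[0] zero    zero    = refl
  coeff-zeros-[0] zero    (suc n) = refl
  coeff-zeros-[0] (suc k) zero    = refl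
  coeff-zeros-[0] (suc k) (suc n) = coeff-zeros-[0] k n

  coeff-∷ʳ0 : ∀ p → (p ∷ʳ 0ℤ) ≋ p
  coeff-∷ʳ0 p n = trans (coeff-++ p [ 0ℤ ] n) (trans (cong (λ u → coeff p n + u) (coeff-zeros-[0] (length p) n)) (ℤ.+-identityʳ _))

  -- Product recursion at the top coefficient of the left factor: the form that `coeff-∷-*ₚ` takes
  -- after reversal.
  coeff-∷ʳ-*ₚ : ∀ p a q n → coeff ((p ∷ʳ a) *ₚ q) n ≡ coeff (p *ₚ q) n + coeff (zeros (length p) ++ map (a *_) q) n
  coeff-∷ʳ-*ₚ []      a q zero    = trans (coeff-∷-*ₚ a [] q 0) (trans (ℤ.+-identityʳ _) (sym (trans (ℤ.+-identityˡ _) (coeff-map a q 0))))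
  coeff-∷ʳ-*ₚ []      a q (suc n) = trans (coeff-∷-*ₚ a [] q (suc n)) (trans (ℤ.+-identityʳ _) (sym (trans (ℤ.+-identityˡ _) (coeff-map a q (suc n)))))
  coeff-∷ʳ-*ₚ (b ∷ p) a q zero    = trans (coeff-∷-*ₚ b (p ∷ʳ a) q 0) (sym (trans (ℤ.+-identityʳ _) (coeff-∷-*ₚ b p q 0)))
  coeff-∷ʳ-*ₚ (b ∷ p) a q (suc n) = begin
    coeff ((b ∷ p ∷ʳ a) *ₚ q) (suc n)                                         ≡⟨ coeff-∷-*ₚ b (p ∷ʳ a) q (suc n) ⟩
    b * coeff q (suc n) + coeff ((p ∷ʳ a) *ₚ q) n                             ≡⟨ cong (λ u → b * coeff q (suc n) + u) (coeff-∷ʳ-*ₚ p a q n) ⟩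
    b * coeff q (suc n) + (coeff (p *ₚ q) n + X)                              ≡⟨ ℤ.+-assoc (b * coeff q (suc n)) (coeff (p *ₚ q) n) X ⟨
    b * coeff q (suc n) + coeff (p *ₚ q) n + X                                ≡⟨ cong (_+ X) (coeff-∷-*ₚ b p q (suc n)) ⟨
    coeff ((b ∷ p) *ₚ q) (suc n) + X                                          ∎
    where
    open ≡-Reasoning
    X = coeff (zeros (length p) ++ map (a *_) q) n

  length-+ₚ : ∀ p q → length p ℕ.≤ length q → length (p +ₚ q) ≡ length q
  length-+ₚ []      q       _             = refl
  length-+ₚ (a ∷ p) (b ∷ q) (ℕ.s≤s p≤q) = cong suc (length-+ₚ p q p≤q)

  -- Reversal depends on the exact length of a list, trailing zeros included, so the length of a
  -- product must be known without reference to degrees.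
  length-*ₚ : ∀ a p b q → length ((a ∷ p) *ₚ (b ∷ q)) ≡ length p ℕ.+ suc (length q)
  length-*ₚ a []      b []      = refl
  length-*ₚ a []      b (c ∷ q) = cong (λ n → suc (suc n)) (List.length-map (a *_) q)
  length-*ₚ a (c ∷ p) b q       = trans
    (length-+ₚ (map (a *_) (b ∷ q)) (0ℤ ∷ ((c ∷ p) *ₚ (b ∷ q)))
      (ℕ.≤-trans (ℕ.≤-reflexive (List.length-map (a *_) (b ∷ q)))
        (ℕ.≤-trans (ℕ.m≤n+m (suc (length q)) (suc (length p))) (ℕ.≤-reflexive (cong suc (sym (length-*ₚ c p b q)))))))
    (cong suc (length-*ₚ c p b q))

  -- Reversal commutes with addition only for equal lengths, so the shorter summand is padded first.
  +ₚ-zeros : ∀ p k q → length p ℕ.+ k ≡ length q → p +ₚ q ≡ (p ++ zeros k) +ₚ q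
  +ₚ-zeros []      zero    []      _  = refl
  +ₚ-zeros []      (suc k) (b ∷ q) eq = cong₂ _∷_ (sym (ℤ.+-identityˡ b)) (+ₚ-zeros [] k q (ℕ.suc-injective eq))
  +ₚ-zeros (a ∷ p) k       (b ∷ q) eq = cong (a + b ∷_) (+ₚ-zeros p k q (ℕ.suc-injective eq))

  ∷ʳ-+ₚ : ∀ p q a b → length p ≡ length q → (p ∷ʳ a) +ₚ (q ∷ʳ b) ≡ (p +ₚ q) ∷ʳ (a + b)
  ∷ʳ-+ₚ []      []      a b _  = refl
  ∷ʳ-+ₚ (c ∷ p) (d ∷ q) a b eq = cong (c + d ∷_) (∷ʳ-+ₚ p q a b (ℕ.suc-injective eq))

  reverse-+ₚ : ∀ p q → length p ≡ length q → reverse (p +ₚ q) ≡ reverse p +ₚ reverse q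
  reverse-+ₚ []      []      _  = refl
  reverse-+ₚ (a ∷ p) (b ∷ q) eq = begin
    reverse (a + b ∷ (p +ₚ q))                     ≡⟨ List.unfold-reverse (a + b) (p +ₚ q) ⟩
    reverse (p +ₚ q) ∷ʳ (a + b)                    ≡⟨ cong (_∷ʳ (a + b)) (reverse-+ₚ p q (ℕ.suc-injective eq)) ⟩
    (reverse p +ₚ reverse q) ∷ʳ (a + b)            ≡⟨ ∷ʳ-+ₚ (reverse p) (reverse q) a b (trans (List.length-reverse p) (trans (ℕ.suc-injective eq) (sym (List.length-reverse q)))) ⟨
    (reverse p ∷ʳ a) +ₚ (reverse q ∷ʳ b)           ≡⟨ cong₂ _+ₚ_ (List.unfold-reverse a p) (List.unfold-reverse b q) ⟨
    reverse (a ∷ p) +ₚ reverse (b ∷ q)             ∎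
    where open ≡-Reasoning

  reverse-zeros : ∀ k → reverse (zeros k) ≡ zeros k
  reverse-zeros zero    = refl
  reverse-zeros (suc k) = trans (List.unfold-reverse 0ℤ (zeros k)) (trans (cong (_∷ʳ 0ℤ) (reverse-zeros k)) (snoc k))
    where
    snoc : ∀ k → zeros k ∷ʳ 0ℤ ≡ 0ℤ ∷ zeros k
    snoc zero    = refl
    snoc (suc k) = cong (0ℤ ∷_) (snoc k)

  -- Only up to `≋`, because the zero that shifts `p *ₚ q` in the definition of the product becomes
  -- a trailing zero under reversal.
  reverse-*ₚ : ∀ a p b q → reverse ((a ∷ p) *ₚ (b ∷ q)) ≋ (reverse (a ∷ p) *ₚ reverse (b ∷ q))
  reverse-*ₚ a [] b q n = begin
    coeff (reverse (map (a *_) (b ∷ q) +ₚ [ 0ℤ ])) n     ≡⟨ cong (λ r → coeff (reverse r) n) (absorb (map (a *_) q)) ⟩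
    coeff (reverse (map (a *_) (b ∷ q))) n               ≡⟨ cong (λ r → coeff r n) (List.reverse-map (a *_) (b ∷ q)) ⟨
    coeff (map (a *_) (reverse (b ∷ q))) n               ≡⟨ ℤ.+-identityˡ _ ⟨
    0ℤ + coeff (map (a *_) (reverse (b ∷ q))) n          ≡⟨ coeff-∷ʳ-*ₚ [] a (reverse (b ∷ q)) n ⟨
    coeff ([ a ] *ₚ reverse (b ∷ q)) n                   ∎
    where
    open ≡-Reasoning
    absorb : ∀ r → (a * b + 0ℤ) ∷ (r +ₚ []) ≡ a * b ∷ r
    absorb []      = cong (_∷ []) (ℤ.+-identityʳ _)
    absorb (c ∷ r) = cong (_∷ c ∷ r) (ℤ.+-identityʳ _)
  reverse-*ₚ a p@(c ∷ p') b q n = begin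
    coeff (reverse (X +ₚ Y)) n                                                  ≡⟨ cong (λ r → coeff (reverse r) n) (+ₚ-zeros X (length p) Y same) ⟩
    coeff (reverse ((X ++ zeros (length p)) +ₚ Y)) n                            ≡⟨ cong (λ r → coeff r n) (reverse-+ₚ (X ++ zeros (length p)) Y same') ⟩
    coeff (reverse (X ++ zeros (length p)) +ₚ reverse Y) n                      ≡⟨ coeff-+ₚ (reverse (X ++ zeros (length p))) (reverse Y) n ⟩
    coeff (reverse (X ++ zeros (length p))) n + coeff (reverse Y) n             ≡⟨ cong₂ _+_ (cong (λ r → coeff r n) revX) revY ⟩
    coeff (zeros (length (reverse p)) ++ map (a *_) q') n + coeff (reverse p *ₚ q') n   ≡⟨ ℤ.+-comm _ (coeff (reverse p *ₚ q') n) ⟩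
    coeff (reverse p *ₚ q') n + coeff (zeros (length (reverse p)) ++ map (a *_) q') n   ≡⟨ coeff-∷ʳ-*ₚ (reverse p) a q' n ⟨
    coeff ((reverse p ∷ʳ a) *ₚ q') n                                            ≡⟨ cong (λ r → coeff (r *ₚ q') n) (List.unfold-reverse a p) ⟨
    coeff (reverse (a ∷ p) *ₚ q') n                                             ∎
    where
    open ≡-Reasoning
    q' = reverse (b ∷ q)
    X = map (a *_) (b ∷ q)
    Y = 0ℤ ∷ (p *ₚ (b ∷ q))
    same : length X ℕ.+ length p ≡ length Y
    same = trans (cong (ℕ._+ length p) (List.length-map (a *_) (b ∷ q)))
      (trans (ℕ.+-comm (suc (length q)) (length p)) (cong suc (sym (length-*ₚ c p' b q))))
    same' : length (X ++ zeros (length p)) ≡ length Y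
    same' = trans (List.length-++ X) (trans (cong (length X ℕ.+_) (List.length-replicate (length p))) same)
    revX : reverse (X ++ zeros (length p)) ≡ zeros (length (reverse p)) ++ map (a *_) q'
    revX = trans (List.reverse-++ X (zeros (length p)))
      (cong₂ _++_ (trans (reverse-zeros (length p)) (cong zeros (sym (List.length-reverse p)))) (sym (List.reverse-map (a *_) (b ∷ q))))
    revY : coeff (reverse Y) n ≡ coeff (reverse p *ₚ q') n
    revY = trans (cong (λ r → coeff r n) (List.unfold-reverse 0ℤ (p *ₚ (b ∷ q))))
      (trans (coeff-∷ʳ0 (reverse (p *ₚ (b ∷ q))) n) (reverse-*ₚ c p' b q n))

  coeff-∷ʳ-0 : ∀ p a → p ≢ [] → coeff (p ∷ʳ a) 0 ≡ coeff p 0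
  coeff-∷ʳ-0 []      a p≢[] = ⊥-elim (p≢[] refl)
  coeff-∷ʳ-0 (_ ∷ _) a _    = refl

  reverse≢[] : ∀ (a : ℤ) p → reverse (a ∷ p) ≢ []
  reverse≢[] a p eq with trans (sym (List.length-reverse (a ∷ p))) (cong length eq)
  ... | ()

  coeff-reverse-0 : ∀ p → coeff (reverse p) 0 ≡ lead p
  coeff-reverse-0 []          = refl
  coeff-reverse-0 (a ∷ [])    = refl
  coeff-reverse-0 (a ∷ b ∷ p) = trans (cong (λ r → coeff r 0) (List.unfold-reverse a (b ∷ p)))
    (trans (coeff-∷ʳ-0 (reverse (b ∷ p)) a (reverse≢[] b p)) (coeff-reverse-0 (b ∷ p)))

  lead-reverse : ∀ p → lead (reverse p) ≡ coeff p 0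
  lead-reverse p = trans (sym (coeff-reverse-0 (reverse p))) (cong (λ r → coeff r 0) (List.reverse-involutive p))

  ≋[]⇒lead≡0 : ∀ p → p ≋ [] → lead p ≡ 0ℤ
  ≋[]⇒lead≡0 []          _   = refl
  ≋[]⇒lead≡0 (a ∷ [])    p≋0 = p≋0 0
  ≋[]⇒lead≡0 (a ∷ b ∷ p) p≋0 = ≋[]⇒lead≡0 (b ∷ p) (λ n → p≋0 (suc n))

  -- Trailing zeros would become low-order zeros under reversal, so an equation can be reversed only
  -- as an equality of lists; nonzero leading coefficients provide it.
  ≋⇒≡ : ∀ p q → lead p ≢ 0ℤ → lead q ≢ 0ℤ → p ≋ q → p ≡ q
  ≋⇒≡ []          q           p≢0 q≢0 p≋q = ⊥-elim (p≢0 refl)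
  ≋⇒≡ (a ∷ p)     []          p≢0 q≢0 p≋q = ⊥-elim (q≢0 refl)
  ≋⇒≡ (a ∷ [])    (b ∷ [])    p≢0 q≢0 p≋q = cong (_∷ []) (p≋q 0)
  ≋⇒≡ (a ∷ [])    (b ∷ c ∷ q) p≢0 q≢0 p≋q = ⊥-elim (q≢0 (≋[]⇒lead≡0 (c ∷ q) (λ n → sym (p≋q (suc n)))))
  ≋⇒≡ (a ∷ c ∷ p) (b ∷ [])    p≢0 q≢0 p≋q = ⊥-elim (p≢0 (≋[]⇒lead≡0 (c ∷ p) (λ n → p≋q (suc n))))
  ≋⇒≡ (a ∷ c ∷ p) (b ∷ d ∷ q) p≢0 q≢0 p≋q = cong₂ _∷_ (p≋q 0) (≋⇒≡ (c ∷ p) (d ∷ q) p≢0 q≢0 (λ n → p≋q (suc n)))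

  -- The cofactor in a divisibility is arbitrary and may end in zeros, which have to go before it is
  -- reversed.
  strip : ∀ p → p ≋ [] ⊎ ∃ λ q → p ≋ q × lead q ≢ 0ℤ
  strip [] = inj₁ λ _ → refl
  strip (a ∷ p) with strip p
  ... | inj₂ ([]    , _   , q≢0) = ⊥-elim (q≢0 refl)
  ... | inj₂ (b ∷ q , p≋q , q≢0) = inj₂ (a ∷ b ∷ q , (λ { zero → refl ; (suc n) → p≋q n }) , q≢0)
  ... | inj₁ p≋0 with a ℤ.≟ 0ℤ
  ...   | yes refl = inj₁ λ { zero → refl ; (suc n) → p≋0 n }
  ...   | no  a≢0  = inj₂ (a ∷ [] , (λ { zero → refl ; (suc n) → p≋0 n }) , a≢0)

  *ₚ-[] : ∀ p → (p *ₚ []) ≋ []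
  *ₚ-[] []      n       = refl
  *ₚ-[] (a ∷ p) zero    = refl
  *ₚ-[] (a ∷ p) (suc n) = *ₚ-[] p n

  -- Read off at the constant term of the reversed product, where multiplicativity is immediate; ℤ
  -- has no zero divisors.
  lead-*ₚ : ∀ p q → lead p ≢ 0ℤ → lead q ≢ 0ℤ → lead (p *ₚ q) ≢ 0ℤ
  lead-*ₚ []      q       p≢0 q≢0 _  = p≢0 refl
  lead-*ₚ (a ∷ p) []      p≢0 q≢0 _  = q≢0 refl
  lead-*ₚ (a ∷ p) (b ∷ q) p≢0 q≢0 eq with ℤ.i*j≡0⇒i≡0∨j≡0 (lead (a ∷ p)) (begin
    lead (a ∷ p) * lead (b ∷ q)                                   ≡⟨ cong₂ _*_ (coeff-reverse-0 (a ∷ p)) (coeff-reverse-0 (b ∷ q)) ⟨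
    coeff (reverse (a ∷ p)) 0 * coeff (reverse (b ∷ q)) 0         ≡⟨ coeff-*ₚ-0 (reverse (a ∷ p)) (reverse (b ∷ q)) ⟨
    coeff (reverse (a ∷ p) *ₚ reverse (b ∷ q)) 0                  ≡⟨ reverse-*ₚ a p b q 0 ⟨
    coeff (reverse ((a ∷ p) *ₚ (b ∷ q))) 0                        ≡⟨ coeff-reverse-0 ((a ∷ p) *ₚ (b ∷ q)) ⟩
    lead ((a ∷ p) *ₚ (b ∷ q))                                     ≡⟨ eq ⟩
    0ℤ                                                            ∎)
    where open ≡-Reasoning
  ... | inj₁ p≡0 = p≢0 p≡0
  ... | inj₂ q≡0 = q≢0 q≡0

  ∣ₚ-reverse : ∀ P N → lead P ≢ 0ℤ → lead N ≢ 0ℤ → P ∣ₚ N → reverse P ∣ₚ reverse N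
  ∣ₚ-reverse []      N P≢0 N≢0 _ = ⊥-elim (P≢0 refl)
  ∣ₚ-reverse (a ∷ p) N P≢0 N≢0 (Q , PQ≋N) with strip Q
  ... | inj₁ Q≋0 = ⊥-elim (N≢0 (≋[]⇒lead≡0 N λ n → trans (sym (PQ≋N n)) (trans (*ₚ-congʳ (a ∷ p) Q [] Q≋0 n) (*ₚ-[] (a ∷ p) n))))
  ... | inj₂ ([]    , _    , Q≢0) = ⊥-elim (Q≢0 refl)
  ... | inj₂ (b ∷ q , Q≋bq , Q≢0) = reverse (b ∷ q) , λ n → trans (sym (reverse-*ₚ a p b q n)) (cong (λ r → coeff (reverse r) n) product≡N)
    where
    product≡N : (a ∷ p) *ₚ (b ∷ q) ≡ N
    product≡N = ≋⇒≡ _ _ (lead-*ₚ (a ∷ p) (b ∷ q) P≢0 Q≢0) N≢0 λ n → trans (sym (*ₚ-congʳ (a ∷ p) Q (b ∷ q) Q≋bq n)) (PQ≋N n)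

  All-reverse : ∀ {Pr : ℤ → Set} {p} → All Pr p → All Pr (reverse p)
  All-reverse []                    = []
  All-reverse {Pr} {a ∷ p} (h ∷ hs) = subst (All Pr) (sym (List.unfold-reverse a p)) (All.∷ʳ⁺ (All-reverse hs) h)

  All-coeff-0 : ∀ {Pr : ℤ → Set} {p} → All Pr p → coeff p 0 ≢ 0ℤ → Pr (coeff p 0)
  All-coeff-0 []      p≢0 = ⊥-elim (p≢0 refl)
  All-coeff-0 (h ∷ _) _   = h

  -- The new constant term is the old leading coefficient, which is nonzero and therefore 1.
  Newman-reverse : ∀ {N} → Newman N → Newman (reverse N)
  Newman-reverse {N} (zero-one , lead≢0 , constant≡1) = All-reverse zero-one , lead'≢0 , constant'
    where
    lead'≢0 : lead (reverse N) ≢ 0ℤ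
    lead'≢0 eq with trans (sym constant≡1) (trans (sym (lead-reverse N)) eq)
    ... | ()
    constant≢0 : coeff (reverse N) 0 ≢ 0ℤ
    constant≢0 eq = lead≢0 (trans (sym (coeff-reverse-0 N)) eq)
    constant' : coeff (reverse N) 0 ≡ 1ℤ
    constant' with All-coeff-0 (All-reverse zero-one) constant≢0
    ... | inj₁ ≡0 = ⊥-elim (constant≢0 ≡0)
    ... | inj₂ ≡1 = ≡1

  Littlewood-reverse : ∀ {L} → Littlewood L → Littlewood (reverse L)
  Littlewood-reverse {[]}    (_ , lead≢0)     = ⊥-elim (lead≢0 refl)
  Littlewood-reverse {a ∷ p} (signs@(h ∷ _) , _) = All-reverse signs , λ eq → a≢0 h (trans (sym (lead-reverse (a ∷ p))) eq)
    where
    a≢0 : a ≡ -1ℤ ⊎ a ≡ 1ℤ → a ≢ 0ℤ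
    a≢0 (inj₁ refl) ()
    a≢0 (inj₂ refl) ()

  -- Both classes of polynomials are invariant under reversal: the Newman multiple is reversed on
  -- the way in, the Littlewood multiple on the way out.
  lifts-reverse : ∀ P → lead P ≢ 0ℤ → coeff P 0 ≢ 0ℤ → Lifts (reverse P) → Lifts P
  lifts-reverse P lead≢0 constant≢0 lift (N , newman@(_ , N≢0 , _) , P∣N)
    with lift (reverse N , Newman-reverse newman , ∣ₚ-reverse P N lead≢0 N≢0 P∣N)
  ... | L , littlewood , P'∣L = reverse L , Littlewood-reverse littlewood ,
      subst (_∣ₚ reverse L) (List.reverse-involutive P)
        (∣ₚ-reverse (reverse P) L (λ eq → constant≢0 (trans (sym (lead-reverse P)) eq)) (proj₂ littlewood) P'∣L)

-- Fixed-point bounds at an approximate root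

module Escape (S : ℕ) {{S≢0 : ℕ.NonZero S}} (R : ℕ) where

  open Analysis
  open import Data.Rational using (_+_; _*_; -_; _-_; _≤_; ∣_∣)
  open import Data.Rational.Properties using (module ≤-Reasoning)
  open import Data.Rational.Solver using (module +-*-Solver)

  -- Gaussian integers as fixed-point numbers

  infix 3 _+I_
  record 𝔾 : Set where
    constructor _+I_
    field Re Im : ℤ
  open 𝔾

  γ : 𝔾 → ℂ
  γ (a +I b) = κ a +i κ b

  _·_ : 𝔾 → 𝔾 → 𝔾
  (a +I b) · (c +I d) = a ℤ.* c ℤ.- b ℤ.* d +I a ℤ.* d ℤ.+ b ℤ.* c

  nm : 𝔾 → ℕ
  nm (a +I b) = ℤ.∣ a ∣ ℕ.+ ℤ.∣ b ∣

  axpy : ℤ → 𝔾 → 𝔾 → 𝔾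
  axpy c (a +I b) (d +I e) = c ℤ.* a ℤ.+ d +I c ℤ.* b ℤ.+ e

  κ-- : ∀ i j → κ (i ℤ.- j) ≡ κ i - κ j
  κ-- i j = trans (κ-+ i (ℤ.- j)) (cong (λ u → κ i + u) (κ-neg j))

  γ-· : ∀ x y → γ (x · y) ≡ γ x ⊛ γ y
  γ-· (a +I b) (c +I d) = cong₂ _+i_
    (trans (κ-- _ _) (cong₂ _-_ (κ-* a c) (κ-* b d)))
    (trans (κ-+ _ _) (cong₂ _+_ (κ-* a d) (κ-* b c)))

  γ-axpy : ∀ c x y → γ (axpy c x y) ≡ ι c ⊛ γ x ⊕ γ y
  γ-axpy c (a +I b) (d +I e) = cong₂ _+i_
    (trans (trans (κ-+ _ _) (cong (_+ κ d) (κ-* c a))) (solve 4 (λ c a b d → c :* a :+ d := c :* a :- con 0ℚ :* b :+ d) refl (κ c) (κ a) (κ b) (κ d)))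
    (trans (trans (κ-+ _ _) (cong (_+ κ e) (κ-* c b))) (solve 4 (λ c a b d → c :* b :+ d := c :* b :+ con 0ℚ :* a :+ d) refl (κ c) (κ a) (κ b) (κ e)))
    where open +-*-Solver

  ‖γ‖ : ∀ x → ‖ γ x ‖ ≡ κ (+ nm x)
  ‖γ‖ (a +I b) = trans (cong₂ _+_ (κ-abs a) (κ-abs b)) (sym (κℕ-+ ℤ.∣ a ∣ ℤ.∣ b ∣))

  σ : ℚ
  σ = κ (+ S)

  ς : ℂ
  ς = ι (+ S)

  0<S : 0 ℕ.< S
  0<S = ℕ.>-nonZero⁻¹ S

  S-cancel : ∀ p q → σ * p ≤ σ * q → p ≤ q
  S-cancel p q = κ-cancel′ S 0<S p q

  S⁻¹ : ∃ λ v → σ * v ≡ 1ℚ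
  S⁻¹ = inverse S 0<S
    where
    inverse : ∀ n → 0 ℕ.< n → ∃ λ v → κ (+ n) * v ≡ 1ℚ
    inverse (suc n) _ = κ-inverse n

  _/S : ℚ → ℚ
  q /S = q * proj₁ S⁻¹

  S*/S : ∀ q → σ * (q /S) ≡ q
  S*/S q = trans (solve 3 (λ s u v → s :* (u :* v) := u :* (s :* v)) refl σ q (proj₁ S⁻¹))
    (trans (cong (q *_) (proj₂ S⁻¹)) (ℚ.*-identityʳ q))
    where open +-*-Solver

  ‖S⊛‖ : ∀ z → ‖ ς ⊛ z ‖ ≡ σ * ‖ z ‖
  ‖S⊛‖ z = ‖ι⊛‖ (+ S) z

  n≤S*⌈n/S⌉ : ∀ n → n ℕ.≤ S ℕ.* suc (n ℕ./ S)
  n≤S*⌈n/S⌉ n = begin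
    n                          ≡⟨ ℕ.m≡m%n+[m/n]*n n S ⟩
    n ℕ.% S ℕ.+ n ℕ./ S ℕ.* S  ≤⟨ ℕ.+-monoˡ-≤ _ (ℕ.<⇒≤ (ℕ.m%n<n n S)) ⟩
    suc (n ℕ./ S) ℕ.* S        ≡⟨ ℕ.*-comm (suc (n ℕ./ S)) S ⟩
    S ℕ.* suc (n ℕ./ S)        ∎
    where open ℕ.≤-Reasoning

  -- In a table of powers, the entry (w , e) at position k records that `S` aᵏ lies within e of the
  -- Gaussian integer w, uniformly for all a in a disc; `Tracks` makes this precise.
  Table : Set
  Table = List (𝔾 × ℕ)

  remainder : 𝔾 → 𝔾 → 𝔾
  remainder u w = axpy (ℤ.- (+ S)) w u

  -- Error of the approximation w' to S a z, given S a ≈ A up to r, S z ≈ w up to e, and u = w · A.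
  nextError : 𝔾 → ℕ → 𝔾 → ℕ → 𝔾 → 𝔾 → ℕ
  nextError A r w e u w' = suc ((e ℕ.* (nm A ℕ.+ r) ℕ.+ (nm w ℕ.* r ℕ.+ nm (remainder u w'))) ℕ./ S)

  -- Any choice of rounding would be sound, since `nextError` measures the actual `remainder`;
  -- flooring both parts keeps that remainder below 2 `S`.
  round : 𝔾 → 𝔾
  round (a +I b) = a /ℕ S +I b /ℕ S

  table : 𝔾 → ℕ → ℕ → 𝔾 → ℕ → Table
  table A r zero    w e = []
  table A r (suc n) w e = (w , e) ∷ advance (w · A)
    where
    continue : 𝔾 → 𝔾 → Table
    continue u w' = table A r n w' (nextError A r w e u w')
    advance : 𝔾 → Table
    advance u = continue u (round u)

  Tracks : ℂ → ℂ → Table → Set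
  Tracks a z []            = ⊤
  Tracks a z ((w , e) ∷ t) = ‖ ς ⊛ z ⊖ γ w ‖ ≤ κ (+ e) × Tracks a (a ⊛ z) t

  -- With X = S a - A and Y = S z - w, the error multiplied by S is S (S a z - w') = (X + A) Y + w X
  -- + (w A - S w'). The three terms are the three summands of `nextError`.
  next-error : ∀ {a z} A r w e w' → ‖ ς ⊛ a ⊖ γ A ‖ ≤ κ (+ r) → ‖ ς ⊛ z ⊖ γ w ‖ ≤ κ (+ e) →
    ‖ ς ⊛ (a ⊛ z) ⊖ γ w' ‖ ≤ κ (+ nextError A r w e (w · A) w')
  next-error {a} {z} A r w e w' a≈ z≈ = S-cancel _ _ (begin
    σ * ‖ ς ⊛ (a ⊛ z) ⊖ γ w' ‖
      ≡⟨ ‖S⊛‖ (ς ⊛ (a ⊛ z) ⊖ γ w') ⟨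
    ‖ ς ⊛ (ς ⊛ (a ⊛ z) ⊖ γ w') ‖
      ≡⟨ cong ‖_‖ (trans regroup (cong (λ u → ((X ⊕ γ A) ⊛ Y) ⊕ (γ w ⊛ X ⊕ u)) (sym γ-remainder))) ⟩
    ‖ ((X ⊕ γ A) ⊛ Y) ⊕ (γ w ⊛ X ⊕ γ ρ) ‖
      ≤⟨ ⊕-bound ((X ⊕ γ A) ⊛ Y) (γ w ⊛ X ⊕ γ ρ)
           (⊛-bound (X ⊕ γ A) Y (⊕-bound X (γ A) a≈ (ℚ.≤-reflexive (‖γ‖ A))) z≈)
           (⊕-bound (γ w ⊛ X) (γ ρ) (⊛-bound (γ w) X (ℚ.≤-reflexive (‖γ‖ w)) a≈) (ℚ.≤-reflexive (‖γ‖ ρ))) ⟩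
    (κ (+ r) + κ (+ nm A)) * κ (+ e) + (κ (+ nm w) * κ (+ r) + κ (+ nm ρ))
      ≡⟨ cong (_+ (κ (+ nm w) * κ (+ r) + κ (+ nm ρ))) (trans (ℚ.*-comm _ (κ (+ e))) (cong (κ (+ e) *_) (ℚ.+-comm (κ (+ r)) (κ (+ nm A))))) ⟩
    κ (+ e) * (κ (+ nm A) + κ (+ r)) + (κ (+ nm w) * κ (+ r) + κ (+ nm ρ))
      ≡⟨ trans (κℕ-+ (e ℕ.* (nm A ℕ.+ r)) (nm w ℕ.* r ℕ.+ nm ρ))
           (cong₂ _+_ (trans (κℕ-* e (nm A ℕ.+ r)) (cong (κ (+ e) *_) (κℕ-+ (nm A) r)))
             (trans (κℕ-+ (nm w ℕ.* r) (nm ρ)) (cong (_+ κ (+ nm ρ)) (κℕ-* (nm w) r)))) ⟨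
    κ (+ total)
      ≤⟨ κ-mono (ℤ.+≤+ (n≤S*⌈n/S⌉ total)) ⟩
    κ (+ (S ℕ.* nextError A r w e (w · A) w'))
      ≡⟨ κℕ-* S (nextError A r w e (w · A) w') ⟩
    σ * κ (+ nextError A r w e (w · A) w') ∎)
    where
    open ≤-Reasoning
    X = ς ⊛ a ⊖ γ A
    Y = ς ⊛ z ⊖ γ w
    ρ = remainder (w · A) w'
    total = e ℕ.* (nm A ℕ.+ r) ℕ.+ (nm w ℕ.* r ℕ.+ nm ρ)
    module C = ℂ-Solver
    regroup : ς ⊛ (ς ⊛ (a ⊛ z) ⊖ γ w') ≡ ((X ⊕ γ A) ⊛ Y) ⊕ (γ w ⊛ X ⊕ (γ w ⊛ γ A ⊖ ς ⊛ γ w'))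
    regroup = C.solve 6 (λ S a z w w' A → S C.:* (S C.:* (a C.:* z) C.:- w') C.:=
        (((S C.:* a C.:- A) C.:+ A) C.:* (S C.:* z C.:- w)) C.:+ (w C.:* (S C.:* a C.:- A) C.:+ (w C.:* A C.:- S C.:* w')))
      refl ς a z (γ w) (γ w') (γ A)
    ι-neg : ι (ℤ.- (+ S)) ≡ ⊝ ς
    ι-neg = cong (_+i 0ℚ) (κ-neg (+ S))
    γ-remainder : γ ρ ≡ γ w ⊛ γ A ⊖ ς ⊛ γ w'
    γ-remainder = trans (γ-axpy (ℤ.- (+ S)) w' (w · A))
      (trans (cong₂ (λ s u → s ⊛ γ w' ⊕ u) ι-neg (γ-· w A))
        (C.solve 3 (λ s w u → (C.:- s) C.:* w C.:+ u C.:= u C.:- s C.:* w) refl ς (γ w') (γ w ⊛ γ A)))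

  table-tracks : ∀ {a} A r → ‖ ς ⊛ a ⊖ γ A ‖ ≤ κ (+ r) →
    ∀ n z w e → ‖ ς ⊛ z ⊖ γ w ‖ ≤ κ (+ e) → Tracks a z (table A r n w e)
  table-tracks     A r a≈ zero    z w e z≈ = tt
  table-tracks {a} A r a≈ (suc n) z w e z≈ = z≈ ,
    table-tracks A r a≈ n (a ⊛ z) (round (w · A)) _ (next-error {a} {z} A r w e (round (w · A)) a≈ z≈)

  powers : 𝔾 → ℕ → ℕ → Table
  powers A r n = table A r n (+ S +I 0ℤ) 0

  powers-tracks : ∀ {a} A r n → ‖ ς ⊛ a ⊖ γ A ‖ ≤ κ (+ r) → Tracks a 1ℂ (powers A r n)
  powers-tracks A r n a≈ = table-tracks A r a≈ n 1ℂ (+ S +I 0ℤ) 0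
    (ℚ.≤-reflexive (trans (cong ‖_‖ (trans (cong (λ u → ς ⊛ 1ℂ ⊖ (σ +i u)) κ-0) (solve 1 (λ s → s :* con 1ℂ :- s := con 0ℂ) refl ς))) (sym κ-0)))
    where open ℂ-Solver

  dot : Poly → Table → 𝔾
  dot []      _             = 0ℤ +I 0ℤ
  dot (c ∷ V) []            = 0ℤ +I 0ℤ
  dot (c ∷ V) ((w , _) ∷ t) = axpy c w (dot V t)

  err : Poly → Table → ℕ
  err []      _             = 0
  err (c ∷ V) []            = 0
  err (c ∷ V) ((_ , e) ∷ t) = ℤ.∣ c ∣ ℕ.* e ℕ.+ err V t

  -- The factor z carries the powers of a already passed, so that the tail poses the same problem
  -- for a z.
  dot-approximates : ∀ {a z} V t → length V ℕ.≤ length t → Tracks a z t →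
    ‖ ς ⊛ (z ⊛ ev V a) ⊖ γ (dot V t) ‖ ≤ κ (+ err V t)
  dot-approximates {a} {z} [] t _ _ = ℚ.≤-reflexive (trans (cong ‖_‖ zero≡) (sym κ-0))
    where
    open ℂ-Solver
    zero≡ : ς ⊛ (z ⊛ 0ℂ) ⊖ (κ 0ℤ +i κ 0ℤ) ≡ 0ℂ
    zero≡ = trans (cong (λ u → ς ⊛ (z ⊛ 0ℂ) ⊖ (u +i u)) κ-0)
      (solve 2 (λ s z → s :* (z :* con 0ℂ) :- con 0ℂ := con 0ℂ) refl ς z)
  dot-approximates {a} {z} (c ∷ V) ((w , e) ∷ t) (ℕ.s≤s V≤t) (z≈ , tr) = begin
    ‖ ς ⊛ (z ⊛ (ι c ⊕ a ⊛ ev V a)) ⊖ γ (axpy c w (dot V t)) ‖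
      ≡⟨ cong ‖_‖ (trans (cong (ς ⊛ (z ⊛ (ι c ⊕ a ⊛ ev V a)) ⊖_) (γ-axpy c w (dot V t))) regroup) ⟩
    ‖ ι c ⊛ X ⊕ Y ‖
      ≤⟨ ⊕-bound (ι c ⊛ X) Y (ℚ.≤-trans (ℚ.≤-reflexive (‖ι⊛‖ c X)) (*-monoˡ₀ (κ-pos ℤ.∣ c ∣) z≈)) (dot-approximates V t V≤t tr) ⟩
    κ (+ ℤ.∣ c ∣) * κ (+ e) + κ (+ err V t)
      ≡⟨ trans (κℕ-+ (ℤ.∣ c ∣ ℕ.* e) (err V t)) (cong (_+ κ (+ err V t)) (κℕ-* ℤ.∣ c ∣ e)) ⟨
    κ (+ err (c ∷ V) ((w , e) ∷ t)) ∎
    where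
    open ≤-Reasoning
    X = ς ⊛ z ⊖ γ w
    Y = ς ⊛ ((a ⊛ z) ⊛ ev V a) ⊖ γ (dot V t)
    regroup : ς ⊛ (z ⊛ (ι c ⊕ a ⊛ ev V a)) ⊖ (ι c ⊛ γ w ⊕ γ (dot V t)) ≡ ι c ⊛ X ⊕ Y
    regroup = solve 7 (λ s z c a v w d → s :* (z :* (c :+ a :* v)) :- (c :* w :+ d) := c :* (s :* z :- w) :+ (s :* ((a :* z) :* v) :- d))
      refl ς z (ι c) a (ev V a) (γ w) (γ (dot V t))
      where open ℂ-Solver

  1⊛ : ∀ z → 1ℂ ⊛ z ≡ z
  1⊛ = ⊛-identityˡ

  dot-approximates₁ : ∀ {a} V t → length V ℕ.≤ length t → Tracks a 1ℂ t → ‖ ς ⊛ ev V a ⊖ γ (dot V t) ‖ ≤ κ (+ err V t)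
  dot-approximates₁ {a} V t V≤t tr = subst (λ u → ‖ ς ⊛ u ⊖ γ (dot V t) ‖ ≤ κ (+ err V t)) (1⊛ (ev V a)) (dot-approximates V t V≤t tr)

  near : ∀ z x {e} → ‖ z ⊖ γ x ‖ ≤ κ (+ e) → ‖ z ‖ ≤ κ (+ (nm x ℕ.+ e))
  near z x {e} z≈x = begin
    ‖ z ‖                   ≡⟨ cong ‖_‖ (solve 2 (λ z x → z := x :+ (z :- x)) refl z (γ x)) ⟩
    ‖ γ x ⊕ (z ⊖ γ x) ‖     ≤⟨ ⊕-bound (γ x) (z ⊖ γ x) (ℚ.≤-reflexive (‖γ‖ x)) z≈x ⟩
    κ (+ nm x) + κ (+ e)    ≡⟨ κℕ-+ (nm x) e ⟨
    κ (+ (nm x ℕ.+ e))      ∎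
    where
    open ≤-Reasoning
    open ℂ-Solver

  -- Newton's method certifies a root within R / S of A / S; C / S approximates the inverse of the derivative there.
  rootᵇ : Poly → 𝔾 → 𝔾 → Table → Poly → Bool
  rootᵇ P A C t P' =
      (length P ℕ.≤ᵇ 9)
    ∧ (length P' ℕ.≤ᵇ 9)
    -- Keeps the whole disc inside `Small`; the two length checks before it match the nine tabulated
    -- powers.
    ∧ (R ℕ.+ nm A ℕ.≤ᵇ S ℕ.* 2)
    -- The hypothesis `room` of `Newton`, multiplied by S².
    ∧ (2 ℕ.* (nm C ℕ.* (nm (dot P t) ℕ.+ err P t)) ℕ.≤ᵇ S ℕ.* R)
    -- The hypothesis `contract`, multiplied by 2 S²: the computed value of S² - C D, then the error
    -- of the tabulated derivative, then the variation of the divided difference over the disc.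
    ∧ (2 ℕ.* (nm (axpy -1ℤ (C · dot P' t) (+ (S ℕ.* S) +I 0ℤ)) ℕ.+ (nm C ℕ.* err P' t ℕ.+ nm C ℕ.* (ddLip P ℕ.* R))) ℕ.≤ᵇ S ℕ.* S)

  length-table : ∀ A r n w e → length (table A r n w e) ≡ n
  length-table A r zero    w e = refl
  length-table A r (suc n) w e = cong suc (length-table A r n (round (w · A)) _)

  ∧-split : ∀ {x y} → T (x ∧ y) → T x × T y
  ∧-split {true} {true} _ = tt , tt

  module Root (P : Poly) (A C : 𝔾) (ok : T (rootᵇ P A C (powers A 0 9) (derivative P))) where

    -- Radius 0, as this table concerns only the centre A / S, for which S a₀ = A exactly. The rest
    -- of the disc is handled by `ddLip`.
    t = powers A 0 9
    D = dot (derivative P) t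
    F = axpy -1ℤ (C · D) (+ (S ℕ.* S) +I 0ℤ)

    checks₁ = ∧-split {length P ℕ.≤ᵇ 9} ok
    checks₂ = ∧-split {length (derivative P) ℕ.≤ᵇ 9} (proj₂ checks₁)
    checks₃ = ∧-split {R ℕ.+ nm A ℕ.≤ᵇ S ℕ.* 2} (proj₂ checks₂)
    checks₄ = ∧-split {2 ℕ.* (nm C ℕ.* (nm (dot P t) ℕ.+ err P t)) ℕ.≤ᵇ S ℕ.* R} (proj₂ checks₃)

    _÷S : 𝔾 → ℂ
    (x +I y) ÷S = κ x /S +i κ y /S

    S⊛÷S : ∀ x → ς ⊛ (x ÷S) ≡ γ x
    S⊛÷S (x +I y) = cong₂ _+i_
      (trans (solve 3 (λ s x y → s :* x :- con 0ℚ :* y := s :* x) refl σ (κ x /S) (κ y /S)) (S*/S (κ x)))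
      (trans (solve 3 (λ s x y → s :* y :+ con 0ℚ :* x := s :* y) refl σ (κ x /S) (κ y /S)) (S*/S (κ y)))
      where open +-*-Solver

    a₀ c : ℂ
    a₀ = A ÷S
    c = C ÷S

    η ρ : ℚ
    η = κ (+ (nm (dot P t) ℕ.+ err P t)) /S
    ρ = κ (+ R) /S

    tracks : Tracks a₀ 1ℂ t
    tracks = powers-tracks A 0 9 (ℚ.≤-reflexive (trans (cong ‖_‖ (trans (cong (_⊖ γ A) (S⊛÷S A)) (solve 1 (λ x → x :- x := con 0ℂ) refl (γ A)))) (sym κ-0)))
      where open ℂ-Solver

    length-t : length t ≡ 9
    length-t = length-table A 0 9 (+ S +I 0ℤ) 0

    S‖c‖ : σ * ‖ c ‖ ≡ κ (+ nm C)
    S‖c‖ = trans (sym (‖S⊛‖ c)) (trans (cong ‖_‖ (S⊛÷S C)) (‖γ‖ C))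

    in-disc : ∀ a → ‖ a ⊖ a₀ ‖ ≤ ρ → ‖ ς ⊛ a ⊖ γ A ‖ ≤ κ (+ R)
    in-disc a a≈ = begin
      ‖ ς ⊛ a ⊖ γ A ‖              ≡⟨ cong (λ u → ‖ ς ⊛ a ⊖ u ‖) (S⊛÷S A) ⟨
      ‖ ς ⊛ a ⊖ ς ⊛ a₀ ‖     ≡⟨ cong ‖_‖ (solve 3 (λ s a b → s :* a :- s :* b := s :* (a :- b)) refl ς a a₀) ⟩
      ‖ ς ⊛ (a ⊖ a₀) ‖             ≡⟨ ‖S⊛‖ (a ⊖ a₀) ⟩
      σ * ‖ a ⊖ a₀ ‖                     ≤⟨ *-monoˡ₀ (κ-pos S) a≈ ⟩
      σ * ρ                              ≡⟨ S*/S (κ (+ R)) ⟩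
      κ (+ R)                            ∎
      where
      open ≤-Reasoning
      open ℂ-Solver

    ball : ∀ a → ‖ a ⊖ a₀ ‖ ≤ ρ → Small a
    ball a a≈ = S-cancel (‖ a ‖) (κ (+ 2)) (begin
      σ * ‖ a ‖                ≡⟨ ‖S⊛‖ a ⟨
      ‖ ς ⊛ a ‖          ≤⟨ near (ς ⊛ a) A (in-disc a a≈) ⟩
      κ (+ (nm A ℕ.+ R))       ≡⟨ cong (λ n → κ (+ n)) (ℕ.+-comm (nm A) R) ⟩
      κ (+ (R ℕ.+ nm A))       ≤⟨ κ-mono (ℤ.+≤+ (ℕ.≤ᵇ⇒≤ (R ℕ.+ nm A) (S ℕ.* 2) (proj₁ checks₃))) ⟩
      κ (+ (S ℕ.* 2))          ≡⟨ κℕ-* S 2 ⟩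
      σ * κ (+ 2)              ∎)
      where open ≤-Reasoning

    start : ‖ ev P a₀ ‖ ≤ η
    start = S-cancel (‖ ev P a₀ ‖) η (begin
      σ * ‖ ev P a₀ ‖                        ≡⟨ ‖S⊛‖ (ev P a₀) ⟨
      ‖ ς ⊛ ev P a₀ ‖                  ≤⟨ near (ς ⊛ ev P a₀) (dot P t) (dot-approximates₁ {a₀} P t (subst (length P ℕ.≤_) (sym length-t) (ℕ.≤ᵇ⇒≤ (length P) 9 (proj₁ checks₁))) tracks) ⟩
      κ (+ (nm (dot P t) ℕ.+ err P t))       ≡⟨ S*/S _ ⟨
      σ * η                                  ∎)
      where open ≤-Reasoning

    room : ‖ c ‖ * (η + η) ≤ ρ
    room = S-cancel (‖ c ‖ * (η + η)) ρ (S-cancel (σ * (‖ c ‖ * (η + η))) (σ * ρ) (begin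
      σ * (σ * (‖ c ‖ * (η + η)))            ≡⟨ solve 3 (λ s c e → s :* (s :* (c :* (e :+ e))) := (con 1ℚ :+ con 1ℚ) :* ((s :* c) :* (s :* e))) refl σ (‖ c ‖) η ⟩
      (1ℚ + 1ℚ) * ((σ * ‖ c ‖) * (σ * η))    ≡⟨ cong₂ (λ x y → x * y) (sym κ-2) (cong₂ _*_ S‖c‖ (S*/S _)) ⟩
      κ (+ 2) * (κ (+ nm C) * κ (+ n))       ≡⟨ trans (κℕ-* 2 (nm C ℕ.* n)) (cong (κ (+ 2) *_) (κℕ-* (nm C) n)) ⟨
      κ (+ (2 ℕ.* (nm C ℕ.* n)))             ≤⟨ κ-mono (ℤ.+≤+ (ℕ.≤ᵇ⇒≤ (2 ℕ.* (nm C ℕ.* n)) (S ℕ.* R) (proj₁ checks₄))) ⟩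
      κ (+ (S ℕ.* R))                        ≡⟨ trans (κℕ-* S R) (cong (σ *_) (sym (S*/S (κ (+ R))))) ⟩
      σ * (σ * ρ)                            ∎))
      where
      open ≤-Reasoning
      open +-*-Solver
      n = nm (dot P t) ℕ.+ err P t

    contract : ∀ a b → ‖ a ⊖ a₀ ‖ ≤ ρ → ‖ b ⊖ a₀ ‖ ≤ ρ → ‖ 1ℂ ⊖ c ⊛ dd P a b ‖ ≤ ½
    contract a b a≈ b≈ = κ-cancel′ 2 (ℕ.s≤s ℕ.z≤n) (‖ X ‖) ½ (S-cancel _ _ (S-cancel _ _ (begin
      σ * (σ * (κ (+ 2) * ‖ X ‖))
        ≡⟨ solve 3 (λ s t x → s :* (s :* (t :* x)) := t :* (s :* (s :* x))) refl σ (κ (+ 2)) (‖ X ‖) ⟩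
      κ (+ 2) * (σ * (σ * ‖ X ‖))
        ≡⟨ cong (κ (+ 2) *_) (trans (‖S⊛‖ (ς ⊛ X)) (cong (σ *_) (‖S⊛‖ X))) ⟨
      κ (+ 2) * ‖ ς ⊛ (ς ⊛ X) ‖
        ≤⟨ *-monoˡ₀ (κ-pos 2) (subst (λ u → ‖ u ‖ ≤ κ (+ total)) (sym regroup) bound) ⟩
      κ (+ 2) * κ (+ total)
        ≡⟨ κℕ-* 2 total ⟨
      κ (+ (2 ℕ.* total))
        ≤⟨ κ-mono (ℤ.+≤+ (ℕ.≤ᵇ⇒≤ (2 ℕ.* total) (S ℕ.* S) (proj₂ checks₄))) ⟩
      κ (+ (S ℕ.* S))
        ≡⟨ trans (κℕ-* S S) (trans (solve 1 (λ s → s :* s := s :* (s :* ((con 1ℚ :+ con 1ℚ) :* con ½))) refl σ) (cong (λ u → σ * (σ * (u * ½))) (sym κ-2))) ⟩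
      σ * (σ * (κ (+ 2) * ½)) ∎)))
      where
      open ≤-Reasoning
      open +-*-Solver
      module ℂS = ℂ-Solver
      X = 1ℂ ⊖ c ⊛ dd P a b
      D₀ = dd P a₀ a₀
      Δ = dd P a b ⊖ D₀
      Y = ς ⊛ D₀ ⊖ γ D
      total = nm F ℕ.+ (nm C ℕ.* err (derivative P) t ℕ.+ nm C ℕ.* (ddLip P ℕ.* R))
      small₀ : Small a₀
      small₀ = ball a₀ (subst (λ u → ‖ u ‖ ≤ ρ) (ℂS.solve 1 (λ x → ℂS.con 0ℂ ℂS.:= x ℂS.:- x) refl a₀) (ℚ.≤-trans (0≤‖ a ⊖ a₀ ‖) a≈))
      Y≤ : ‖ Y ‖ ≤ κ (+ err (derivative P) t)
      Y≤ = subst (λ u → ‖ ς ⊛ u ⊖ γ D ‖ ≤ κ (+ err (derivative P) t)) (sym (dd-diagonal P a₀))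
        (dot-approximates₁ {a₀} (derivative P) t (subst (length (derivative P) ℕ.≤_) (sym length-t) (ℕ.≤ᵇ⇒≤ (length (derivative P)) 9 (proj₁ checks₂))) tracks)
      SΔ≤ : ‖ ς ⊛ Δ ‖ ≤ κ (+ (ddLip P ℕ.* R))
      SΔ≤ = begin
        ‖ ς ⊛ Δ ‖                      ≡⟨ ‖S⊛‖ Δ ⟩
        σ * ‖ Δ ‖                            ≤⟨ *-monoˡ₀ (κ-pos S) (dd-Lipschitz P small₀ (ball a a≈) (ball b b≈) a≈ b≈) ⟩
        σ * (κ (+ ddLip P) * ρ)              ≡⟨ solve 3 (λ s l r → s :* (l :* r) := l :* (s :* r)) refl σ (κ (+ ddLip P)) ρ ⟩
        κ (+ ddLip P) * (σ * ρ)              ≡⟨ cong (κ (+ ddLip P) *_) (S*/S (κ (+ R))) ⟩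
        κ (+ ddLip P) * κ (+ R)              ≡⟨ κℕ-* (ddLip P) R ⟨
        κ (+ (ddLip P ℕ.* R))                ∎
      ι-1 : ι -1ℤ ≡ ⊝ 1ℂ
      ι-1 = cong (_+i 0ℚ) (trans (κ-neg 1ℤ) (cong -_ κ-1))
      γF : γ F ≡ ς ⊛ ς ⊖ γ C ⊛ γ D
      γF = trans (γ-axpy -1ℤ (C · D) (+ (S ℕ.* S) +I 0ℤ))
        (trans (cong₂ (λ x y → ι -1ℤ ⊛ x ⊕ y) (γ-· C D) (trans (cong (κ (+ (S ℕ.* S)) +i_) κ-0) (trans (cong ι (ℤ.pos-* S S)) (ι-* (+ S) (+ S)))))
          (trans (cong (λ u → u ⊛ (γ C ⊛ γ D) ⊕ ς ⊛ ς) ι-1)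
            (ℂS.solve 2 (λ x y → ℂS.con (⊝ 1ℂ) ℂS.:* x ℂS.:+ y ℂS.:= y ℂS.:- x) refl (γ C ⊛ γ D) (ς ⊛ ς))))
      -- Separates the computed integer `F` from the error `Y` at the centre and the change `Δ`
      -- within the disc.
      regroup : ς ⊛ (ς ⊛ X) ≡ γ F ⊕ (⊝ (γ C ⊛ Y) ⊕ ⊝ (γ C ⊛ (ς ⊛ Δ)))
      regroup = trans
        (ℂS.solve 5 (λ s c D₀ d G → s ℂS.:* (s ℂS.:* (ℂS.con 1ℂ ℂS.:- c ℂS.:* d)) ℂS.:=
            (s ℂS.:* s ℂS.:- (s ℂS.:* c) ℂS.:* G) ℂS.:+ ((ℂS.:- ((s ℂS.:* c) ℂS.:* (s ℂS.:* D₀ ℂS.:- G))) ℂS.:+ (ℂS.:- ((s ℂS.:* c) ℂS.:* (s ℂS.:* (d ℂS.:- D₀))))))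
          refl ς c D₀ (dd P a b) (γ D))
        (cong₂ (λ u v → u ⊕ (⊝ (v ⊛ Y) ⊕ ⊝ (v ⊛ (ς ⊛ Δ)))) (trans (cong (λ v → ς ⊛ ς ⊖ v ⊛ γ D) (S⊛÷S C)) (sym γF)) (S⊛÷S C))
      C≤ : ‖ γ C ‖ ≤ κ (+ nm C)
      C≤ = ℚ.≤-reflexive (‖γ‖ C)
      bound : ‖ γ F ⊕ (⊝ (γ C ⊛ Y) ⊕ ⊝ (γ C ⊛ (ς ⊛ Δ))) ‖ ≤ κ (+ total)
      bound = ℚ.≤-trans
        (⊕-bound (γ F) (⊝ (γ C ⊛ Y) ⊕ ⊝ (γ C ⊛ (ς ⊛ Δ))) (ℚ.≤-reflexive (‖γ‖ F))
          (⊕-bound (⊝ (γ C ⊛ Y)) (⊝ (γ C ⊛ (ς ⊛ Δ)))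
            (ℚ.≤-trans (ℚ.≤-reflexive (‖⊝‖ (γ C ⊛ Y))) (⊛-bound (γ C) Y C≤ Y≤))
            (ℚ.≤-trans (ℚ.≤-reflexive (‖⊝‖ (γ C ⊛ (ς ⊛ Δ)))) (⊛-bound (γ C) (ς ⊛ Δ) C≤ SΔ≤))))
        (ℚ.≤-reflexive (sym (trans (κℕ-+ (nm F) _) (cong (λ u → κ (+ nm F) + u)
          (trans (κℕ-+ (nm C ℕ.* err (derivative P) t) _) (cong₂ _+_ (κℕ-* (nm C) _) (κℕ-* (nm C) _)))))))

    approachable : Approachable P (λ a → ‖ ς ⊛ a ⊖ γ A ‖ ≤ κ (+ R))
    approachable = C' , λ k → let a , a≈ , small , close = approach k in a , in-disc a a≈ , small , close
      where
      n = nm (dot P t) ℕ.+ err P t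
      η≤n : η ≤ κ (+ n)
      η≤n = S-cancel η (κ (+ n)) (begin
        σ * η             ≡⟨ S*/S (κ (+ n)) ⟩
        κ (+ n)           ≤⟨ κ-mono (ℤ.+≤+ (ℕ.m≤n*m n S)) ⟩
        κ (+ (S ℕ.* n))   ≡⟨ κℕ-* S n ⟩
        σ * κ (+ n)       ∎)
        where open ≤-Reasoning
      newton : Approachable P (λ a → ‖ a ⊖ a₀ ‖ ≤ ρ)
      newton = Newton.approachable P a₀ c η ρ ball start room contract n η≤n
      C' = proj₁ newton
      approach = proj₂ newton

  -- For a table of a⁰, ..., aᵐ these bound S (‖a⁰‖ + ... + ‖aᵐ⁻¹‖) and S ‖aᵐ‖. The last power is
  -- kept apart, as the factor in front of everything beyond the table.
  mass last : Table → ℕ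
  mass []                  = 0
  mass (_ ∷ [])            = 0
  mass ((w , e) ∷ x ∷ t)   = (nm w ℕ.+ e) ℕ.+ mass (x ∷ t)
  last []            = S
  last ((w , e) ∷ []) = nm w ℕ.+ e
  last (_ ∷ x ∷ t)   = last (x ∷ t)

  Direction : Set
  Direction = ℤ × ℤ

  -- The unit ball of the norm dual to |Re| + |Im|, so that these functionals never exceed ‖_‖.
  Unit : Direction → Set
  Unit (s , t) = ℤ.∣ s ∣ ℕ.≤ 1 × ℤ.∣ t ∣ ℕ.≤ 1

  along : Direction → 𝔾 → ℤ
  along (s , t) (x +I y) = s ℤ.* x ℤ.+ t ℤ.* y

  positivePart : ℤ → ℕ
  positivePart (+ n)    = n
  positivePart -[1+ _ ] = 0

  -- Support function of the zonotope spanned by the tabulated powers, errors included: a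
  -- coefficient 0 or 1 contributes at most the positive part of its term.
  reach : Direction → Table → ℕ
  reach f []                = 0
  reach f (_ ∷ [])          = 0
  reach f ((w , e) ∷ x ∷ t) = positivePart (along f w ℤ.+ + e) ℕ.+ reach f (x ∷ t)

  φ : Direction → ℂ → ℚ
  φ (s , t) z = κ s * re z + κ t * im z

  φ-⊕ : ∀ f y z → φ f (y ⊕ z) ≡ φ f y + φ f z
  φ-⊕ (s , t) y z = solve 6 (λ s t a b c d → s :* (a :+ c) :+ t :* (b :+ d) := s :* a :+ t :* b :+ (s :* c :+ t :* d)) refl (κ s) (κ t) (re y) (im y) (re z) (im z)
    where open +-*-Solver

  φ-γ : ∀ f x → φ f (γ x) ≡ κ (along f x)
  φ-γ (s , t) (x +I y) = sym (trans (κ-+ _ _) (cong₂ _+_ (κ-* s x) (κ-* t y)))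

  φ≤‖_‖ : ∀ z f → Unit f → φ f z ≤ ‖ z ‖
  φ≤‖ z ‖ (s , t) (s≤1 , t≤1) = ℚ.+-mono-≤ (part s (re z) s≤1) (part t (im z) t≤1)
    where
    open ≤-Reasoning
    part : ∀ s x → ℤ.∣ s ∣ ℕ.≤ 1 → κ s * x ≤ ∣ x ∣
    part s x s≤1 = begin
      κ s * x               ≤⟨ p≤∣p∣ (κ s * x) ⟩
      ∣ κ s * x ∣           ≡⟨ trans (ℚ.∣p*q∣≡∣p∣*∣q∣ (κ s) x) (cong (_* ∣ x ∣) (κ-abs s)) ⟩
      κ (+ ℤ.∣ s ∣) * ∣ x ∣ ≤⟨ *-monoʳ₀ (ℚ.0≤∣p∣ x) (κ-mono (ℤ.+≤+ s≤1)) ⟩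
      κ 1ℤ * ∣ x ∣          ≡⟨ trans (cong (_* ∣ x ∣) κ-1) (ℚ.*-identityˡ (∣ x ∣)) ⟩
      ∣ x ∣                 ∎

  φ-approx : ∀ f z x {e} → Unit f → ‖ z ⊖ γ x ‖ ≤ κ (+ e) → φ f z ≤ κ (along f x ℤ.+ + e)
  φ-approx f z x {e} unit z≈x = begin
    φ f z                        ≡⟨ cong (φ f) (C.solve 2 (λ z x → z C.:= x C.:+ (z C.:- x)) refl z (γ x)) ⟩
    φ f (γ x ⊕ (z ⊖ γ x))        ≡⟨ φ-⊕ f (γ x) (z ⊖ γ x) ⟩
    φ f (γ x) + φ f (z ⊖ γ x)    ≤⟨ ℚ.+-mono-≤ (ℚ.≤-reflexive (φ-γ f x)) (ℚ.≤-trans (φ≤‖ z ⊖ γ x ‖ f unit) z≈x) ⟩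
    κ (along f x) + κ (+ e)      ≡⟨ κ-+ (along f x) (+ e) ⟨
    κ (along f x ℤ.+ + e)        ∎
    where
    open ≤-Reasoning
    module C = ℂ-Solver

  -- For a 0/1 polynomial n, bound u(S z n(a)) for a subadditive u by summing per-entry bounds g over the table and
  -- estimating the part of n beyond the table through β.
  module TableSum (u : ℂ → ℚ) (u-⊕ : ∀ y z → u (y ⊕ z) ≤ u y + u z) (u≤ : ∀ z → u z ≤ ‖ z ‖)
    (g : 𝔾 × ℕ → ℕ) (g-bound : ∀ z w e → ‖ z ⊖ γ w ‖ ≤ κ (+ e) → u z ≤ κ (+ g (w , e))) where

    total : Table → ℕ
    total []          = 0
    total (_ ∷ [])    = 0
    total (x ∷ y ∷ t) = g x ℕ.+ total (y ∷ t)

    u-0 : ∀ z → u (ς ⊛ (z ⊛ 0ℂ)) ≤ 0ℚ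
    u-0 z = ℚ.≤-trans (u≤ (ς ⊛ (z ⊛ 0ℂ))) (ℚ.≤-reflexive (trans (cong ‖_‖ vanishes) ‖0‖))
      where
      open ℂ-Solver
      ‖0‖ : ‖ 0ℂ ‖ ≡ 0ℚ
      ‖0‖ = refl
      vanishes : ς ⊛ (z ⊛ 0ℂ) ≡ 0ℂ
      vanishes = solve 2 (λ s z → s :* (z :* con 0ℂ) := con 0ℂ) refl ς z

    -- The hypothesis concerns only the part m of n beyond the table. Its length equation makes m
    -- shorter than n once the table has two entries, which admits an induction on length.
    sum-bound : ∀ {a β} → 0ℚ ≤ β → ∀ x t z n → ZeroOne n → Tracks a z (x ∷ t) →
      (∀ m → ZeroOne m → length n ≡ length t ℕ.+ length m → ‖ ev m a ‖ ≤ β) →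
      u (ς ⊛ (z ⊛ ev n a)) ≤ κ (+ total (x ∷ t)) + κ (+ last (x ∷ t)) * β
    sum-bound {a} {β} 0≤β x t z [] _ _ _ = ℚ.≤-trans (u-0 z) (0≤+ (κ-pos (total (x ∷ t))) (0≤* (κ-pos (last (x ∷ t))) 0≤β))
    sum-bound {a} {β} 0≤β (w , e) [] z n n01 (z≈ , _) short = begin
      u (ς ⊛ (z ⊛ ev n a))           ≤⟨ u≤ (ς ⊛ (z ⊛ ev n a)) ⟩
      ‖ ς ⊛ (z ⊛ ev n a) ‖           ≡⟨ cong ‖_‖ (sym (⊛-assoc ς z (ev n a))) ⟩
      ‖ (ς ⊛ z) ⊛ ev n a ‖           ≤⟨ ⊛-bound (ς ⊛ z) (ev n a) (near (ς ⊛ z) w z≈) (short n n01 refl) ⟩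
      κ (+ (nm w ℕ.+ e)) * β               ≡⟨ trans (sym (ℚ.+-identityˡ (κ (+ (nm w ℕ.+ e)) * β))) (cong (_+ κ (+ (nm w ℕ.+ e)) * β) (sym κ-0)) ⟩
      κ (+ 0) + κ (+ (nm w ℕ.+ e)) * β     ∎
      where open ≤-Reasoning
    sum-bound {a} {β} 0≤β (w , e) (y ∷ t) z (c ∷ n) (c01 ∷ n01) (z≈ , tr) short = begin
      u (ς ⊛ (z ⊛ (ι c ⊕ a ⊛ ev n a)))
        ≡⟨ cong u (C.solve 5 (λ s z c a v → s C.:* (z C.:* (c C.:+ a C.:* v)) C.:= c C.:* (s C.:* z) C.:+ s C.:* ((a C.:* z) C.:* v)) refl ς z (ι c) a (ev n a)) ⟩
      u (ι c ⊛ (ς ⊛ z) ⊕ rest)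
        ≤⟨ u-⊕ (ι c ⊛ (ς ⊛ z)) rest ⟩
      u (ι c ⊛ (ς ⊛ z)) + u rest
        ≤⟨ ℚ.+-mono-≤ (head c01) (sum-bound 0≤β y t (a ⊛ z) n n01 tr (λ m m01 eq → short m m01 (cong suc eq))) ⟩
      κ (+ g (w , e)) + (κ (+ total (y ∷ t)) + κ (+ last (y ∷ t)) * β)
        ≡⟨ trans (sym (ℚ.+-assoc (κ (+ g (w , e))) (κ (+ total (y ∷ t))) (κ (+ last (y ∷ t)) * β))) (cong (_+ κ (+ last (y ∷ t)) * β) (sym (κℕ-+ (g (w , e)) (total (y ∷ t))))) ⟩
      κ (+ (g (w , e) ℕ.+ total (y ∷ t))) + κ (+ last (y ∷ t)) * β ∎
      where
      open ≤-Reasoning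
      module C = ℂ-Solver
      rest = ς ⊛ ((a ⊛ z) ⊛ ev n a)
      head : ∀ {c} → c ≡ 0ℤ ⊎ c ≡ 1ℤ → u (ι c ⊛ (ς ⊛ z)) ≤ κ (+ g (w , e))
      head (inj₁ refl) = ℚ.≤-trans (u≤ (ι 0ℤ ⊛ (ς ⊛ z)))
        (ℚ.≤-trans (ℚ.≤-reflexive (trans (‖ι⊛‖ 0ℤ (ς ⊛ z)) (trans (cong (_* ‖ ς ⊛ z ‖) κ-0) (ℚ.*-zeroˡ (‖ ς ⊛ z ‖))))) (κ-pos (g (w , e))))
      head (inj₂ refl) = subst (λ v → u v ≤ κ (+ g (w , e))) (sym (trans (cong (λ k → (k +i 0ℚ) ⊛ (ς ⊛ z)) κ-1) (1⊛ (ς ⊛ z)))) (g-bound (ς ⊛ z) w e z≈)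

  κ≤κ-positivePart : ∀ i → κ i ≤ κ (+ positivePart i)
  κ≤κ-positivePart (+ n)    = ℚ.≤-refl
  κ≤κ-positivePart -[1+ n ] = κ-mono ℤ.-≤+

  -- If B bounds ‖m(a)‖ for shorter m, then splitting n at the last tabulated power gives S ‖n(a)‖ ≤
  -- mass + last · B. By `contracting` the value `β` = 2 mass / S reproduces itself. Two entries are
  -- required so that the split really shortens n.
  module Zonotope (a : ℂ) (x y : 𝔾 × ℕ) (t : Table) (tracks : Tracks a 1ℂ (x ∷ y ∷ t))
    (contracting : 2 ℕ.* last (x ∷ y ∷ t) ℕ.≤ S) where

    tbl : Table
    tbl = x ∷ y ∷ t

    module Norm = TableSum ‖_‖ ‖⊕‖ (λ z → ℚ.≤-refl) (λ (w , e) → nm w ℕ.+ e) (λ z w e → near z w)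

    total-mass : ∀ t → Norm.total t ≡ mass t
    total-mass []          = refl
    total-mass (_ ∷ [])    = refl
    total-mass ((w , e) ∷ y ∷ t) = cong ((nm w ℕ.+ e) ℕ.+_) (total-mass (y ∷ t))

    β : ℚ
    β = κ (+ (2 ℕ.* mass tbl)) /S

    0≤β : 0ℚ ≤ β
    0≤β = S-cancel 0ℚ β (subst₂ _≤_ (sym (ℚ.*-zeroʳ σ)) (sym (S*/S (κ (+ (2 ℕ.* mass tbl))))) (κ-pos (2 ℕ.* mass tbl)))

    lastβ≤mass : κ (+ last tbl) * β ≤ κ (+ mass tbl)
    lastβ≤mass = κ-cancel′ 2 (ℕ.s≤s ℕ.z≤n) (κ (+ last tbl) * β) (κ (+ mass tbl)) (begin
      κ (+ 2) * (κ (+ last tbl) * β)      ≡⟨ trans (sym (ℚ.*-assoc (κ (+ 2)) (κ (+ last tbl)) β)) (cong (_* β) (sym (κℕ-* 2 (last tbl)))) ⟩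
      κ (+ (2 ℕ.* last tbl)) * β          ≤⟨ *-monoʳ₀ 0≤β (κ-mono (ℤ.+≤+ contracting)) ⟩
      σ * β                               ≡⟨ S*/S (κ (+ (2 ℕ.* mass tbl))) ⟩
      κ (+ (2 ℕ.* mass tbl))              ≡⟨ κℕ-* 2 (mass tbl) ⟩
      κ (+ 2) * κ (+ mass tbl)            ∎)
      where open ≤-Reasoning

    ev-bounded : ∀ k n → length n ℕ.< k → ZeroOne n → ‖ ev n a ‖ ≤ β
    ev-bounded zero    n ()
    ev-bounded (suc k) n (ℕ.s≤s n≤k) n01 = S-cancel (‖ ev n a ‖) β (begin
      σ * ‖ ev n a ‖                                     ≡⟨ trans (cong (λ v → ‖ ς ⊛ v ‖) (1⊛ (ev n a))) (‖S⊛‖ (ev n a)) ⟨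
      ‖ ς ⊛ (1ℂ ⊛ ev n a) ‖                        ≤⟨ Norm.sum-bound 0≤β x (y ∷ t) 1ℂ n n01 tracks shorter ⟩
      κ (+ Norm.total tbl) + κ (+ last tbl) * β          ≤⟨ ℚ.+-mono-≤ (ℚ.≤-reflexive (cong (λ m → κ (+ m)) (total-mass tbl))) lastβ≤mass ⟩
      κ (+ mass tbl) + κ (+ mass tbl)                    ≡⟨ trans (cong (λ m → κ (+ (mass tbl ℕ.+ m))) (ℕ.+-identityʳ (mass tbl))) (κℕ-+ (mass tbl) (mass tbl)) ⟨
      κ (+ (2 ℕ.* mass tbl))                             ≡⟨ S*/S (κ (+ (2 ℕ.* mass tbl))) ⟨
      σ * β                                              ∎)
      where
      open ≤-Reasoning
      shorter : ∀ m → ZeroOne m → length n ≡ suc (length t) ℕ.+ length m → ‖ ev m a ‖ ≤ β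
      shorter m m01 eq = ev-bounded k m (ℕ.≤-trans (ℕ.s≤s (ℕ.m≤n+m (length m) (length t))) (ℕ.≤-trans (ℕ.≤-reflexive (sym eq)) n≤k)) m01

    -- An integer above last · β, by which the polygon is enlarged to make room for coefficients
    -- beyond the table.
    overflow : ℕ
    overflow = suc ((last tbl ℕ.* (2 ℕ.* mass tbl)) ℕ./ S)

    lastβ≤overflow : κ (+ last tbl) * β ≤ κ (+ overflow)
    lastβ≤overflow = S-cancel (κ (+ last tbl) * β) (κ (+ overflow)) (begin
      σ * (κ (+ last tbl) * β)                     ≡⟨ solve 3 (λ s l b → s :* (l :* b) := l :* (s :* b)) refl σ (κ (+ last tbl)) β ⟩
      κ (+ last tbl) * (σ * β)                     ≡⟨ cong (κ (+ last tbl) *_) (S*/S (κ (+ (2 ℕ.* mass tbl)))) ⟩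
      κ (+ last tbl) * κ (+ (2 ℕ.* mass tbl))      ≡⟨ κℕ-* (last tbl) (2 ℕ.* mass tbl) ⟨
      κ (+ (last tbl ℕ.* (2 ℕ.* mass tbl)))        ≤⟨ κ-mono (ℤ.+≤+ (n≤S*⌈n/S⌉ (last tbl ℕ.* (2 ℕ.* mass tbl)))) ⟩
      κ (+ (S ℕ.* overflow))                       ≡⟨ κℕ-* S overflow ⟩
      σ * κ (+ overflow)                           ∎)
      where
      open ≤-Reasoning
      open +-*-Solver

    φ-bounded : ∀ f → Unit f → ∀ n → ZeroOne n → φ f (ς ⊛ ev n a) ≤ κ (+ (reach f tbl ℕ.+ overflow))
    φ-bounded f unit n n01 = begin
      φ f (ς ⊛ ev n a)                                 ≡⟨ cong (λ v → φ f (ς ⊛ v)) (1⊛ (ev n a)) ⟨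
      φ f (ς ⊛ (1ℂ ⊛ ev n a))                          ≤⟨ Along.sum-bound 0≤β x (y ∷ t) 1ℂ n n01 tracks (λ m m01 _ → ev-bounded (suc (length m)) m ℕ.≤-refl m01) ⟩
      κ (+ Along.total tbl) + κ (+ last tbl) * β             ≤⟨ ℚ.+-mono-≤ (ℚ.≤-reflexive (cong (λ m → κ (+ m)) (total-reach tbl))) lastβ≤overflow ⟩
      κ (+ reach f tbl) + κ (+ overflow)                     ≡⟨ κℕ-+ (reach f tbl) overflow ⟨
      κ (+ (reach f tbl ℕ.+ overflow))                       ∎
      where
      open ≤-Reasoning
      module Along = TableSum (φ f) (λ y z → ℚ.≤-reflexive (φ-⊕ f y z)) (λ z → φ≤‖ z ‖ f unit) (λ (w , e) → positivePart (along f w ℤ.+ + e))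
        (λ z w e z≈ → ℚ.≤-trans (φ-approx f z w unit z≈) (κ≤κ-positivePart (along f w ℤ.+ + e)))
      total-reach : ∀ t → Along.total t ≡ reach f t
      total-reach []          = refl
      total-reach (_ ∷ [])    = refl
      total-reach ((w , e) ∷ y ∷ t) = cong (positivePart (along f w ℤ.+ + e) ℕ.+_) (total-reach (y ∷ t))

  Unreachable : Poly → Poly → Set
  Unreachable P V = ∀ n Q → ZeroOne n → (P *ₚ Q) ≋ (V +ₚ n) → ⊥

  overflow : Table → ℕ
  overflow t = suc ((last t ℕ.* (2 ℕ.* mass t)) ℕ./ S)

  -- At a suitable approximate root S ‖V(a) + m(a)‖ ≤ 1, so f takes a value of at least -1 at S
  -- (V(a) + m(a)), while `negative` forces it down to -2. This is the 2 in the inequality.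
  escapes : ∀ P A n f V → Approachable P (λ a → ‖ ς ⊛ a ⊖ γ A ‖ ≤ κ (+ R)) → Unit f →
    (let t = powers A R (suc (suc n))) → 2 ℕ.* last t ℕ.≤ S → length V ℕ.≤ length t →
    along f (dot V t) ℤ.+ + (2 ℕ.+ (err V t ℕ.+ (reach f t ℕ.+ overflow t))) ℤ.≤ 0ℤ → Unreachable P V
  escapes P A n f V approach unit contracting V≤t negative m Q m01 PQ≋V+m = absurd (multiple-small P approach (V +ₚ m) (Q , PQ≋V+m) S)
    where
    open ≤-Reasoning
    t = powers A R (suc (suc n))
    h = reach f t ℕ.+ overflow t
    -- The first two entries are spelled out because `Zonotope` expects a table of the form x ∷ y ∷
    -- t.
    w₀ = + S +I 0ℤ
    w₁ = round (w₀ · A)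
    e₁ = nextError A R w₀ 0 (w₀ · A) w₁
    w₂ = round (w₁ · A)
    e₂ = nextError A R w₁ e₁ (w₁ · A) w₂
    absurd : (∃ λ a → ‖ ς ⊛ a ⊖ γ A ‖ ≤ κ (+ R) × Small a × σ * ‖ ev (V +ₚ m) a ‖ ≤ 1ℚ) → ⊥
    absurd (a , a≈ , _ , close) = ℚ.<-irrefl refl (begin-strict
      1ℚ                                                 <⟨ ℚ.+-monoʳ-< 1ℚ (ℚ.positive⁻¹ 1ℚ) ⟩
      1ℚ + 1ℚ                                            ≡⟨ solve 2 (λ x y → con 1ℚ :+ con 1ℚ := (con 1ℚ :+ con 1ℚ) :+ (x :+ y) :- (x :+ y)) refl (κ (along f (dot V t) ℤ.+ + err V t)) (κ (+ h)) ⟩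
      1ℚ + 1ℚ + (κ (along f (dot V t) ℤ.+ + err V t) + κ (+ h)) - (κ (along f (dot V t) ℤ.+ + err V t) + κ (+ h))
        ≡⟨ cong (λ v → v - (κ (along f (dot V t) ℤ.+ + err V t) + κ (+ h))) assemble ⟩
      κ (along f (dot V t) ℤ.+ + (2 ℕ.+ (err V t ℕ.+ h))) - (κ (along f (dot V t) ℤ.+ + err V t) + κ (+ h))
        ≤⟨ ℚ.+-mono-≤ (ℚ.≤-trans (κ-mono negative) (ℚ.≤-reflexive κ-0)) (ℚ.neg-antimono-≤ value) ⟩
      0ℚ - φ f (ς ⊛ ev (V +ₚ m) a)                 ≡⟨ trans (ℚ.+-identityˡ (- φ f (ς ⊛ ev (V +ₚ m) a))) (φ-neg f (ς ⊛ ev (V +ₚ m) a)) ⟩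
      φ f (⊝ (ς ⊛ ev (V +ₚ m) a))                  ≤⟨ φ≤‖ ⊝ (ς ⊛ ev (V +ₚ m) a) ‖ f unit ⟩
      ‖ ⊝ (ς ⊛ ev (V +ₚ m) a) ‖                    ≡⟨ trans (‖⊝‖ (ς ⊛ ev (V +ₚ m) a)) (‖S⊛‖ (ev (V +ₚ m) a)) ⟩
      σ * ‖ ev (V +ₚ m) a ‖                              ≤⟨ close ⟩
      1ℚ                                                 ∎)
      where
      open +-*-Solver
      tr : Tracks a 1ℂ t
      tr = powers-tracks {a} A R (suc (suc n)) a≈
      φ-neg : ∀ f z → - φ f z ≡ φ f (⊝ z)
      φ-neg (s , t) z = solve 4 (λ s t a b → :- (s :* a :+ t :* b) := s :* (:- a) :+ t :* (:- b)) refl (κ s) (κ t) (re z) (im z)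
      assemble : 1ℚ + 1ℚ + (κ (along f (dot V t) ℤ.+ + err V t) + κ (+ h)) ≡ κ (along f (dot V t) ℤ.+ + (2 ℕ.+ (err V t ℕ.+ h)))
      assemble = trans (cong (λ v → 1ℚ + 1ℚ + (v + κ (+ h))) (κ-+ (along f (dot V t)) (+ err V t)))
        (trans (solve 3 (λ x e h → con 1ℚ :+ con 1ℚ :+ (x :+ e :+ h) := x :+ (con 1ℚ :+ con 1ℚ :+ (e :+ h))) refl (κ (along f (dot V t))) (κ (+ err V t)) (κ (+ h)))
          (sym (trans (κ-+ (along f (dot V t)) (+ (2 ℕ.+ (err V t ℕ.+ h))))
            (cong (λ v → κ (along f (dot V t)) + v) (trans (κℕ-+ 2 (err V t ℕ.+ h)) (cong₂ _+_ κ-2 (κℕ-+ (err V t) h)))))))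
      value : φ f (ς ⊛ ev (V +ₚ m) a) ≤ κ (along f (dot V t) ℤ.+ + err V t) + κ (+ h)
      value = begin
        φ f (ς ⊛ ev (V +ₚ m) a)                            ≡⟨ cong (λ v → φ f (ς ⊛ v)) (ev-+ₚ V m a) ⟩
        φ f (ς ⊛ (ev V a ⊕ ev m a))                        ≡⟨ cong (φ f) (⊛-distribˡ ς (ev V a) (ev m a)) ⟩
        φ f (ς ⊛ ev V a ⊕ ς ⊛ ev m a)                ≡⟨ φ-⊕ f (ς ⊛ ev V a) (ς ⊛ ev m a) ⟩
        φ f (ς ⊛ ev V a) + φ f (ς ⊛ ev m a)
          ≤⟨ ℚ.+-mono-≤ (φ-approx f (ς ⊛ ev V a) (dot V t) unit (dot-approximates₁ {a} V t V≤t tr))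
               (Zonotope.φ-bounded a (w₀ , 0) (w₁ , e₁) (table A R n w₂ e₂) tr contracting f unit m m01) ⟩
        κ (along f (dot V t) ℤ.+ + err V t) + κ (+ h)            ∎

-- Refuting Newman multiples by a finite state search

module Search (S : ℕ) {{S≢0 : ℕ.NonZero S}} (R : ℕ) where

  open Analysis using (ZeroOne; derivative)
  open Polynomials
  open Escape S R
  open import Data.Integer using (_+_; _*_; -_; ∣_∣)
  open import Data.Integer.Solver using (module +-*-Solver)

  -- (V + c − qP) / X for the q cancelling the constant term, where P = 1 + X P'.
  step : Poly → Poly → ℤ → Poly
  step P' V c = tail V +ₚ map ((- (coeff V 0 + c)) *_) P'

  -- As P has constant term 1, the constant term of Q can only be V₀ + n₀. Removing that multiple of
  -- P and dividing by X leaves the same situation for the tails.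
  step-sound : ∀ P' V n Q → ((1ℤ ∷ P') *ₚ Q) ≋ (V +ₚ n) → ((1ℤ ∷ P') *ₚ tail Q) ≋ (step P' V (coeff n 0) +ₚ tail n)
  step-sound P' V n Q PQ≋V+n m = begin
    coeff (P *ₚ tail Q) m
      ≡⟨ solve 3 (λ q p x → x := :- (con 1ℤ :* q) :* p :+ (q :* p :+ x)) refl (coeff Q 0) (coeff P' m) (coeff (P *ₚ tail Q) m) ⟩
    - (1ℤ * coeff Q 0) * coeff P' m + (coeff Q 0 * coeff P' m + coeff (P *ₚ tail Q) m)
      ≡⟨ cong₂ (λ u v → - u * coeff P' m + v) (trans (sym (coeff-*ₚ-0 P Q)) (trans (PQ≋V+n 0) (coeff-+ₚ V n 0)))
           (trans (sym (coeff-*ₚ-tail P Q (suc m))) (trans (PQ≋V+n (suc m)) (coeff-+ₚ V n (suc m)))) ⟩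
    k * coeff P' m + (coeff V (suc m) + coeff n (suc m))
      ≡⟨ solve 3 (λ x y z → x :+ (y :+ z) := (y :+ x) :+ z) refl (k * coeff P' m) (coeff V (suc m)) (coeff n (suc m)) ⟩
    (coeff V (suc m) + k * coeff P' m) + coeff n (suc m)
      ≡⟨ cong₂ _+_ (cong₂ _+_ (sym (coeff-tail V m)) (sym (coeff-map k P' m))) (sym (coeff-tail n m)) ⟩
    (coeff (tail V) m + coeff (map (k *_) P') m) + coeff (tail n) m
      ≡⟨ cong (_+ coeff (tail n) m) (coeff-+ₚ (tail V) (map (k *_) P') m) ⟨
    coeff (step P' V (coeff n 0)) m + coeff (tail n) m
      ≡⟨ coeff-+ₚ (step P' V (coeff n 0)) (tail n) m ⟨
    coeff (step P' V (coeff n 0) +ₚ tail n) m ∎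
    where
    open ≡-Reasoning
    open +-*-Solver
    P = 1ℤ ∷ P'
    k = - (coeff V 0 + coeff n 0)

  -- Boolean tests

  infix 4 _≡ℤᵇ_ _≡ₚᵇ_

  _≡ℤᵇ_ : ℤ → ℤ → Bool
  + m      ≡ℤᵇ + n      = m ℕ.≡ᵇ n
  -[1+ m ] ≡ℤᵇ -[1+ n ] = m ℕ.≡ᵇ n
  _        ≡ℤᵇ _        = false

  ≡ℤᵇ⇒≡ : ∀ i j → T (i ≡ℤᵇ j) → i ≡ j
  ≡ℤᵇ⇒≡ (+ m)    (+ n)    eq = cong +_ (ℕ.≡ᵇ⇒≡ m n eq)
  ≡ℤᵇ⇒≡ -[1+ m ] -[1+ n ] eq = cong -[1+_] (ℕ.≡ᵇ⇒≡ m n eq)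

  _≡ₚᵇ_ : Poly → Poly → Bool
  []      ≡ₚᵇ []      = true
  (a ∷ p) ≡ₚᵇ (b ∷ q) = (a ≡ℤᵇ b) ∧ (p ≡ₚᵇ q)
  _       ≡ₚᵇ _       = false

  ≡ₚᵇ⇒≡ : ∀ p q → T (p ≡ₚᵇ q) → p ≡ q
  ≡ₚᵇ⇒≡ []      []      _  = refl
  ≡ₚᵇ⇒≡ (a ∷ p) (b ∷ q) eq = let e , es = ∧-split {a ≡ℤᵇ b} eq in cong₂ _∷_ (≡ℤᵇ⇒≡ a b e) (≡ₚᵇ⇒≡ p q es)

  ∨-split : ∀ {x y} → T (x ∨ y) → T x ⊎ T y
  ∨-split {true}  _ = inj₁ tt
  ∨-split {false} h = inj₂ h

  any-∈ : ∀ {A : Set} (f : A → Bool) xs → T (any f xs) → ∃ λ x → x ∈ xs × T (f x)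
  any-∈ f (x ∷ xs) h with ∨-split {f x} h
  ... | inj₁ fx = x , here refl , fx
  ... | inj₂ h' = let y , y∈ , fy = any-∈ f xs h' in y , there y∈ , fy

  all-∈ : ∀ {A : Set} (f : A → Bool) xs → T (all f xs) → ∀ {x} → x ∈ xs → T (f x)
  all-∈ f (x ∷ xs) h (here refl) = proj₁ (∧-split {f x} h)
  all-∈ f (x ∷ xs) h (there x∈)  = all-∈ f xs (proj₂ (∧-split {f x} h)) x∈

  memberᵇ : Poly → List Poly → Bool
  memberᵇ V = any (V ≡ₚᵇ_)

  memberᵇ⇒∈ : ∀ V Vs → T (memberᵇ V Vs) → V ∈ Vs
  memberᵇ⇒∈ V Vs h = let W , W∈ , eq = any-∈ (V ≡ₚᵇ_) Vs h in subst (_∈ Vs) (sym (≡ₚᵇ⇒≡ V W eq)) W∈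

  nonzeroᵇ : Poly → Bool
  nonzeroᵇ = any (λ c → not (c ≡ℤᵇ 0ℤ))

  nonzeroᵇ-sound : ∀ V → T (nonzeroᵇ V) → V ≋ [] → ⊥
  nonzeroᵇ-sound (c ∷ V) h V≋0 with c | V≋0 0
  ... | _ | refl = nonzeroᵇ-sound V h (λ n → V≋0 (suc n))

  +ₚ-[] : ∀ V → (V +ₚ []) ≋ V
  +ₚ-[] V n = trans (coeff-+ₚ V [] n) (ℤ.+-identityʳ _)

  ZeroOne-tail : ∀ {n} → ZeroOne n → ZeroOne (tail n)
  ZeroOne-tail []       = []
  ZeroOne-tail (_ ∷ hs) = hs

  ZeroOne-head : ∀ {n} → ZeroOne n → coeff n 0 ≡ 0ℤ ⊎ coeff n 0 ≡ 1ℤ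
  ZeroOne-head []      = inj₁ refl
  ZeroOne-head (h ∷ _) = h

  -- Each step shortens n or Q, and zeros are read once n has run out. When both are empty the state
  -- is 0, which `nonzero` excludes.
  module Closed (P' : Poly) (Vs : List Poly)
    (nonzero : ∀ {V} → V ∈ Vs → V ≋ [] → ⊥)
    (next : ∀ {V} → V ∈ Vs → ∀ c → c ≡ 0ℤ ⊎ c ≡ 1ℤ → step P' V c ∈ Vs ⊎ Unreachable (1ℤ ∷ P') (step P' V c)) where

    P = 1ℤ ∷ P'

    unreachable : ∀ k {V} → V ∈ Vs → ∀ n Q → length n ℕ.+ length Q ℕ.≤ k → ZeroOne n → (P *ₚ Q) ≋ (V +ₚ n) → ⊥
    continue : ∀ k {V} → V ∈ Vs → ∀ n Q → length (tail n) ℕ.+ length (tail Q) ℕ.≤ k → ZeroOne n → (P *ₚ Q) ≋ (V +ₚ n) → ⊥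
    continue k {V} V∈ n Q short n01 PQ≋ with next V∈ (coeff n 0) (ZeroOne-head n01)
    ... | inj₁ W∈ = unreachable k W∈ (tail n) (tail Q) short (ZeroOne-tail n01) (step-sound P' V n Q PQ≋)
    ... | inj₂ un = un (tail n) (tail Q) (ZeroOne-tail n01) (step-sound P' V n Q PQ≋)
    unreachable k {V} V∈ [] [] _ _ PQ≋ = nonzero V∈ λ n → trans (sym (+ₚ-[] V n)) (trans (sym (PQ≋ n)) (*ₚ-[] P n))
    unreachable (suc k) V∈ []      (q ∷ Q) (ℕ.s≤s short) n01 PQ≋ = continue k V∈ [] (q ∷ Q) short n01 PQ≋
    unreachable (suc k) V∈ (c ∷ n) []      (ℕ.s≤s short) n01 PQ≋ = continue k V∈ (c ∷ n) [] short n01 PQ≋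
    unreachable (suc k) V∈ (c ∷ n) (q ∷ Q) (ℕ.s≤s short) n01 PQ≋ = continue k V∈ (c ∷ n) (q ∷ Q)
      (ℕ.≤-trans (ℕ.+-monoʳ-≤ (length n) (ℕ.n≤1+n (length Q))) short) n01 PQ≋

  -- Probes and the search for a closed set of states

  directions : List Direction
  directions = (1ℤ , 0ℤ) ∷ (-1ℤ , 0ℤ) ∷ (0ℤ , 1ℤ) ∷ (0ℤ , -1ℤ) ∷ (1ℤ , 1ℤ) ∷ (-1ℤ , -1ℤ) ∷ (1ℤ , -1ℤ) ∷ (-1ℤ , 1ℤ) ∷ []

  directions-unit : All Unit directions
  directions-unit = (s≤s z≤n , z≤n) ∷ (s≤s z≤n , z≤n) ∷ (z≤n , s≤s z≤n) ∷ (z≤n , s≤s z≤n) ∷ (s≤s z≤n , s≤s z≤n) ∷ (s≤s z≤n , s≤s z≤n) ∷ (s≤s z≤n , s≤s z≤n) ∷ (s≤s z≤n , s≤s z≤n) ∷ []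

  -- An approximate root centre / S; escape is tested from direction number first on, with size + 2 tabulated powers.
  record Probe : Set where
    constructor probe
    field
      centre : 𝔾
      first size : ℕ

    ordered : List Direction
    ordered = drop first directions ++ take first directions

    powersTable : Table
    powersTable = powers centre R (suc (suc size))

  open Probe

  -- For D ≈ S P'(a), the result is close to S / P'(a).
  reciprocal : 𝔾 → 𝔾
  reciprocal (x +I y) = invert (∣ x ∣ ℕ.* ∣ x ∣ ℕ.+ ∣ y ∣ ℕ.* ∣ y ∣)
    where
    invert : ℕ → 𝔾
    -- There is no inverse here; the default C = 0 fails the contraction check in `rootᵇ`.
    invert zero      = 0ℤ +I 0ℤ
    invert n@(suc _) = (+ (S ℕ.* S) * x) /ℕ n +I (+ (S ℕ.* S) * (- y)) /ℕ n

  validᵇ : Poly → Probe → Bool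
  validᵇ P pr = test (powers (centre pr) 0 9) (derivative P) ∧ (2 ℕ.* last (powersTable pr) ℕ.≤ᵇ S)
    where
    test : Table → Poly → Bool
    test t P' = rootᵇ P (centre pr) (reciprocal (dot P' t)) t P'

  farᵇ : 𝔾 → ℕ → Direction × ℕ → Bool
  farᵇ z e (f , h) = along f z + + (2 ℕ.+ (e ℕ.+ h)) ℤ.≤ᵇ 0ℤ

  Bounds : Set
  Bounds = Table × List (Direction × ℕ)

  -- The offsets of the half-planes depend on the probe alone, so they are fixed here and shared by
  -- all states.
  bounds : Table → List Direction → Bounds
  bounds t fs = t , map (λ f → f , reach f t ℕ.+ overflow t) fs

  outsideᵇ : Poly → Bounds → Bool
  outsideᵇ V (t , fs) = (length V ℕ.≤ᵇ length t) ∧ test (dot V t) (err V t)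
    where
    test : 𝔾 → ℕ → Bool
    test z e = any (farᵇ z e) fs

  coveredᵇ : List Bounds → List Poly → Poly → Bool
  coveredᵇ bs Vs V = memberᵇ V Vs ∨ any (outsideᵇ V) bs

  -- Nothing is proved about the outcome: closedᵇ checks it independently.
  explore : ℕ → Poly → List Bounds → List Poly → List Poly → List Poly
  explore zero    P' bs Vs _        = Vs
  explore (suc k) P' bs Vs []       = Vs
  explore (suc k) P' bs Vs (V ∷ Ws) =
    if coveredᵇ bs Vs V then explore k P' bs Vs Ws
    else explore k P' bs (V ∷ Vs) (step P' V 0ℤ ∷ step P' V 1ℤ ∷ Ws)

  -- The process starts from the state 0, which `nonzeroᵇ` would reject; the first state considered
  -- is therefore the one after the constant term 1 of N has been read.
  closedᵇ : Poly → List Bounds → List Poly → Bool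
  closedᵇ P' bs Vs = coveredᵇ bs Vs (step P' [] 1ℤ)
    ∧ all (λ V → nonzeroᵇ V ∧ coveredᵇ bs Vs (step P' V 0ℤ) ∧ coveredᵇ bs Vs (step P' V 1ℤ)) Vs

  inverse : Poly → Probe → 𝔾
  inverse P pr = reciprocal (dot (derivative P) (powers (centre pr) 0 9))

  ∈-annotated : ∀ {A B : Set} (g : A → B) (test : A × B → Bool) xs → T (any test (map (λ x → x , g x) xs)) → ∃ λ x → x ∈ xs × T (test (x , g x))
  ∈-annotated g test (x ∷ xs) h with ∨-split {test (x , g x)} h
  ... | inj₁ ok = x , here refl , ok
  ... | inj₂ h' = let y , y∈ , ok = ∈-annotated g test xs h' in y , there y∈ , ok

  outside-sound : ∀ P pr V → T (validᵇ P pr) → T (outsideᵇ V (bounds (powersTable pr) (ordered pr))) → Unreachable P V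
  outside-sound P pr V valid outside = conclude (∈-annotated (λ f → reach f t ℕ.+ overflow t) (farᵇ (dot V t) (err V t)) (ordered pr) (proj₂ both))
    where
    t = powersTable pr
    both = ∧-split {length V ℕ.≤ᵇ length t} outside
    valid′ = ∧-split {rootᵇ P (centre pr) (inverse P pr) (powers (centre pr) 0 9) (derivative P)} valid
    approach = Root.approachable P (centre pr) (inverse P pr) (proj₁ valid′)
    conclude : (∃ λ f → f ∈ ordered pr × T (farᵇ (dot V t) (err V t) (f , reach f t ℕ.+ overflow t))) → Unreachable P V
    conclude (f , f∈ , far) = escapes P (centre pr) (size pr) f V approach
      (All.lookup (All.++⁺ (All.drop⁺ (first pr) directions-unit) (All.take⁺ (first pr) directions-unit)) f∈)
      (ℕ.≤ᵇ⇒≤ (2 ℕ.* last t) S (proj₂ valid′)) (ℕ.≤ᵇ⇒≤ (length V) (length t) (proj₁ both)) (ℤ.≤ᵇ⇒≤ far)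

  allBounds : List Probe → List Bounds
  allBounds = map (λ pr → bounds (powersTable pr) (ordered pr))

  ∈-allBounds : ∀ {b} prs → b ∈ allBounds prs → ∃ λ pr → pr ∈ prs × b ≡ bounds (powersTable pr) (ordered pr)
  ∈-allBounds (pr ∷ prs) (here eq)  = pr , here refl , eq
  ∈-allBounds (pr ∷ prs) (there b∈) = let pr' , pr∈ , eq = ∈-allBounds prs b∈ in pr' , there pr∈ , eq

  module _ (P' : Poly) (prs : List Probe) (Vs : List Poly) (valid : T (all (validᵇ (1ℤ ∷ P')) prs)) where

    covered : ∀ V → T (coveredᵇ (allBounds prs) Vs V) → V ∈ Vs ⊎ Unreachable (1ℤ ∷ P') V
    covered V h = [ (λ member → inj₁ (memberᵇ⇒∈ V Vs member)) , (λ outside → inj₂ (found (any-∈ (outsideᵇ V) (allBounds prs) outside))) ]′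
        (∨-split {memberᵇ V Vs} {any (outsideᵇ V) (allBounds prs)} h)
      where
      found : (∃ λ b → b ∈ allBounds prs × T (outsideᵇ V b)) → Unreachable (1ℤ ∷ P') V
      found (b , b∈ , out) = inside (∈-allBounds prs b∈)
        where
        inside : (∃ λ pr → pr ∈ prs × b ≡ bounds (powersTable pr) (ordered pr)) → Unreachable (1ℤ ∷ P') V
        inside (pr , pr∈ , eq) = outside-sound (1ℤ ∷ P') pr V (all-∈ (validᵇ (1ℤ ∷ P')) prs valid pr∈) (subst (λ b → T (outsideᵇ V b)) eq out)

    closed-sound : T (closedᵇ P' (allBounds prs) Vs) → ∀ n Q → ZeroOne n → ((1ℤ ∷ P') *ₚ Q) ≋ (1ℤ ∷ n) → ⊥
    closed-sound ok n Q n01 PQ≋N =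
      [ (λ V∈ → Closed.unreachable P' Vs nonzero next (length n ℕ.+ length (tail Q)) V∈ n (tail Q) ℕ.≤-refl n01 start)
      , (λ un → un n (tail Q) n01 start) ]′ (covered (step P' [] 1ℤ) (proj₁ ok′))
      where
      cov : Poly → Bool
      cov = coveredᵇ (allBounds prs) Vs
      ok′ = ∧-split {cov (step P' [] 1ℤ)} ok
      start : ((1ℤ ∷ P') *ₚ tail Q) ≋ (step P' [] 1ℤ +ₚ n)
      start = step-sound P' [] (1ℤ ∷ n) Q PQ≋N
      each : ∀ {V} → V ∈ Vs → T (nonzeroᵇ V) × T (cov (step P' V 0ℤ)) × T (cov (step P' V 1ℤ))
      each {V} V∈ = let nz , rest = ∧-split {nonzeroᵇ V} (all-∈ (λ V → nonzeroᵇ V ∧ cov (step P' V 0ℤ) ∧ cov (step P' V 1ℤ)) Vs (proj₂ ok′) V∈)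
                    in nz , ∧-split {cov (step P' V 0ℤ)} rest
      nonzero : ∀ {V} → V ∈ Vs → V ≋ [] → ⊥
      nonzero {V} V∈ = nonzeroᵇ-sound V (proj₁ (each V∈))
      next : ∀ {V} → V ∈ Vs → ∀ c → c ≡ 0ℤ ⊎ c ≡ 1ℤ → step P' V c ∈ Vs ⊎ Unreachable (1ℤ ∷ P') (step P' V c)
      next {V} V∈ _ (inj₁ refl) = covered (step P' V 0ℤ) (proj₁ (proj₂ (each V∈)))
      next {V} V∈ _ (inj₂ refl) = covered (step P' V 1ℤ) (proj₂ (proj₂ (each V∈)))

  refutedᵇ : Poly → List Probe → Bool
  refutedᵇ P' prs = all (validᵇ (1ℤ ∷ P')) prs ∧ search (allBounds prs)
    where
    search : List Bounds → Bool
    -- The fuel 200 is not trusted: if it ran out too early, the list would simply fail `closedᵇ`.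
    search bs = closedᵇ P' bs (explore 200 P' bs [] (step P' [] 1ℤ ∷ []))

  refuted-sound : ∀ P' prs → T (refutedᵇ P' prs) → ∀ {N} → Newman N → (1ℤ ∷ P') ∣ₚ N → ⊥
  refuted-sound P' prs ok {[]}    (_ , _ , ()) _
  refuted-sound P' prs ok {c ∷ n} (_ ∷ n01 , _ , refl) (Q , PQ≋N) =
    closed-sound P' prs (explore 200 P' (allBounds prs) [] (step P' [] 1ℤ ∷ [])) (proj₁ ok′) (proj₂ ok′) n Q n01 PQ≋N
    where ok′ = ∧-split {all (validᵇ (1ℤ ∷ P')) prs} ok

-- Certificates

open Analysis using (Approachable; NonnegReal; homogeneous; sign-change⇒approachable; approachable-∣ₚ; positive-root⇒¬Newman)
open Polynomials

-- Nine decimals, the precision of the centres listed below. The discs, of radius 10^3 in these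
-- units, have radius one millionth.
scale : ℕ
scale = 10 ℕ.^ 9

open Escape scale (10 ℕ.^ 3) using (_+I_; ∧-split)
open Search scale (10 ℕ.^ 3)
open import Data.Integer using (_+_; _*_; -_)
open import Data.Integer.Solver using (module +-*-Solver)

signᵇ : ℤ → Bool
signᵇ a = (a ≡ℤᵇ -1ℤ) ∨ (a ≡ℤᵇ 1ℤ)

signᵇ-sound : ∀ a → T (signᵇ a) → a ≡ -1ℤ ⊎ a ≡ 1ℤ
signᵇ-sound a ok = Sum.map (≡ℤᵇ⇒≡ a -1ℤ) (≡ℤᵇ⇒≡ a 1ℤ) (∨-split {a ≡ℤᵇ -1ℤ} ok)

littlewoodᵇ : Poly → Bool
littlewoodᵇ []      = false
littlewoodᵇ (a ∷ p) = all signᵇ (a ∷ p)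

littlewoodᵇ-sound : ∀ p → T (littlewoodᵇ p) → Littlewood p
littlewoodᵇ-sound (a ∷ p) ok = All.tabulate (λ {c} c∈ → signᵇ-sound c (all-∈ signᵇ (a ∷ p) ok c∈)) , lead≢0 a p ok
  where
  lead≢0 : ∀ a p → T (all signᵇ (a ∷ p)) → lead (a ∷ p) ≢ 0ℤ
  lead≢0 a []      ()  refl
  lead≢0 a (b ∷ p) ok  eq = lead≢0 b p (proj₂ (∧-split {signᵇ a} ok)) eq

-- Binary digits as signs, least significant first; the leading 1 only marks the end.
fromBits : ℕ → ℕ → Poly
fromBits zero    n = []
fromBits (suc k) n = if n ℕ.≤ᵇ 1 then [] else (if n ℕ.% 2 ℕ.≡ᵇ 1 then 1ℤ else -1ℤ) ∷ fromBits k (n ℕ./ 2)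

-- Borwein coefficients are 0, 1 or -1, so the special clauses spare the evaluation of certificates
-- all multiplications; the general clause keeps the function total.
subtract : ℤ → Poly → Poly → Poly
subtract c []              r       = r
subtract c (a ∷ p)         []      = map ((- c) *_) (a ∷ p)
subtract c (+ 0 ∷ p)       (b ∷ r) = b ∷ subtract c p r
subtract c (+ 1 ∷ p)       (b ∷ r) = b ℤ.- c ∷ subtract c p r
subtract c (-[1+ 0 ] ∷ p)  (b ∷ r) = b + c ∷ subtract c p r
subtract c (a ∷ p)         (b ∷ r) = b ℤ.- c * a ∷ subtract c p r

coeff-subtract : ∀ c p r n → coeff (subtract c p r) n ≡ coeff r n ℤ.- c * coeff p n
coeff-subtract c []      r n = solve 2 (λ r c → r := r :- c :* con 0ℤ) refl (coeff r n) c
  where open +-*-Solver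
coeff-subtract c (a ∷ p) [] n = trans (coeff-map (- c) (a ∷ p) n) (solve 2 (λ c a → (:- c) :* a := con 0ℤ :- c :* a) refl c (coeff (a ∷ p) n))
  where open +-*-Solver
coeff-subtract c (+ 0 ∷ p)           (b ∷ r) zero = solve 2 (λ b c → b := b :- c :* con 0ℤ) refl b c
  where open +-*-Solver
coeff-subtract c (+ 1 ∷ p)           (b ∷ r) zero = solve 2 (λ b c → b :- c := b :- c :* con 1ℤ) refl b c
  where open +-*-Solver
coeff-subtract c (+ suc (suc m) ∷ p) (b ∷ r) zero = refl
coeff-subtract c (-[1+ 0 ] ∷ p)      (b ∷ r) zero = solve 2 (λ b c → b :+ c := b :- c :* con -1ℤ) refl b c
  where open +-*-Solver
coeff-subtract c (-[1+ suc m ] ∷ p)  (b ∷ r) zero = refl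
coeff-subtract c (+ 0 ∷ p)           (b ∷ r) (suc n) = coeff-subtract c p r n
coeff-subtract c (+ 1 ∷ p)           (b ∷ r) (suc n) = coeff-subtract c p r n
coeff-subtract c (+ suc (suc m) ∷ p) (b ∷ r) (suc n) = coeff-subtract c p r n
coeff-subtract c (-[1+ 0 ] ∷ p)      (b ∷ r) (suc n) = coeff-subtract c p r n
coeff-subtract c (-[1+ suc m ] ∷ p)  (b ∷ r) (suc n) = coeff-subtract c p r n

zeroᵇ : Poly → Bool
zeroᵇ = all (_≡ℤᵇ 0ℤ)

zeroᵇ-sound : ∀ p → T (zeroᵇ p) → p ≋ []
zeroᵇ-sound []      ok n       = refl
zeroᵇ-sound (a ∷ p) ok zero    = ≡ℤᵇ⇒≡ a 0ℤ (proj₁ (∧-split {a ≡ℤᵇ 0ℤ} ok))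
zeroᵇ-sound (a ∷ p) ok (suc n) = zeroᵇ-sound p (proj₂ (∧-split {a ≡ℤᵇ 0ℤ} ok)) n

-- Division of r by 1 + X p, starting from the constant term and stopping after k steps.
dividesᵇ : ℕ → Poly → Poly → Bool
dividesᵇ zero    p r       = zeroᵇ r
dividesᵇ (suc k) p []      = true
dividesᵇ (suc k) p (c ∷ r) = dividesᵇ k p (subtract c p r)

divides-sound : ∀ k p r → T (dividesᵇ k p r) → (1ℤ ∷ p) ∣ₚ r
divides-sound zero    p r       ok = [] , λ n → trans (*ₚ-[] (1ℤ ∷ p) n) (sym (zeroᵇ-sound r ok n))
divides-sound (suc k) p []      ok = [] , *ₚ-[] (1ℤ ∷ p)
divides-sound (suc k) p (c ∷ r) ok = c ∷ Q , product
  where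
  open ≡-Reasoning
  open +-*-Solver
  ih = divides-sound k p (subtract c p r) ok
  Q = proj₁ ih
  product : ((1ℤ ∷ p) *ₚ (c ∷ Q)) ≋ (c ∷ r)
  product zero    = trans (coeff-*ₚ-0 (1ℤ ∷ p) (c ∷ Q)) (ℤ.*-identityˡ c)
  product (suc n) = begin
    coeff ((1ℤ ∷ p) *ₚ (c ∷ Q)) (suc n)              ≡⟨ coeff-*ₚ-tail (1ℤ ∷ p) (c ∷ Q) (suc n) ⟩
    c * coeff p n + coeff ((1ℤ ∷ p) *ₚ Q) n          ≡⟨ cong (λ u → c * coeff p n + u) (trans (proj₂ ih n) (coeff-subtract c p r n)) ⟩
    c * coeff p n + (coeff r n ℤ.- c * coeff p n)    ≡⟨ solve 2 (λ x y → x :+ (y :- x) := y) refl (c * coeff p n) (coeff r n) ⟩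
    coeff r n                                        ∎

multipleᵇ : Poly → Poly → Bool
-- The number of quotient coefficients, deg L - deg P + 1, where deg P is `length p`.
multipleᵇ p L = littlewoodᵇ L ∧ dividesᵇ (length L ℕ.∸ length p) p L

sign-changeᵇ : Poly → ℕ × ℕ → Bool
sign-changeᵇ p (u , s) = (u ℕ.≤ᵇ 2 ℕ.* suc s) ∧ (homogeneous (+ u) (suc s) (1ℤ ∷ p) ℤ.≤ᵇ 0ℤ)

-- The pair (u , s) stands for u / (s + 1).
samples : List (ℕ × ℕ)
samples = (21 , 15) ∷ (1 , 0) ∷ (2 , 0) ∷ (11 , 7) ∷ (23 , 15) ∷ []

positive-rootᵇ : Poly → Bool
positive-rootᵇ p = any (sign-changeᵇ p) samples

positive-root-sound : ∀ p → T (positive-rootᵇ p) → Approachable (1ℤ ∷ p) NonnegReal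
positive-root-sound p ok with any-∈ (sign-changeᵇ p) samples ok
... | (u , s) , _ , change = let u≤2s , H≤0 = ∧-split {u ℕ.≤ᵇ 2 ℕ.* suc s} change in
  sign-change⇒approachable p u s (ℕ.≤ᵇ⇒≤ u (2 ℕ.* suc s) u≤2s) (ℤ.≤ᵇ⇒≤ H≤0)

normalise : Poly → Poly
normalise p = if coeff p 0 ≡ℤᵇ 1ℤ then p else negate p

-- Roots become their reciprocals, so a root outside the unit disc moves inside. The sign is
-- adjusted to restore the constant term 1 on which division relies.
mirror : Poly → Poly
mirror P = normalise (reverse P)

lifts-mirror : ∀ P → lead P ≢ 0ℤ → coeff P 0 ≢ 0ℤ → Lifts (mirror P) → Lifts P
lifts-mirror P lead≢0 constant≢0 lift = lifts-reverse P lead≢0 constant≢0 (unnormalise (reverse P) lift)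
  where
  unnormalise : ∀ p → Lifts (normalise p) → Lifts p
  unnormalise p with coeff p 0 ≡ℤᵇ 1ℤ
  ... | true  = λ lift → lift
  ... | false = lifts-negate p

-- `inner` probes roots of P inside the unit disc, `outer` those of its mirror image; with several
-- probes a state is discarded as soon as one of them rules it out. `factor` serves a P that is
-- positive at all samples although some factor 1 + X f is not.
data Certificate : Set where
  signs       : ℕ → Certificate
  inner outer : List Probe → Certificate
  factor      : Poly → Certificate

-- The real part is shifted by scale, so that no negative literals occur.
at : ℕ → ℕ → ℕ → ℕ → Probe
at x y first size = probe (+ x ℤ.- + scale +I + y) first size

inner₁ outer₁ : ℕ → ℕ → ℕ → ℕ → Certificate
inner₁ x y first size = inner (at x y first size ∷ [])
outer₁ x y first size = outer (at x y first size ∷ [])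

-- The mirror image is computed, so its constant term 1 has to be recognised anew.
refutes-headᵇ : Poly → List Probe → Bool
refutes-headᵇ (+ 1 ∷ p) prs = refutedᵇ p prs
refutes-headᵇ _         prs = false

refutes-head-sound : ∀ P prs → T (refutes-headᵇ P prs) → Lifts P
refutes-head-sound (+ 1 ∷ p) prs ok (N , newman , P∣N) = ⊥-elim (refuted-sound p prs ok newman P∣N)

certifiedᵇ : Poly → Certificate → Bool
-- The 300 is fuel: a cap on the number of signs decoded from n.
certifiedᵇ p (signs n) = multipleᵇ p (fromBits 300 n)
certifiedᵇ p (inner prs)  = refutedᵇ p prs
certifiedᵇ p (outer prs)  = refutes-headᵇ (mirror (1ℤ ∷ p)) prs
certifiedᵇ p (factor f) = positive-rootᵇ f ∧ dividesᵇ (suc (length p) ℕ.∸ length f) f (1ℤ ∷ p)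

certified-sound : ∀ p c → lead (1ℤ ∷ p) ≢ 0ℤ → T (certifiedᵇ p c) → Lifts (1ℤ ∷ p)
certified-sound p (signs n) lead≢0 ok _ = L , littlewoodᵇ-sound L (proj₁ ok′) , divides-sound (length L ℕ.∸ length p) p L (proj₂ ok′)
  where
  L = fromBits 300 n
  ok′ = ∧-split {littlewoodᵇ L} ok
certified-sound p (inner prs) lead≢0 ok (N , newman , P∣N) = ⊥-elim (refuted-sound p prs ok newman P∣N)
certified-sound p (outer prs) lead≢0 ok = lifts-mirror (1ℤ ∷ p) lead≢0 (λ ()) (refutes-head-sound (mirror (1ℤ ∷ p)) prs ok)
certified-sound p (factor f) lead≢0 ok (N , newman , P∣N) = ⊥-elim (positive-root⇒¬Newman (1ℤ ∷ p) approach newman P∣N)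
  where
  ok′ = ∧-split {positive-rootᵇ f} ok
  approach : Approachable (1ℤ ∷ p) NonnegReal
  approach = approachable-∣ₚ (1ℤ ∷ f) (1ℤ ∷ p) (divides-sound (suc (length p) ℕ.∸ length f) f (1ℤ ∷ p) (proj₂ ok′)) (positive-root-sound f (proj₁ ok′))

-- Base-3 code, used only to pick one representative of each pair {P, mirror P}.
code : Poly → ℕ
code []             = 0
code (+ n ∷ p)      = suc n ℕ.+ 3 ℕ.* code p
code (-[1+ _ ] ∷ p) = 3 ℕ.* code p

canonicalᵇ : Poly → Bool
canonicalᵇ P = code P ℕ.≤ᵇ code (mirror P)

-- The cases without a certificate: words ending in 0 belong to a lower degree, one member of each
-- mirror pair suffices, and a sign change at a sample decides at once.
trivialᵇ : Poly → Bool
trivialᵇ p = (lead (1ℤ ∷ p) ≡ℤᵇ 0ℤ) ∨ not (canonicalᵇ (1ℤ ∷ p)) ∨ positive-rootᵇ p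

-- The certificates are listed in the order of the non-trivial polynomials.
run : List Poly → List Certificate → Bool
run []       cs = true
run (p ∷ ps) cs = if trivialᵇ p then run ps cs else consume cs
  where
  consume : List Certificate → Bool
  consume []       = false
  consume (c ∷ cs) = certifiedᵇ p c ∧ run ps cs

run-sound : ∀ ps cs → T (run ps cs) → ∀ {p} → p ∈ ps → lead (1ℤ ∷ p) ≢ 0ℤ → T (canonicalᵇ (1ℤ ∷ p)) → Lifts (1ℤ ∷ p)
run-sound (p ∷ ps) cs ok p∈ lead≢0 canonical with trivialᵇ p in eq
run-sound (p ∷ ps) cs       ok (there p∈)  lead≢0 canonical | true = run-sound ps cs ok p∈ lead≢0 canonical
run-sound (p ∷ ps) cs       ok (here refl) lead≢0 canonical | true with ∨-split {lead (1ℤ ∷ p) ≡ℤᵇ 0ℤ} (subst T (sym eq) tt)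
... | inj₁ lead≡0 = ⊥-elim (lead≢0 (≡ℤᵇ⇒≡ (lead (1ℤ ∷ p)) 0ℤ lead≡0))
... | inj₂ h with canonicalᵇ (1ℤ ∷ p)
...   | true = λ (N , newman , P∣N) → ⊥-elim (positive-root⇒¬Newman (1ℤ ∷ p) (positive-root-sound p h) newman P∣N)
run-sound (p ∷ ps) (c ∷ cs) ok (here refl) lead≢0 canonical | false = certified-sound p c lead≢0 (proj₁ (∧-split {certifiedᵇ p c} ok))
run-sound (p ∷ ps) (c ∷ cs) ok (there p∈)  lead≢0 canonical | false = run-sound ps cs (proj₂ (∧-split {certifiedᵇ p c} ok)) p∈ lead≢0 canonical

-- Enumeration of the coefficient words

words : ℕ → List Poly
words zero    = [] ∷ []
words (suc n) = map (-1ℤ ∷_) (words n) ++ map (0ℤ ∷_) (words n) ++ map (1ℤ ∷_) (words n)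

Ternary : Poly → Set
Ternary = All (λ a → a ≡ -1ℤ ⊎ a ≡ 0ℤ ⊎ a ≡ 1ℤ)

∈-words : ∀ {p} → Ternary p → p ∈ words (length p)
∈-words []                                 = here refl
∈-words {_ ∷ p} (inj₁ refl ∷ hs)          = ∈-++⁺ˡ (∈-map⁺ (-1ℤ ∷_) (∈-words hs))
∈-words {_ ∷ p} (inj₂ (inj₁ refl) ∷ hs)   = ∈-++⁺ʳ (map (-1ℤ ∷_) (words (length p))) (∈-++⁺ˡ (∈-map⁺ (0ℤ ∷_) (∈-words hs)))
∈-words {_ ∷ p} (inj₂ (inj₂ refl) ∷ hs)   = ∈-++⁺ʳ (map (-1ℤ ∷_) (words (length p))) (∈-++⁺ʳ (map (0ℤ ∷_) (words (length p))) (∈-map⁺ (1ℤ ∷_) (∈-words hs)))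

-- Certificates, one list for each degree

certificates₀ : List Certificate
certificates₀ =
  signs 0x3 ∷ []

certificates₁ : List Certificate
certificates₁ =
  signs 0x4 ∷ []

certificates₂ : List Certificate
certificates₂ =
  signs 0xd ∷ signs 0x1a ∷ signs 0xf ∷ []

certificates₃ : List Certificate
certificates₃ =
  signs 0xa9 ∷ signs 0x40 ∷ signs 0x14 ∷ signs 0xfc ∷ signs 0x10 ∷ []

certificates₄ : List Certificate
certificates₄ =
  signs 0x35 ∷ signs 0x66 ∷ signs 0xb2d5 ∷ signs 0x111 ∷ signs 0x6d95 ∷ signs 0x6a ∷ signs 0x33 ∷ signs 0x4cfc ∷ signs 0x3b ∷
  outer₁ 1566120943 458821465 1 11 ∷ signs 0xff0c ∷ signs 0x1009 ∷ signs 0x37 ∷ signs 0x40c7 ∷ signs 0x3f ∷ []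

certificates₅ : List Certificate
certificates₅ =
  signs 0xe79acd55 ∷ signs 0x191b ∷ signs 0xd7b6c9db ∷ signs 0x9f2c803f ∷ signs 0x2caaa5 ∷ signs 0x54a ∷ signs 0x1aeb852f ∷
  inner₁ 855408688 695997030 2 11 ∷ signs 0x132f ∷ signs 0x6ba7d725 ∷ signs 0x84f9b6ff ∷ signs 0xdd8a658f ∷ signs 0x1000 ∷ signs 0xaa8aa8ef ∷
  signs 0x4c ∷ signs 0xce6f303b ∷ signs 0x11c78064 ∷ signs 0x54 ∷ signs 0xf3a3370b ∷ signs 0xcba95bbf ∷ signs 0x4c9f01f8 ∷ signs 0x921ab09f ∷
  signs 0x163 ∷ signs 0x3ff070 ∷ signs 0x133 ∷ signs 0xdff1f21b ∷ signs 0x4009f9e3 ∷ signs 0x67 ∷ inner₁ 640401135 598913223 2 9 ∷ signs 0x77 ∷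
  outer₁ 1549136259 411180911 1 7 ∷ signs 0x1dc1a1f8 ∷ signs 0xed2531bf ∷ signs 0x50 ∷ signs 0xfe1cfdef ∷ signs 0x40 ∷ []

certificates₆ : List Certificate
certificates₆ =
  signs 0x1fff ∷ signs 0xd5 ∷ signs 0xb2ce734a731c69d5 ∷ signs 0x1ab54cc ∷ signs 0xcd ∷ signs 0x59fbcd5e398f17ad ∷ signs 0xdd ∷ signs 0x291193 ∷
  signs 0x8410 ∷ signs 0xd5ab55a955a2b169 ∷ signs 0x14dd57a8c95ad559 ∷ signs 0x355 ∷ signs 0xd2d1 ∷ signs 0x5655 ∷ signs 0xd5ab017fa152e000 ∷
  signs 0x1041 ∷ signs 0x55292b2b5a56cb51 ∷ signs 0xcd6d ∷ signs 0x76f273f393919bff ∷ signs 0x1ad42d6d ∷ signs 0x3ff ∷ signs 0xda9b ∷ signs 0xe6ef ∷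
  signs 0xd57f02050a2b7e10 ∷ signs 0x4c99d3b9b5195635 ∷ signs 0x1ad61853486ab2d5 ∷ signs 0xd5ce ∷ signs 0x2d24e5 ∷ signs 0x165 ∷ signs 0x58d2c2848a5 ∷
  signs 0x6655 ∷ signs 0x291a55 ∷ signs 0x155 ∷ outer₁ 1646416462 287906874 1 7 ∷ signs 0xcc45 ∷ outer₁ 1576044886 418176955 1 9 ∷
  signs 0x663379131fb3fc9f ∷ outer₁ 1467453855 522722992 7 7 ∷ signs 0xff64 ∷ signs 0xe3 ∷ signs 0xf1f3 ∷ signs 0xd3 ∷
  outer₁ 882651164 689191507 2 9 ∷ signs 0x387884 ∷ signs 0x1df0b11772f04 ∷ outer₁ 1784337669 245609314 1 23 ∷ signs 0x4027ff21e49f87db ∷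
  inner₁ 338562402 209248946 4 9 ∷ signs 0x3e4e3c ∷ signs 0xcb ∷ signs 0x1dbe8482f6fa120b ∷ signs 0xeb ∷ signs 0x5a7e1e076693f384 ∷ signs 0xfbc4 ∷
  signs 0xdb ∷ signs 0x158af806d62b4ddc ∷ signs 0xe1ec087fe07fc07f ∷ signs 0x4c930db3f936c3ff ∷ signs 0x1693 ∷ signs 0x11c1e81f ∷ signs 0x1fff ∷
  inner₁ 450679870 385860926 4 7 ∷ inner₁ 423955116 418176956 4 11 ∷ outer₁ 1728229217 117409142 1 7 ∷ signs 0x4e1fe060100 ∷ outer₁ 396271528 0 0 7 ∷
  signs 0x19b26c ∷ signs 0xaaa90fe855eac07f ∷ signs 0x1a157a ∷ inner₁ 380374140 342837354 4 11 ∷ signs 0x43ee2fa786c ∷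
  outer₁ 1661808803 256023424 1 7 ∷ inner (at 965500190 879597552 0 21 ∷ at 360454618 0 0 21 ∷ []) ∷ outer₁ 463291137 0 0 7 ∷ signs 0x163c ∷
  signs 0x100781ef ∷ signs 0x1f50 ∷ signs 0x5007b008bd846c73 ∷ signs 0xae95c082fa8ad5ff ∷ signs 0x13001f039bf40118 ∷ signs 0xe7 ∷
  signs 0x66d8dd3a11562d57 ∷ signs 0xc607 ∷ signs 0x735167f49325bd07 ∷ signs 0xd7 ∷ inner₁ 532546146 522722993 4 11 ∷ signs 0xf7 ∷
  outer₁ 1661437600 209248945 1 7 ∷ signs 0x339bb8 ∷ signs 0x1cd032f ∷ outer₁ 1619625862 342837353 1 7 ∷ signs 0x481e703c1f9f8f80 ∷
  signs 0x9864d9e0d9b6c37f ∷ outer₁ 1566120942 458821464 1 11 ∷ signs 0x3fe1b8 ∷ signs 0x1ab54cc ∷ signs 0xcf ∷ signs 0x1ae215c95477a8da ∷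
  signs 0xef ∷ outer₁ 1549320131 385860925 1 7 ∷ signs 0xef0f ∷ signs 0x4cf32664ccc1b6ff ∷ signs 0xdf ∷ signs 0x101e7fcb860b2c1f ∷ signs 0xff ∷ []

certificates₇ : List Certificate
certificates₇ =
  signs 0x999bd2ec48001284481b2767e8dcbdad ∷ signs 0x3366ba96e8bae0e8b89b20dd ∷ signs 0x54fca ∷ signs 0x2492ada9240b5a160b269595 ∷
  signs 0x8f4bfa9e80407c7e56b7f4237f0fe81f ∷ signs 0x270b6c64a343d2c08055bdaac92 ∷ signs 0x54acbdd8 ∷ outer₁ 1743019078 245772326 1 13 ∷
  signs 0x1b751e2e1d80bc9bc6c2f75717b27615 ∷ inner₁ 1319392719 632105918 7 9 ∷ signs 0x1ad ∷ inner₁ 1340770555 582981803 7 7 ∷ signs 0x672d ∷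
  inner₁ 1448361057 591279581 7 13 ∷ signs 0x19d ∷ inner₁ 1413006273 535944063 7 7 ∷ signs 0x1bd ∷ outer₁ 1282290868 621343285 7 7 ∷
  signs 0xda864570cf0b60a660f0ce5ce1ac2ca9 ∷ signs 0xdb52d7b6812048132666676fd01af03f ∷ outer₁ 1339793192 610668064 7 7 ∷
  signs 0xfe07003f033e0fe4bc11b6332cb4b324 ∷ signs 0x267003333f000ff812bd7af4889 ∷ signs 0x355aa564a25353537e92525b ∷
  signs 0x7f1e419a1b2378ecc06010a7de42fda4 ∷ signs 0xd3b5234f060d326c6921213c85000df6 ∷ signs 0x1b6d ∷ signs 0x1883d56c946d4a9 ∷
  outer₁ 1393247906 566932322 7 7 ∷ signs 0x52296aefa77 ∷ signs 0x93aa13649348273d80b5902fd2184f38 ∷ signs 0xc9a25d777 ∷ signs 0x6caeef65777 ∷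
  signs 0x88c0df8fd889db9f12b43cf0a0fff00f ∷ signs 0xd160060fcfc00c0364e73f211bfc23bf ∷ signs 0x36adac89c9e49f03601e0c00 ∷
  signs 0x9c238f331a166666644081818900003f ∷ signs 0x450a ∷ signs 0x1fde4d74194db346 ∷ outer₁ 1755488115 205592490 1 11 ∷
  signs 0x16ae28ae981da47887a06fa07803f41f ∷ signs 0x7360fe07 ∷ signs 0xdab2be7f0e173512a30e8590bab5b0e7 ∷ inner₁ 1210631192 757301846 0 29 ∷
  outer₁ 1779337296 210275193 1 17 ∷ signs 0x11ccf40 ∷ signs 0x6ad4d66aaa9 ∷ signs 0x657912090ad ∷ signs 0x4c2677b3e42790fc00ff186c660e77bf ∷
  signs 0x19b1e738b0ae10d31e21d6296987aaad ∷ signs 0x9c6c6600033338dd881bd09f01e2f03f ∷ signs 0x48ae2a26656 ∷ signs 0x66e1bcff0dd ∷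
  signs 0xe78e65743e2fc477c88bb9715c83cc1f ∷ signs 0xa8fad9789 ∷ signs 0x1ff01fe ∷ outer₁ 1446425525 547223887 7 7 ∷
  signs 0xe37399d989a86a25631733462227188a ∷ inner₁ 808117258 712176112 2 15 ∷ signs 0x1f6f ∷ signs 0x39bbdf9897b652cee4bff300dff ∷
  signs 0x333a5bb0d52626edbe5ceee7 ∷ signs 0x1cdb32644891b60004b490bf400f417f ∷ signs 0x6d9607ecbfcc8bd5ff11b4e1f271a2e7 ∷
  outer₁ 1751868224 156263929 1 7 ∷ signs 0x1dbf ∷ signs 0x163228c6c790ce7 ∷ signs 0x9f2fbfcde92fb2414d973d860db3cd3f ∷
  inner₁ 693807122 647804045 2 11 ∷ signs 0x270a011e504d29284326286d445 ∷ signs 0xad102248f2d89da59fbefcd569d21d92 ∷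
  signs 0x5c9d09ce39984ccda05e30de4feecbe5 ∷ signs 0x1aad07d56011fe01f55c2f ∷ signs 0x3cec8985093d3555658de3722a5 ∷ outer₁ 1736582334 86360923 1 7 ∷
  signs 0x19589f ∷ signs 0x66d3dc86d1ee1d26f83d3fb8393d90f0 ∷ signs 0x318afef000df9c47f13b81ff ∷ signs 0x901ad5e6a5319ab56bb73dc6221884e7 ∷
  signs 0x1dac73 ∷ outer₁ 1677313568 246793945 1 7 ∷ inner (at 1232785617 792551993 0 19 ∷ at 481087206 666609845 0 19 ∷ []) ∷
  outer₁ 1634063418 399739240 1 13 ∷ signs 0x5acc7dacf49e1e79ff18f83c7e0fe1ff ∷ signs 0x15302ed3c9a45920990d88 ∷ inner₁ 1141964291 677696074 2 9 ∷
  outer₁ 1701878690 256847745 1 9 ∷ inner₁ 1128122793 714658385 2 13 ∷ outer₁ 1677136032 403658166 1 23 ∷ signs 0x118f ∷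
  outer₁ 1673230994 198729464 1 7 ∷ inner₁ 1192470817 693993567 7 11 ∷ outer₁ 1637231361 343260966 1 9 ∷ signs 0x19936f2e7211c9b4586829b580b6419f ∷
  signs 0x6dc3e8d4361c01f2fb1c7850b8002a1f ∷ signs 0x200c8dd8b5a8ed5a9790e0c3f0f ∷ outer₁ 1614112959 282241493 1 7 ∷
  inner₁ 1254668764 691007839 7 17 ∷ outer₁ 1560586012 395698997 1 7 ∷ signs 0xdb2be9f380ba2aaea60f074579704f1f ∷ outer₁ 1473515868 498072607 7 7 ∷
  signs 0x1a95 ∷ signs 0x860e4ce09987a077889f1f1eaa7d53dc ∷ signs 0xfdd0b70bfff62fcd803024fb68cf984c ∷ outer₁ 1206386955 688929138 7 11 ∷
  outer₁ 1062910336 712457092 2 11 ∷ inner₁ 368732247 326332412 4 11 ∷ inner (at 348862157 455969849 0 17 ∷ at 196047047 0 0 17 ∷ []) ∷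
  signs 0x419b9320793 ∷ signs 0x14c ∷ outer₁ 1120391355 673494237 2 7 ∷ signs 0xe703c0b3df06c41c7be4a323893773e4 ∷ signs 0x7e7dde414fb ∷
  inner₁ 460204097 0 0 7 ∷ inner₁ 452810404 0 0 7 ∷ signs 0xb3873c0cf861cf19cb728aa05104451b ∷ signs 0x42080410 ∷
  signs 0x2c9c43fb143dfd178cb2d2076a3 ∷ signs 0x12ea6a6bbb8ef823 ∷ inner₁ 432740134 0 0 7 ∷ signs 0xf8eec6ac8c00cfeb19d0df42b7e41b7b ∷
  signs 0xb31828dfa5066161da7ce510cbf1c13c ∷ signs 0x54888c5c0e8fc7000303f90fc30f9cf3 ∷ signs 0x15231b8bc9d781fc03ce7e9f13f20883 ∷
  signs 0x5510aba8aef ∷ inner₁ 393872776 0 0 7 ∷ outer₁ 1163073934 700105778 2 13 ∷ inner₁ 472649735 0 0 7 ∷ signs 0x134 ∷ inner₁ 489174395 0 0 7 ∷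
  inner₁ 484078617 0 0 7 ∷ signs 0x154 ∷ signs 0xfe8a98e35c09773fee64179ae1b48bd4 ∷ inner₁ 453775815 0 0 7 ∷ inner₁ 444110950 0 0 7 ∷
  inner₁ 432100082 0 0 7 ∷ signs 0x5934 ∷ signs 0x8e1c83833ef77fce517bb8ced793cabb ∷ signs 0xab7ecb9bc01b93f1a6536cf830cd8f74 ∷
  inner₁ 473886647 0 0 7 ∷ signs 0x164 ∷ signs 0x98ce014c7a8fb965881a7b18b7aa9da3 ∷ signs 0x124 ∷ signs 0x2a2ce7c1271e541558580ac4 ∷
  signs 0x7e007f7d5fb ∷ signs 0x144 ∷ inner₁ 447641857 0 0 7 ∷ signs 0x3ea51e0059ff80198ff4601f ∷ signs 0xaa88e20ff ∷ signs 0x594ca ∷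
  outer₁ 1098070170 746743272 0 15 ∷ outer₁ 932535620 737960614 2 15 ∷ signs 0xe1ed0aac0a5bdb96c7eda758b18a16df ∷ outer₁ 424848467 0 0 7 ∷
  outer₁ 1794426160 179708510 1 13 ∷ signs 0x4387ff60 ∷ inner₁ 525849943 577499285 0 19 ∷ signs 0xacf6009d44db0d5a0fdb61700da156bf ∷
  inner₁ 479794648 443220571 4 7 ∷ inner₁ 465652516 421926252 4 7 ∷ inner₁ 459518254 398488931 4 7 ∷ signs 0x6af57 ∷ inner₁ 462101813 464644602 4 11 ∷
  inner₁ 514011324 515565448 4 11 ∷ outer₁ 1100565234 701411674 2 9 ∷ signs 0x3333631117b30b589cc42c29 ∷ signs 0x7cff ∷
  signs 0xb34832935a1aa56da732da915f7da363 ∷ signs 0x11c0ff3f870e7bcfd0d4029e55755710 ∷ signs 0xfc3c7ecc01831e718fdfb82f91bd45f0 ∷ signs 0x561c ∷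
  signs 0x3ea50faa07c0380c5c022063 ∷ signs 0x4e07303f807c0f97f8fe7e0647f8e01f ∷ signs 0x2485a5a27563f04ea5ccddd2ba0 ∷ signs 0x164c ∷
  signs 0xad2d0f7858cb1e658307e1819939b990 ∷ signs 0x1b6d ∷ inner (at 481087206 666609845 0 17 ∷ at 317672197 0 0 17 ∷ []) ∷
  signs 0x7ec924fffe1c3fc3493edbd1905e0f10 ∷ signs 0x5a1f ∷ signs 0x39ecbb983e13fabb39c1b9a0 ∷ signs 0x4b5f ∷ outer₁ 1665344646 380825212 1 15 ∷
  signs 0x1921093e5bf03de901ec06f3cc7b981f ∷ signs 0x524c ∷ signs 0x347e8c0e74fe4b7c646db24c ∷ outer₁ 1770142578 267241196 1 23 ∷
  outer₁ 337540935 318172560 4 23 ∷ inner₁ 405478453 0 0 7 ∷ inner₁ 392035814 0 0 9 ∷ outer₁ 442765902 435566292 4 11 ∷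
  signs 0x2cac80ccfe39f9a07fb15964 ∷ signs 0x156d615ddb87ea3 ∷ outer₁ 1683128643 177424135 1 7 ∷ signs 0xe7f0e8d0eb522000d5e1049f233ac6d0 ∷
  signs 0x1b569fb6ff60c93c33c6cfc000f3ecc1 ∷ signs 0xb19dbc04886448fccfca0fe60bc2b4db ∷ signs 0x4c3215e3 ∷ signs 0xfdcced6e626a3130bdc9ccaf6a7328ef ∷
  signs 0x1b7979feffb0560a39df28df6b2a6ae3 ∷ signs 0x803f003c333e7e0d771d488e2ebb52e4 ∷ outer₁ 1629864036 270512265 1 7 ∷ signs 0x16397e3e65b1e00 ∷
  outer₁ 412209327 0 0 7 ∷ outer₁ 1586437851 394964510 1 7 ∷ signs 0xca2a2ba89 ∷ signs 0x56fda ∷ outer₁ 1500748311 535336321 7 9 ∷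
  signs 0x149f2850a157510 ∷ signs 0xccba66eba54dd517fde007e9a6aa20bf ∷ signs 0x1c7 ∷ outer₁ 1765483724 81361022 1 9 ∷ signs 0x54c26cbdb87 ∷
  signs 0x3ffaa00ea8fc00385ff801f8 ∷ signs 0x1a7 ∷ inner₁ 678017182 622795392 2 9 ∷ signs 0x1e7 ∷ inner₁ 539187994 539199998 2 13 ∷
  outer₁ 444227005 0 0 7 ∷ signs 0x65c8 ∷ inner₁ 579304082 572958292 2 13 ∷ signs 0x4287 ∷ inner₁ 639417065 559822665 2 7 ∷
  inner₁ 626904204 581491760 2 9 ∷ signs 0x197 ∷ inner₁ 557978779 484823884 2 7 ∷ signs 0x1d7 ∷ inner₁ 596045121 507814096 2 7 ∷
  inner₁ 576255007 511481802 4 7 ∷ inner₁ 551290551 510166388 4 7 ∷ signs 0x148 ∷ inner₁ 603932820 530480541 2 7 ∷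
  signs 0x4e007df87b9f90c96fe79387399dfb00 ∷ signs 0xcaa8b8057cd5d8ffe056e7097205f9f0 ∷ signs 0x168ad877f2e9891025d4741fb45717c0 ∷
  signs 0x4e1fe0623ff ∷ signs 0x1327dfb7ff9b1e07e93cdb987633e67f ∷ outer₁ 1704985850 339782326 1 17 ∷
  inner (at 712427742 744401889 0 15 ∷ at 221289730 0 0 15 ∷ []) ∷ signs 0xf0f979bebeeaff4566f09c8d25eb352f ∷ outer₁ 1686418319 143465415 1 7 ∷
  outer₁ 1729004561 324971258 1 19 ∷ outer₁ 407104811 0 0 7 ∷ outer₁ 1667753300 295862270 1 7 ∷ signs 0x1cf33f80e0fc34f1 ∷
  signs 0x2c5450979cfffe460fe7c13e0ff ∷ outer₁ 1652235058 423691738 1 21 ∷ signs 0xfbc0899c2e4123c4fa0d05d0b31be640 ∷ signs 0x7b406fed ∷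
  outer₁ 1640602791 244375895 1 7 ∷ inner₁ 477049064 503548247 4 15 ∷ outer₁ 467253699 0 0 7 ∷ outer₁ 1610261732 367227586 1 9 ∷ signs 0x4c7a9ecfa77 ∷
  signs 0x1da56b5f437950b6d86d5e9c1235e69f ∷ inner₁ 576721036 580313647 2 15 ∷ signs 0x526403cca64e57ce30a8fd6864b6c077 ∷ signs 0x18f ∷
  outer₁ 1716391869 292014415 1 13 ∷ signs 0x1cf ∷ outer₁ 1661808803 256023425 1 7 ∷ inner (at 979584924 802604015 0 11 ∷ at 264886615 0 0 11 ∷ []) ∷
  inner₁ 960031606 758442366 2 19 ∷ signs 0x150 ∷ inner (at 886272745 829620581 0 19 ∷ at 309987505 0 0 19 ∷ []) ∷ signs 0x110 ∷
  outer₁ 1639506906 205357085 1 7 ∷ signs 0x163286dc488195e1b68070 ∷ inner (at 1041849525 780312478 0 19 ∷ at 234337202 456366784 0 19 ∷ []) ∷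
  signs 0x678f ∷ signs 0xb1c7f7e8c6c4f364b3ef5a43724eea2d ∷ signs 0x4cff ∷ outer₁ 1580159439 436305119 7 9 ∷ signs 0x153be51ff428da955ed576 ∷
  signs 0xfea2eeceeedd9d9d0b336b6326c6cd96 ∷ signs 0x19f ∷ outer₁ 1626200821 415308597 1 13 ∷ signs 0x1df ∷ outer₁ 1554613800 371904987 1 7 ∷
  signs 0x59e639c0f9f ∷ signs 0x3ef9c1e8e0c30aa8f3c17820 ∷ signs 0x140 ∷ signs 0xdb6d096594bacbdff3fe3718e4666f33 ∷ signs 0x1ff ∷ []

certificates₈ : List Certificate
certificates₈ =
  signs 0x339 ∷ signs 0x6822fa40 ∷ signs 0xb26936f6beab5 ∷ signs 0xd6b5 ∷ signs 0x2aa5d6d45642a8aeaacd35 ∷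
  signs 0x34f9dd2ec9110751b3638cf91fecc0359af79c826e41758ae0795ca ∷ signs 0x1b78e12 ∷ inner₁ 1521384377 538458178 7 13 ∷ signs 0x5a4b7d80bfd ∷
  inner₁ 1554449326 477953201 7 11 ∷ inner₁ 1531360929 450774277 7 7 ∷ inner₁ 1547456566 423529032 1 7 ∷
  signs 0x24f424fa4bea57d803dd01500b00df94af856f02af30ea3bab4788a ∷ signs 0x355 ∷ signs 0xc5c2fa1d47d4a ∷ signs 0x335 ∷
  inner (at 1710348984 500007488 0 27 ∷ at 825554359 783198079 0 27 ∷ []) ∷ signs 0x2ba6d ∷ signs 0x6caea6f6555 ∷
  signs 0xaad8f4a15bfaf42928de7fabd54154152a95feaaff0bf901f40baa8015b4136d ∷
  signs 0xe6fedd91be1f175549707c2e97e6d2d06cab75ab6aa525129254af55afdbd4ad ∷ signs 0x1fff ∷ outer₁ 1757895358 215780976 1 11 ∷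
  signs 0x668c9dc9cf9f2f0b0707a5c58ee6e9ab4854964bf42e47a95eb54b15ebd5a2da ∷ signs 0x65a61431ead ∷
  signs 0x54a5492c525fea06afe36b7f52d212aa93b008049fdfcbfa26d15 ∷ outer₁ 1739461002 151066559 1 7 ∷ signs 0x19cd70629da1654edbc191785c9e9c15 ∷
  signs 0x2ab84 ∷ outer₁ 1660295586 290502829 1 7 ∷ outer₁ 1577383142 435771551 1 9 ∷ signs 0x34d ∷ signs 0xad0e739f34bad ∷
  signs 0x6940875529f58056a91c137cbdff7f94cee35bcaaff15a4f4bdad ∷ signs 0x32d ∷
  signs 0x1960c3028142c1eaf018005735bcc30d3e0e4e3d3c5cf771b0f0a145ab9554ea ∷ signs 0x292 ∷ inner₁ 1359834365 581153080 7 7 ∷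
  inner₁ 1368177638 612146799 7 9 ∷ inner₁ 1384498693 560833363 7 7 ∷ inner₁ 1404694302 583260556 7 7 ∷
  signs 0xd502753e59b5b9d78f3a196dded001af51b19a96011fd948db8ef6a60a6c7d2d ∷ inner₁ 1422308371 548957395 7 7 ∷ inner₁ 1456851988 559319525 7 9 ∷
  signs 0x1b6395f5c6d ∷ inner₁ 1388541457 536414088 7 7 ∷ signs 0x35d ∷ inner₁ 1399721349 514353542 1 7 ∷ inner₁ 1420007427 521249275 7 7 ∷
  inner₁ 1448484255 524434026 7 7 ∷ signs 0x33d ∷ inner₁ 1443598865 494070545 1 7 ∷ signs 0x37d ∷ outer₁ 1342946610 570187053 7 7 ∷
  outer₁ 1399509423 609617364 7 11 ∷ signs 0x37637034a0ac3e87689c1c ∷ outer₁ 1371990716 535310381 1 7 ∷ outer₁ 1330844256 615333556 7 7 ∷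
  signs 0x288cebb17fa06b3221d64dbe09302746e9a13449212da9f27b45d93 ∷ signs 0x354e1c ∷ outer₁ 1377782097 577856649 7 7 ∷
  signs 0xff7c141dd07e307ed1841bf0671577ff108200f0638436d6bead72649661e66c ∷ signs 0x733 ∷
  signs 0x254470711c7359ca3bbd0544771e60078600019803927b3c9be000c ∷ outer₁ 1457462192 608641477 7 31 ∷
  signs 0xac4e8f8f8570e8a95a4e2d6ad4a554d556b5bddb6eddab6f7baebaefbdbd7b73 ∷ signs 0x1ac3c8751740e3d4ae5e3f43f57d0c0c ∷
  outer₁ 1402457664 527629846 7 7 ∷ signs 0x3faca021992019c9e311b3 ∷ signs 0x3b15a4 ∷ signs 0x204873f00079fc77e90e5b ∷
  outer₁ 1376223351 641011000 7 15 ∷ signs 0x696652cc ∷ signs 0x9cb9d7cc8380039a38e08ffcfe0fc19c594716082fbf40769249becd2d86d9a4 ∷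
  signs 0xc70c1c71e3c32f0f347c78e388e2fce6733f9db6610187ccf6180180e08269db ∷ signs 0x1fc2c39db30e6cc ∷ signs 0x5a36525b ∷ signs 0x12756554d0 ∷
  signs 0x7303b75ab5486a6b56 ∷ signs 0x6d1f58f3 ∷ signs 0x2e576d ∷ outer₁ 1792195842 228554497 1 21 ∷
  signs 0x79c936e1b3be16ac2064bc728b4788bec209a3134c6668712407e47d8e96c593 ∷ outer₁ 1743692644 162180214 1 7 ∷
  signs 0x6bdffdfe3ccffcf30cfc3f33ccf6f34ccccc6937b3dbdb49213e06dbdb49b084 ∷ signs 0x1adc69a5e8f06a5b ∷ outer₁ 1527252873 564370981 0 25 ∷
  signs 0x675ae3cf6e13f6d34e8679a3c0071f62e37c0226510240ec3955433802e72b84 ∷ signs 0x3bd57b ∷ outer₁ 1555902772 444013014 1 9 ∷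
  outer₁ 1431437095 507146356 1 7 ∷ outer₁ 1295527703 613357546 7 7 ∷ signs 0xda8394aa74ebe3b8 ∷
  signs 0xc9f5019fd005eb8407f2333d3d07bf503f1d7f4271d5c0baee180a3d002cf707 ∷
  signs 0xd42291af42ab75a8ebd50d5ebf752e804029ef7109ec42ea0153bc462883f207 ∷ outer₁ 1346212377 593549817 7 7 ∷ signs 0x2e9b3 ∷
  signs 0x376b5e92f59349b3296251 ∷ signs 0xe66e4a8983a64c88 ∷ signs 0x294846b5c7154b99dc654e2aaa3abc1e2000008f878c3d7d7951387 ∷
  signs 0x1a8e600c11b027103da7fe3b69bde5b79555138608181fcddfa6fe7ffb17f5c0 ∷ signs 0x38fef49cd24bb666e8bce7 ∷
  signs 0x101d034c0750fdf96dd0d3e9bc9a17f8 ∷ signs 0x6dafb656d88 ∷ outer₁ 1386058671 552055587 7 7 ∷ signs 0x10f0 ∷ signs 0xa561 ∷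
  signs 0xe34fa6fbe9b3d967c41b049f4c00ac2ccff8618de21a6184d3be65bdf29c723f ∷ signs 0x92883af9010c7 ∷ signs 0x1b58720cebadca1f08a1ef ∷
  signs 0x3d5bfad4f42352aceafa9c8ce4444445f7e4c09797b405ff404fc1f ∷ signs 0x2e2e3444c2e2e208e155767d1ca23c07c11104c19f33ccc3065e359 ∷
  signs 0x5964d4aa ∷ signs 0xd56b60005f6f6000 ∷ signs 0x18181 ∷ signs 0x767c8c993124c81a0a6e49326ce824dd1377f006f6d904dc04dd5f404d06f87f ∷
  signs 0x34bdd3860cedb1d23272b4738c62d799de7abb5bbdbdd7bed5aa915 ∷ signs 0x6532990866d9e4b49fc1b1bfc000fe42f001fc0bfc83f50 ∷
  signs 0x1556f3118ac2e470738121 ∷ outer₁ 1392619484 610366669 7 11 ∷ signs 0xb2cb2dbd35929b4bc9eba3a2e5e0f55574342edbfeddfe8a4250920255a5896a ∷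
  signs 0xd2f3acb6d827f ∷ signs 0x78ee39ec67256b0af1b8bf87a80888c44053d0febf8085e403e42fe8ee6223e0 ∷ signs 0x1ad4a05924fa2fd13b545f ∷ signs 0xb515 ∷
  signs 0x164d2755 ∷ signs 0x4c06c986e8b2d1654b278b0490a95a6ad9db7db6aa6dffaaadbebc106ad9e220 ∷ signs 0x1eee ∷ signs 0x91df ∷
  outer₁ 1681485914 282164918 1 7 ∷ signs 0x986187179f3831e1634109084f4a5fffde9e847154775420e8fa38a8ff0f23c0 ∷ signs 0xd71b27094cf88 ∷
  outer₁ 1427104123 539121529 7 7 ∷ signs 0x3596d ∷ inner (at 1232802174 829292443 0 27 ∷ at 218402524 277934133 0 27 ∷ []) ∷
  signs 0xcac98c72ff9fa7bf ∷ signs 0x38bf78a6a71a64b8d2b634e1d66cdb7a7cddbd6cdf36b666ceeed9b ∷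
  signs 0x6a16073f3ff03c3ccc30c0c3fd80c4e4ff3f9030027c033f01a40fc3ff003e40 ∷
  signs 0x11415d565a820e8b2fa1e0e14102db6f87843018c63d0de711ec3295ce7301cf ∷ outer₁ 1761905817 135814047 1 9 ∷
  outer (at 340483550 0 0 39 ∷ at 1839713390 347853656 0 39 ∷ []) ∷ signs 0x4d0fe47e221 ∷ signs 0x20416 ∷ signs 0x353aaa88a4bb6a4d53f93c ∷
  signs 0xe35fab357aaf412ead58999797ad15fa95b7d5e8db7f6a1044b2a097aa865dad ∷ outer₁ 1780388515 145328966 1 11 ∷
  inner (at 1321734552 744387098 0 37 ∷ at 148762763 333127603 0 37 ∷ []) ∷ inner (at 1357979838 804748724 0 33 ∷ at 254677789 328432148 0 33 ∷ []) ∷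
  signs 0xcaaff157f03b792d ∷ signs 0x5a5b26642499db6cda4f93c9924d9ffeded6d9a5e6664cc6d806a ∷ signs 0x1970be74291c2ad2d49154cb325ba92 ∷
  signs 0x35ad4eaf55eaf17978ace575eeeeeee4c8d81404c03f22f4fc151fd ∷ signs 0xa92959a9aadabf49 ∷
  signs 0x66dce277aeeb6c325d41774368130ed6b24587b0a2291a485a82f5f217d715ea ∷
  signs 0xcaa3c33e1b9e1f11f4e3dd776f39686605e05ee1de0e4e57616d9f503a3a85c0 ∷
  signs 0xb1c58e304782381f1f6380e6239f1c7c56b488947e521010fc3f81e263f9487f ∷ signs 0x1bbd94000000056a ∷
  signs 0x55e1d068c14287c287fd84c68a180f9def6994a49f9f805b012c2495b480e886 ∷ signs 0x1ab7a9e6adfa5753c77a79431630bd52 ∷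
  outer₁ 1715802759 250155720 1 9 ∷ inner (at 214496839 411532533 0 21 ∷ at 1387822467 703322058 0 21 ∷ []) ∷
  inner (at 1444936436 722267140 0 17 ∷ at 295418399 368524614 0 17 ∷ []) ∷ outer₁ 1683431318 192462980 1 7 ∷ signs 0xccc4e023290ce622 ∷
  outer₁ 1651026805 349296263 1 9 ∷ signs 0x6b5bbb376f57a35aa342ead5f568582a226eeeafd2d5edc97e9f0393274db76d ∷
  inner (at 249021179 354010701 0 31 ∷ at 1549818567 669819689 0 31 ∷ []) ∷ outer₁ 1623120532 284820425 1 7 ∷
  signs 0x19c70320ce685c22d03f3c0717b12cad ∷ outer₁ 1563139710 407810943 1 7 ∷ signs 0x24319 ∷ outer₁ 1458571431 503779159 7 7 ∷ signs 0x3e5f4f ∷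
  signs 0x820a02f97e5a1f370207855ea01143bf9200f36f1b8c6446495cc99b5bb299d0 ∷ inner₁ 885334592 704173295 2 9 ∷ inner₁ 816440293 680270959 2 9 ∷
  inner₁ 848325378 672952844 2 7 ∷ inner₁ 842304811 689245973 2 9 ∷ inner₁ 869886739 672292208 2 7 ∷
  signs 0xe63ba19c46262639999ddfcf7d7537831d0087df0eae9e0f0fa0a213f83f820a ∷ signs 0x696b2975 ∷ signs 0x1aad944613 ∷ inner₁ 734275205 703325655 2 33 ∷
  signs 0x9b00491c78f6ae35e1caa16f22bc3b88c106b7b85c6ea9d89339c05e8e4e61b8 ∷ signs 0x7e0f0f7fe03d02124bebe10d9a667939d8cf36a45aa464a ∷
  signs 0x1481257c23c622f ∷ inner₁ 781035537 666188410 2 9 ∷ inner₁ 764563885 671913798 2 11 ∷ inner₁ 800096004 681697356 2 11 ∷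
  inner₁ 783425906 694288117 2 13 ∷ outer₁ 1343814598 625357812 7 9 ∷ inner (at 1320041893 809842033 0 11 ∷ at 636589345 667668737 0 11 ∷ []) ∷
  signs 0x32d563b9591ae757b085af ∷ signs 0x10601bc8cee53acc43348b63bdf54495 ∷
  signs 0x6b6ba16515acbb6e4b36da2adb2ad8ece673f1e002e238ce3dceeee618cf1c38 ∷ signs 0x6aaaaaaaaaa ∷ outer₁ 1750790382 75907864 1 7 ∷
  inner₁ 684961834 663170902 2 15 ∷ signs 0x164d172783ab6df8 ∷ signs 0xc54e7a7b6875540757eb2caf852dfd071511da3586fa9f505ea3cc76cd230ee7 ∷
  signs 0x2ad74256f3fa202a3507b8 ∷ outer₁ 1698843616 255668207 1 7 ∷ signs 0x39cc67 ∷ inner₁ 747559505 674299729 2 11 ∷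
  inner₁ 725791152 675387784 2 13 ∷ outer₁ 1406466167 577126557 7 7 ∷ signs 0x9cc4d35898d759e5 ∷ inner₁ 1029758146 760376164 2 19 ∷
  outer₁ 892841876 727980546 2 13 ∷ signs 0x5a5 ∷ signs 0x347aa7028116154257555950d71544628a1a89c63d575ebfbbf698a ∷ signs 0x15b5fef5 ∷
  inner₁ 963904794 751071062 2 15 ∷ signs 0x69a ∷ outer₁ 1762252204 94497820 1 9 ∷
  signs 0x5a8f11bd6bbd0dc7b9cc439f62a119856c0c609f183e84cbdc38619fdd9b0290 ∷ signs 0x1542443ea4a6f232a50ce6b733b58c6f ∷ signs 0xb66e79f2327df34f ∷
  inner₁ 924157325 720214339 2 11 ∷ outer₁ 1829152166 158143556 5 21 ∷ signs 0x32b955 ∷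
  signs 0x4702aa000a4d0f55020a4f897d57c3c2685aa0a15689834e928d5 ∷ signs 0x1cbe617b1d0ce1e7be351dac2ad6a18a2e13d40820e1841063d82e38a0a285f0 ∷
  signs 0xd74daae042b581a94f4bf5bfd08bcaff5a63d82bffc7e40f419c0b300df13f45 ∷ inner (at 1285117018 804619572 0 27 ∷ at 714882983 804619572 0 27 ∷ []) ∷
  signs 0x65c4b542f48c5b30cb50ac3cd8c639e9d45752a44308a75af296add78a96b2b5 ∷ signs 0x60a0fe0a ∷
  signs 0x2d5e73b9ba89475612957f3624b4b8eff8defd1c8e38bc587185a8a ∷ signs 0x16599a6 ∷ outer₁ 1702239686 217229501 1 7 ∷
  inner (at 1369549513 847489356 0 29 ∷ at 763958302 755236869 0 29 ∷ []) ∷ signs 0x35dcca ∷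
  signs 0x6da800aaa0e7a5ffa8a0e523d7fd6968c2f00a0bfc2329e43827f ∷ signs 0x14a912e33887194ced4bde691c450896f6bfc378654b273275f0b9392582c010 ∷
  outer₁ 1781694288 255078323 1 23 ∷ signs 0x196c004b7705e916d03c43c20bded66a ∷ signs 0xc6215c1d52a7e1d5 ∷
  signs 0xcd28cd184db6aab34c51cda6cd3664d551205d7c1b7b22edbbd26640d3177fe0 ∷
  signs 0x5cc92524be3f2015ea52ba3f3d119108282d81f8b4175741a03d13d0780e0fe0 ∷ outer₁ 1692242622 169202149 1 7 ∷ signs 0x595 ∷
  signs 0x2c6598e1b8f60ffa7f840b591654ffdf2b1518dbd77d352bbedeeea ∷ signs 0x19a66555 ∷ signs 0x6b55a2740be89b95fd2ad896ab6a159249b0545682a7d00 ∷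
  signs 0x6aa ∷ outer₁ 1639772671 271129489 1 7 ∷ inner (at 1431653122 752797475 0 17 ∷ at 702408357 722791607 0 17 ∷ []) ∷
  outer₁ 1594079649 408472418 1 9 ∷ signs 0xec8bf6b7f80d4b7f ∷ outer₁ 1469232838 546151137 7 9 ∷ inner₁ 1183559708 680270960 7 9 ∷
  outer₁ 1770267151 50295587 1 9 ∷ inner₁ 1157695190 689245973 2 11 ∷ inner₁ 1129046198 710619055 2 13 ∷ inner₁ 1130192271 688571930 2 9 ∷
  signs 0x5a66f064e399c909497e36e196d805bf6e4af4eedb64b47ed8fb781b5620d312 ∷ signs 0x15840d174057ff92 ∷
  signs 0xa8a0a853d4f0b59da8ad2ff40abbe91538aa59c5b126ceece3f66331f118337a ∷ inner₁ 1086325057 759544033 0 13 ∷ inner₁ 1107158125 727980546 2 15 ∷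
  outer₁ 1703525699 181849569 1 7 ∷ outer (at 317672196 0 0 11 ∷ at 1764884435 352471546 0 11 ∷ []) ∷ signs 0x2c630be848dc069f03e1f0 ∷
  signs 0x1f7887f87ff7f8ff01ffe7f879e0f78f ∷ inner₁ 1008828879 765413525 2 17 ∷ signs 0x34f5e5 ∷ inner₁ 1235436116 671913798 7 11 ∷
  outer₁ 1722415934 191272461 1 7 ∷ inner₁ 1216574095 694288117 7 15 ∷ outer₁ 1722013255 335718050 1 19 ∷ outer₁ 813524371 711682797 2 15 ∷
  outer₁ 1693978342 133435228 1 7 ∷ outer₁ 1743498704 319279292 1 25 ∷ signs 0xb25d1a07ae3d1113305e803e17c605993a20a9069dfefafc054c6a01e36db16d ∷
  signs 0x54a5a5d54a97a8b8e1414ba730ccd39372659c0ef00ece0 ∷ signs 0x1aeb5587e38eb0f ∷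
  signs 0xfbd4ed72acc2b66bd2b95b5540a74987d503422f547d43d3e06a7c0ba90073df ∷ outer₁ 1649718790 242737801 1 7 ∷
  inner (at 1318552034 734552456 0 33 ∷ at 752867027 855044608 0 33 ∷ []) ∷ signs 0x6712c9bd566de260fa ∷
  signs 0xcc910b36ec8c8c9333377565d7df9d29b7aa2d75a40434a5a50a08b9529528a0 ∷ signs 0x526c165f ∷ signs 0x10073eecb9 ∷ outer₁ 1686662911 71942881 1 7 ∷
  signs 0x3366cd ∷ outer₁ 1671599436 253352836 1 7 ∷ inner₁ 1274208849 675387784 7 13 ∷ outer₁ 1657368922 379573430 1 11 ∷
  outer₁ 741492644 709036301 0 17 ∷ outer₁ 1647004982 202301281 1 7 ∷ inner₁ 1315038167 663170901 7 13 ∷ outer₁ 1621671467 327596152 1 7 ∷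
  signs 0xefe4d0d1c2dffeadfd4186052f8757adbfbb709f2c5035faf40966dc6789a44d ∷ outer₁ 1587172500 452239746 1 11 ∷
  signs 0x6b56b6ad285885abca1010a1ed4ac7afae88c88595bdf83f40ab95b5e3838e64 ∷ outer₁ 1599832032 273428689 1 7 ∷ outer₁ 1636993747 425124490 1 15 ∷
  outer₁ 1558348642 380047642 1 7 ∷ signs 0x1acab162644f9066e99e21c9175fee3f ∷ outer₁ 1486124803 487033922 1 7 ∷ signs 0x6aaaaaaaaaa ∷
  outer₁ 1143066212 736809035 0 19 ∷ outer₁ 1251508645 719670306 0 19 ∷ signs 0x363 ∷ outer₁ 1172872134 667603653 2 9 ∷
  inner₁ 350281212 242737801 4 9 ∷ signs 0x3fb801fc517dd1d11f10165d997c26c936f036323db1c4ca693dd0f ∷ inner₁ 329295312 216040362 4 9 ∷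
  inner₁ 297760316 217229503 4 25 ∷ inner (at 331291994 0 0 25 ∷ at 458060919 694442505 0 25 ∷ []) ∷ outer₁ 1425655878 642167390 0 21 ∷
  signs 0x5376d831987a4f92d096c6fa3f342ffb522630678c47992c213679806cfd9224 ∷ outer₁ 1331925387 578374331 7 7 ∷ outer₁ 1218964465 666188409 2 9 ∷
  signs 0x393 ∷ inner₁ 376879469 284820426 4 9 ∷ signs 0x353 ∷ inner₁ 400167970 273428690 4 7 ∷
  signs 0xcdc5f47451041045d1c07711c7747c1fff3ff83f01f09387e0212dfa525213b0 ∷ inner₁ 346077623 264386737 4 11 ∷ inner₁ 318514088 282164919 4 19 ∷
  inner₁ 376501522 259364789 4 7 ∷ inner₁ 360227331 271129490 4 9 ∷ signs 0x333 ∷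
  signs 0x6ed7a4ff7ef7bf603d9bc1b01806ff7fff3000cc609f327c9d81e87f7284f60f ∷
  signs 0x1b668edfc99436d91bb426918995dec6673e6e5d8f700dbfc40b58f01175354f ∷ signs 0x364d08466710e3cd8f4549 ∷ signs 0x28c ∷
  outer₁ 1263212947 651186652 7 9 ∷ signs 0x217cfb55b082dd57c69523 ∷ signs 0x3b93b ∷ signs 0xf87b ∷ inner₁ 399097576 0 0 7 ∷
  signs 0x7c23f9e4036c94676721fc8b7800190d3930e9b749abd7b ∷ inner₁ 454032700 0 0 7 ∷ inner₁ 440025492 0 0 7 ∷ inner₁ 445497472 0 0 7 ∷
  inner₁ 428356729 0 0 7 ∷ inner₁ 435275697 0 0 7 ∷ signs 0xf8ae328c0f9fba3ac0503bae2b5ccb67a24bb8c7e38873b50a8a33de67af6ee4 ∷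
  signs 0xf0e5c4ad5fed5003 ∷ inner₁ 333450491 147974875 4 9 ∷ inner₁ 306021660 133435229 4 11 ∷
  signs 0x39e3ff19078e79e31e4cc679c703603000318790678501cfb4ff5a3 ∷ signs 0x1c5c ∷
  signs 0xb51dc97788f134704c960d86cff703da63199ec9f5a6f926ff7519a41b411a5b ∷
  signs 0x41db9fe00f8dffc37ce1ff9e721f80f263379f1e78643e4037c3c19987fa6ee4 ∷ signs 0x14a4 ∷ inner (at 317672196 0 0 17 ∷ at 191269400 0 0 17 ∷ []) ∷
  inner₁ 414502106 0 0 7 ∷ inner₁ 422487316 0 0 7 ∷ signs 0x6671eac7376035c505a673cc7a1210ee4ce3e6583f0053839e17e182bba585a3 ∷
  signs 0x7f305d8e708eb00e9670903cfa88e35c ∷ outer₁ 1365022748 594041215 7 7 ∷ inner₁ 388081610 0 0 9 ∷ inner₁ 256307357 162180215 0 21 ∷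
  signs 0x62e50cc1e7f199ce6613260000c1e003381fde0063c03f0004e0f ∷ inner₁ 343899655 193472364 4 9 ∷ inner₁ 316568683 192462981 4 11 ∷
  inner₁ 370818798 200485874 4 7 ∷ inner₁ 352995020 202301282 4 7 ∷ signs 0x32b5b ∷ signs 0x5180649c3e36319b036c8ccd2794aa8001fe13e66781110 ∷
  signs 0x2151b ∷ inner₁ 299136210 153117086 4 13 ∷ signs 0xfefc ∷ signs 0x35143 ∷ inner₁ 307757381 169202150 4 11 ∷
  signs 0x58c19dfef63e09c3d6ea337461cbdb9c07c6c2dda34cc38bd9624 ∷ signs 0x2d6d94bcf8db514a6fcbdb ∷ signs 0x662df46a9fc ∷
  signs 0x1038fc8f4cc0190df216ce680e67c01c07c861bc06678062d240c93d3c32fda4 ∷ outer₁ 1403341752 544513149 7 7 ∷ outer₁ 1293730902 673425880 7 15 ∷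
  signs 0x38b ∷ inner₁ 466895745 0 0 7 ∷ signs 0x34b ∷ inner₁ 458615184 0 0 7 ∷ inner₁ 485247459 0 0 7 ∷ inner₁ 487888299 0 0 7 ∷
  signs 0xad446fe0f118b ∷ signs 0x1c6f8fb99cf1c4ef825374 ∷ inner₁ 469514617 0 0 7 ∷ inner₁ 473272118 0 0 7 ∷ signs 0x32b ∷ inner₁ 494746670 0 0 7 ∷
  signs 0x254 ∷ inner₁ 487518997 0 0 7 ∷ signs 0x2163f9cce4415b79354714 ∷ signs 0x36b ∷ inner₁ 484936469 0 0 7 ∷ inner₁ 445562456 0 0 7 ∷
  inner₁ 451053758 0 0 7 ∷ inner₁ 425068354 0 0 7 ∷ inner₁ 433612335 0 0 7 ∷ inner₁ 404162399 0 0 7 ∷ inner₁ 417535163 0 0 7 ∷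
  inner₁ 462127054 0 0 7 ∷ inner₁ 466119026 0 0 7 ∷ signs 0x6737c674902ccfc4a7a6606e40b33f12af7981db190cfc4 ∷
  signs 0x2311ec6e1f867cf1b66b9bfb400c879bfd807326f0163fba0ffa94b ∷ inner₁ 436389897 0 0 7 ∷ inner₁ 443359068 0 0 7 ∷ inner₁ 471757935 0 0 7 ∷
  signs 0x76fa120b ∷ inner₁ 478215025 0 0 7 ∷ signs 0x2cdfdf26c00490204dc8612083fee6f8ee31d3a5ca8d664a1e7f3cb ∷ inner₁ 468557022 0 0 7 ∷
  signs 0x14b4b4b4b4b ∷ inner₁ 460986730 0 0 7 ∷ inner₁ 399253633 0 0 7 ∷ signs 0x39b ∷ outer₁ 1728264544 233071373 1 9 ∷
  outer₁ 610137907 642258435 0 13 ∷ signs 0x35b ∷ outer₁ 705025494 641354808 2 11 ∷ inner₁ 420653819 0 0 7 ∷ inner₁ 429103231 0 0 7 ∷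
  inner₁ 436150156 0 0 7 ∷ inner₁ 400862274 0 0 7 ∷ signs 0x1c487ea3c487f994b7817b ∷ inner (at 363117083 0 0 7 ∷ at 245122334 0 0 7 ∷ []) ∷
  inner₁ 389958975 0 0 9 ∷ signs 0x2c4 ∷ inner₁ 448995727 0 0 7 ∷ signs 0x3bb ∷ inner₁ 431601160 0 0 7 ∷ signs 0x207e77cfda30963bad6cfb ∷
  signs 0x37b ∷ inner₁ 425497150 0 0 7 ∷ signs 0xfc1f ∷ signs 0x2b5a52b586adc8e850b26c ∷ signs 0x4851c4dbfbf ∷ signs 0xdb2eae504a20e ∷
  outer₁ 1245099864 673786370 7 11 ∷ signs 0x15c9b076647cd9a0fe6e5cf8fd688e80 ∷ inner₁ 609343415 654449663 0 21 ∷ outer₁ 470753630 0 0 7 ∷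
  signs 0xd4e7 ∷ signs 0x52132d96a07 ∷ outer₁ 1280648027 611198551 7 7 ∷ outer₁ 1151674623 672952844 2 9 ∷
  signs 0x3e53778463bbadfb19c92653b5466a9f305d3628c4ebdf204ad3f60 ∷ signs 0xd5a3e549896a54b52eae8f95be223c1fb5b6d648992a49d6d6a48a5bac927b6c ∷
  signs 0x11d24b8 ∷ inner₁ 385826974 351943937 4 11 ∷ signs 0x7d6b3b473005ce7893 ∷ signs 0x2da4ff ∷
  signs 0x428e19f458f23493873c9d43d90043f7af0fa79cafa0127210d61a85ede7b0c7 ∷ outer₁ 1816726523 168103358 5 19 ∷ signs 0x12e2b64a48de9fb2265c00 ∷
  outer₁ 1304762440 682428036 0 13 ∷ signs 0x20cddf ∷ outer₁ 1774766476 115667744 1 9 ∷ signs 0x6d6f659c3c9a53e788 ∷ outer₁ 440658370 0 0 7 ∷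
  inner (at 199419594 321455365 0 31 ∷ at 581197600 689353556 0 31 ∷ []) ∷ signs 0xda8d4a209bb44fea810bb162edd160abaa10fdd417f2ff41207dc00bd06e08bf ∷
  outer₁ 1329701513 601317873 7 7 ∷ outer₁ 1199903997 681697356 2 11 ∷ inner₁ 444097230 444013015 4 11 ∷ inner₁ 468639073 450774278 4 9 ∷
  inner₁ 428100109 387887631 4 7 ∷ inner₁ 436860292 407810944 4 9 ∷ inner₁ 452543436 423529032 4 9 ∷ inner₁ 438792963 364722771 4 7 ∷
  inner₁ 441651360 380047643 4 7 ∷ factor (1ℤ ∷ 0ℤ ∷ -1ℤ ∷ []) ∷ signs 0x19a9a14056856d0df816da84204b969f ∷ signs 0x70e1d72a157 ∷
  signs 0x5a9fb837b1df74f9c1e95e3024c15b326483822be6270ce1a1e86c3168c6e420 ∷ signs 0xa2533e2d8c6df ∷ signs 0x6d6cb5b2d6c ∷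
  inner₁ 405920353 408472419 4 15 ∷ signs 0x1a7f9fbdd5a4f8576a8e55ba4ef2329b3362efcc4dc31788dce397cc6ae24338 ∷ signs 0x2dad8876852c0a0f2b7277 ∷
  outer₁ 389143052 0 0 9 ∷ signs 0xa447 ∷ signs 0x6ec7031d7c7 ∷ outer₁ 1378643383 569163078 7 7 ∷ outer₁ 1252440496 674299729 7 11 ∷
  signs 0xe0ee503f46540 ∷ signs 0x319c444c6670735cc7d1dcd6171cc67da4f2703c90e61b606097509 ∷
  signs 0x47729fb73ff0c0c00303c206607f803f03c03c36c0f7f803e4000de877f920ff ∷ outer₁ 1838924018 167949097 1 31 ∷ signs 0x1e35540a8421a8b0 ∷
  signs 0x2d351fa5d6659633633ff6f8e1fc6c8080056e72289041195669710 ∷ outer₁ 433000648 0 0 7 ∷ outer₁ 1801841252 131524108 1 13 ∷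
  signs 0x4b936d8019860cc3c183cdb6cd33c3003e67fff3fcdfe066f606fc993f600def ∷ signs 0x7c5c529c ∷ outer₁ 1245236618 720830084 0 15 ∷
  signs 0x20987511505f7fd26d881a0826effb7cbf9fff7e2ffa7ba82b6016f ∷ outer₁ 1765384417 53934999 1 9 ∷
  inner (at 346408351 0 0 9 ∷ at 626526047 738932907 0 9 ∷ []) ∷ outer₁ 482619538 0 0 7 ∷
  inner (at 284701347 0 0 15 ∷ at 697418944 761681365 0 15 ∷ []) ∷ inner (at 317672196 0 0 15 ∷ at 659205134 785423103 0 15 ∷ []) ∷
  outer₁ 1296664084 644321291 7 9 ∷ signs 0x1a3ba6e131116470 ∷ signs 0xc7618a292a6aa69d335a6ae99c7654cd993509224925b5bcd2d0cb496db6b2db ∷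
  signs 0x4c90c697b33ce7210cccc0c0190267840cfc33f33c0c4e8 ∷ signs 0x32c7d890c9c27f63da6593 ∷ signs 0x1e3f70e679802381e1fe923e84d7a43 ∷
  signs 0x3f3cc0040802e7efc7de00 ∷ inner₁ 342004047 281128860 4 11 ∷ signs 0xf1ec71c96a81b3fab50515761ae02884e67a9b5e94aa17acceeef4905a86f78c ∷
  signs 0x4e21dc678e798cf1ec631f9b330ccf73cccc30cf3cccccf0f33ccfdbccccfd8f ∷ outer₁ 387580520 0 0 9 ∷ outer₁ 1753488070 246806125 1 15 ∷
  signs 0xaaa9d1d7aaa9c1ff ∷ signs 0x100012a5 ∷ inner₁ 296848888 261098066 0 17 ∷
  signs 0x41f9f0fed047f0f97c13ee9a23f810204f4db26c65a7e81e699c26e17a01e243 ∷ signs 0x65d472204ba8e83f97527880d15a9101a2cde203459dbbf ∷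
  inner (at 272887797 0 0 19 ∷ at 554234221 713861328 0 19 ∷ []) ∷ outer₁ 458421271 0 0 7 ∷ outer₁ 1717012916 368788810 0 29 ∷
  signs 0x1fae1372630181c07e708d211c27e3f ∷ outer₁ 1366707756 630787774 7 11 ∷
  signs 0xa469939217ab64ce276011b7a45c1aeb2244b408d1e803697c901d25b6e3aac6 ∷ signs 0x170fca5bd0f3c91f ∷ signs 0x98c39c5c1401f ∷
  outer₁ 1733388033 207149508 1 9 ∷ inner₁ 348973196 349296263 0 11 ∷ outer₁ 445550675 477953201 4 19 ∷ inner₁ 388011913 311818868 4 9 ∷
  inner₁ 378328534 327596153 4 9 ∷ outer₁ 1700863792 153117084 1 7 ∷ signs 0x2caaa518d316392a99aaaa696aa65b76efebd1120d9f36dbb6b6efe ∷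
  signs 0x10825cc2d0b4b7e004ff8196c13f5abf ∷ signs 0x59364d93 ∷ signs 0x6bbb4c7f28a5f5c7ffd5473ff1c51c4c7f3c0fe8e29ed39e030879ef72ce72a6 ∷
  signs 0x428850ea ∷ inner₁ 347713537 308764312 4 13 ∷ signs 0x20445c5103f3d77d1c9bfb035d54fe7b9f0ae956154a7491a499e6c ∷
  outer₁ 1653922379 264386737 1 7 ∷ signs 0x1bbf06174f664e6e ∷ signs 0x9095aa9fed0bf ∷
  signs 0x6ba3726f09a72f4bcb6693b35fbadae3399c0a63a9b40f4a4d611449d1add4fc ∷ signs 0x3693bf97d7d2c96948aaaaa25ad01200024fe6dd990ffb6df06e8f8 ∷
  outer₁ 1432347795 566719632 7 9 ∷ signs 0x1b51c7f6b4e4218c ∷ outer₁ 1816318685 105044877 1 13 ∷ outer₁ 386566522 0 0 9 ∷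
  inner (at 328372986 0 0 17 ∷ at 1157097238 863873397 0 17 ∷ []) ∷ inner (at 351634780 0 0 17 ∷ at 1135970886 820640160 0 17 ∷ []) ∷
  outer₁ 1784337670 245609314 1 23 ∷ outer₁ 832287561 710897457 2 13 ∷ inner₁ 392383149 0 0 9 ∷ inner₁ 400984707 0 0 7 ∷
  outer₁ 1746304473 213484420 1 11 ∷ signs 0xb19476ae023e3 ∷ inner₁ 386094820 0 0 11 ∷
  inner (at 143325116 0 0 27 ∷ at 317672196 0 0 27 ∷ at 849948510 897460327 0 27 ∷ []) ∷ signs 0x1af4f01c3f830e41dfc03da6c179a063 ∷
  inner₁ 407267915 0 0 7 ∷ inner₁ 414230451 0 0 7 ∷ inner₁ 420327077 0 0 7 ∷ inner₁ 393005065 0 0 7 ∷ signs 0x4912c0117a3 ∷ signs 0x9d7b ∷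
  inner (at 373840003 0 0 11 ∷ at 806328424 829308082 0 11 ∷ []) ∷ inner₁ 386364517 0 0 11 ∷ outer₁ 1779337296 210275193 1 17 ∷
  inner (at 1232785616 792551993 0 15 ∷ at 307128370 0 0 15 ∷ []) ∷ outer₁ 1729612853 174671657 1 7 ∷
  inner (at 1240683492 846895229 0 33 ∷ at 219611487 145328967 0 33 ∷ []) ∷ signs 0x1ee720f1ccf40 ∷ inner₁ 309283937 197781515 4 13 ∷
  outer₁ 758881859 704432864 2 17 ∷ outer₁ 1700848041 115412567 1 7 ∷ signs 0x2d1e24 ∷ outer₁ 416924419 0 0 7 ∷ signs 0x339e61d27562d8cb89d6c3 ∷
  signs 0x19cf3c9ff1ecf699985803 ∷ signs 0x399aaf6e72ae2a283227af ∷ signs 0x6dfdfd267f89193e332b8ea68d7c750c48721660d897365eefba96e75943a63c ∷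
  signs 0x3ff903 ∷ outer₁ 1661231085 234286126 1 7 ∷ inner (at 375258638 0 0 31 ∷ at 568300039 807125193 0 31 ∷ []) ∷ outer₁ 472125191 0 0 7 ∷
  signs 0x1636363 ∷ signs 0xb4d8e4332f8101b21bf00f805907937cf18f90c3c006060f1f72de390d30ca5b ∷ signs 0x13eac1c ∷
  outer (at 1440438893 686318706 0 27 ∷ at 1662358979 562279511 0 27 ∷ []) ∷ signs 0x7e52ee712b30742850 ∷ outer₁ 1692389493 38857369 1 7 ∷
  outer₁ 1737805269 274119639 1 15 ∷ signs 0x18e4ff120078108181dbc99381272487f36c1e25a5fb1ad7a76f18664f79c0fa ∷ outer₁ 1682668745 243391642 1 7 ∷
  inner₁ 284197243 250155720 0 25 ∷ inner (at 223819123 262584099 0 29 ∷ at 1265035021 807197905 0 29 ∷ []) ∷ inner₁ 349020766 246231853 4 9 ∷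
  inner₁ 328400566 253352837 4 13 ∷ outer₁ 1656100347 193472363 1 7 ∷ signs 0x19cdb9e93b71caf36461863effd90f76 ∷ signs 0x490f5c4c72f ∷
  outer₁ 1636966468 324852520 1 7 ∷ signs 0xd58a71c304d0f ∷ signs 0x6ed84cf33c337e3180fff63f0f33fd9ffff3f691bdbc6f03607806c3697c8f0f ∷
  signs 0x54bcae32b43 ∷ signs 0x1fcc1d17ae96896a1c23d0a4478aa9c3 ∷ outer₁ 1610687982 271121137 1 7 ∷ outer₁ 1659616695 425639332 1 25 ∷
  outer₁ 444646762 0 0 7 ∷ outer₁ 1571899893 387887630 1 7 ∷ signs 0x7b81f23d9d6 ∷ signs 0x844c ∷ outer₁ 1482129395 514777112 7 7 ∷
  signs 0x341e8b17f641b9f9127fc3 ∷ signs 0x387 ∷ signs 0x2d3953fce0710e0880013f ∷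
  signs 0x13ca69a82be86b405ab2aafd9f1669a794a4e49796f65ddb1a5a0bef013ffe40 ∷ signs 0x347 ∷ outer₁ 991171122 765413525 2 17 ∷ signs 0x238 ∷
  inner₁ 669155745 615333556 2 9 ∷ inner₁ 651396218 605023872 2 9 ∷ inner₁ 703335918 644321292 2 11 ∷ signs 0x15d2fba52f91f7d9ae4b07 ∷
  signs 0x87a4d9359e107 ∷ inner₁ 728756699 664106407 2 11 ∷ outer₁ 1075842676 720214338 2 11 ∷ inner₁ 696465409 593133379 2 7 ∷ signs 0x3a7 ∷
  inner₁ 719351973 611198550 2 7 ∷ inner₁ 704472298 613357546 2 9 ∷ inner₁ 687329545 611990406 2 9 ∷ signs 0x367 ∷ outer₁ 1130113262 672292208 2 7 ∷
  signs 0x596c1487 ∷ inner₁ 577691630 548957396 4 9 ∷ signs 0x72ef6ae1c0e3a78a9c2ad4d4e3e0cf1744d6acbef262c552fa52fa0a6f284b40 ∷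
  inner₁ 543148014 559319526 2 17 ∷ outer₁ 1793928615 248496640 1 31 ∷ signs 0x5430a738 ∷ signs 0x11c93f5f6c7 ∷ inner₁ 622217904 577856649 2 9 ∷
  inner₁ 615501309 560833364 2 9 ∷ outer₁ 1755007724 219863364 1 11 ∷ inner₁ 607380518 610366669 2 15 ∷ inner₁ 595305699 583260556 2 13 ∷
  inner (at 307488950 495693943 0 15 ∷ at 652363323 677550580 0 15 ∷ []) ∷ signs 0x1a2a9eb0e3637a504e64e780cb46957c5c3ba08923cd1781d98324bb66de23f8 ∷
  inner₁ 668074614 578374331 2 7 ∷ inner₁ 657053391 570187053 2 7 ∷ inner₁ 648372840 560092129 2 7 ∷ inner₁ 670298489 601317873 2 9 ∷
  inner₁ 653787624 593549817 2 9 ∷ inner₁ 640165636 581153080 2 9 ∷ inner₁ 680304803 627952048 2 9 ∷ inner₁ 656185404 625357812 2 11 ∷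
  inner₁ 568562906 507146356 4 7 ∷ signs 0x397 ∷ outer₁ 1736415049 182449498 1 9 ∷ inner₁ 541428570 503779160 4 7 ∷ inner₁ 556401137 494070545 4 7 ∷
  signs 0x357 ∷ inner₁ 513875199 487033924 4 7 ∷ signs 0x3d7 ∷ outer₁ 1705780065 126944357 1 7 ∷ inner₁ 597542337 527629846 2 7 ∷
  inner₁ 600278652 514353542 2 7 ∷ outer₁ 1704167940 292997913 1 11 ∷ inner₁ 572895879 539121530 2 9 ∷ inner₁ 579992575 521249275 4 7 ∷
  inner (at 452576207 585651981 0 27 ∷ at 481087206 666609845 0 27 ∷ []) ∷ inner₁ 530767166 546151138 4 15 ∷ signs 0x2c8 ∷
  inner₁ 628009285 535310381 2 7 ∷ signs 0x3b7 ∷ inner₁ 621356619 569163078 2 7 ∷ inner₁ 613941330 552055587 2 7 ∷ inner₁ 611458545 536414089 2 7 ∷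
  signs 0x377 ∷ inner₁ 593533835 577126556 2 11 ∷ signs 0x331bb258d9aa399a2a0c15 ∷ signs 0x7377bf305e969f18c97fe601bff9bbdf9897b652ceca97f300dff ∷
  signs 0x1592a64d903e69d224d1a16c9b2a68b4b5c71ea282dad2f5e7bdaebf0c010282 ∷ signs 0x6caea6f6555 ∷ outer₁ 1782178487 221434423 1 17 ∷
  inner (at 251198419 376097447 0 23 ∷ at 868342360 816576717 0 23 ∷ []) ∷ signs 0x47c5e163c0957fe5c1b7660d51545e518a48ff02ac14f8012ea0f ∷
  signs 0x58e10ce1933e71ad1891929dc0f78d897ef5bc7b02cd6b8 ∷ outer₁ 420292034 0 0 7 ∷ outer₁ 1747779758 188989709 1 9 ∷ signs 0xe9f8 ∷
  signs 0x1cdb25b3f649e69e1fb86c0030ff8750 ∷ inner₁ 795875708 722659784 2 21 ∷ outer₁ 1036095207 751071062 2 17 ∷ signs 0x210c7 ∷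
  outer₁ 1715853243 139803947 1 7 ∷ inner₁ 712350422 666149473 2 13 ∷ outer₁ 476706760 0 0 7 ∷ inner₁ 754900136 673786370 2 11 ∷
  signs 0x1ab599c4f8f322f57fc46faf87bf9746153ab8134033742a00ee4141e101a4b8 ∷ inner₁ 709418117 705048101 0 15 ∷ inner₁ 781738730 680826358 2 9 ∷
  outer₁ 1114665409 704173295 2 11 ∷ signs 0x199cda671369e95 ∷ inner (at 503937101 630775734 0 23 ∷ at 1150092846 851965702 0 23 ∷ []) ∷
  signs 0x5a4c25f3ec8f02288bce6f1394cf46d1d97edaf90c0920664a73712acc7abab8 ∷ signs 0xe3d407006067e0e0 ∷
  signs 0x4c263763653585a1adad0f6f244c4301e2fe3ce15e84ed03f41fe1bf417f0870 ∷ outer₁ 1741453582 293650036 1 17 ∷ signs 0x15a7db6d4b007df ∷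
  signs 0xf0f5b182981d124723e756ea9e066c6fd06aaf1771e684d25f647c6794fd8aff ∷ signs 0x1707 ∷
  signs 0x339def163581c3a38ef3a1846f62b38a51ce7da23306a157b104c88 ∷ signs 0x1dbf ∷ outer₁ 1703151114 261098065 1 9 ∷
  signs 0x552d72862a140462a4628c7172a951188463af67398e373ebcae63898ce6e531 ∷
  signs 0xcc54773b14b5bdffe3dad6843d4c787ac601df01c00f8fb838fe05ff05717e07 ∷ signs 0x1547 ∷
  signs 0x2081e9b69ed09248dbd45c954490f0e27357f83a7f6f881191365fc ∷ signs 0x1fff ∷ outer₁ 1670704691 216040360 1 7 ∷
  signs 0x19cdd732006f31863228c6c790ce7 ∷ outer₁ 449296522 0 0 7 ∷ outer₁ 1663973508 352737833 1 11 ∷ signs 0xa449413d803e4a07 ∷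
  signs 0x7df3bfb5b2d9cc24cdc07898e6d848558883f98bf866436375bdf6f0324c32c0 ∷ inner₁ 726309922 705150517 0 19 ∷ signs 0x15eec96e940e2b8 ∷
  outer₁ 1741774057 254814502 1 13 ∷ outer₁ 339704416 290502829 4 13 ∷ signs 0x65e06481a1f ∷
  inner (at 412366939 510057793 0 47 ∷ at 1230296619 895480169 0 47 ∷ []) ∷ outer₁ 422616860 435771552 4 15 ∷ outer₁ 1692574894 348812685 1 15 ∷
  inner₁ 412827502 452239748 0 11 ∷ outer₁ 551515747 524434026 4 9 ∷ signs 0x32fbf ∷ outer₁ 1715076598 331538126 1 17 ∷
  inner₁ 545522355 574995027 0 17 ∷ outer₁ 1652286466 308764310 1 7 ∷ signs 0xd76e ∷ signs 0x1367dac8370bcfe4716b3bd2f63436bf ∷ signs 0x36f47 ∷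
  signs 0x6a853faf02029ce38c0bf1ff0ec7f8540dcef5ea13bc01f ∷ signs 0x2012e ∷ outer₁ 1623498481 259364788 1 7 ∷ inner₁ 600490579 609617365 2 15 ∷
  outer₁ 405318799 0 0 7 ∷ signs 0x58f863e18f8 ∷ signs 0x1a905427554d5cf511952b2bacb620003470d173c76d54f16a24ea7229aacdbf ∷ signs 0x4f0cbe9b407 ∷
  inner (at 272863916 430014289 0 23 ∷ at 648192049 720341736 0 23 ∷ []) ∷ signs 0x2916bf202a215347e2f7c0 ∷
  signs 0x666e9ff31e14c3b67c969669e13c2c5b6d8b1949a25693e5f3cef635b92cf870 ∷ signs 0x38f ∷ outer₁ 1728229217 117409142 1 7 ∷
  outer₁ 1781597478 277934132 0 25 ∷ signs 0x1ad6c98c78db0d24d01eca16ec044d069cdedb9cc1efcccda05f87a44feecbe5 ∷ signs 0x34f ∷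
  outer₁ 870953803 710619055 2 11 ∷ signs 0x3cf ∷ outer₁ 1752350687 257583999 1 15 ∷ outer₁ 441235239 0 0 7 ∷ outer₁ 1702056280 232585880 1 7 ∷
  signs 0x1b3d24fcc30f3fcf81f6c3 ∷ signs 0xe342ada5a280f ∷ outer₁ 1711538661 352129554 1 19 ∷ outer₁ 970241855 760376163 2 19 ∷
  signs 0x476b25fa127a7cb16b598f7c81fe9567b9ff5f8cba1efcc08dd5a ∷ signs 0x32f ∷ outer₁ 1729669464 334092096 1 21 ∷ signs 0x3af ∷
  outer₁ 1668712004 319026276 1 9 ∷ inner (at 268998607 0 0 11 ∷ at 801086236 772007305 0 11 ∷ []) ∷ outer₁ 396271528 0 0 7 ∷ signs 0x36f ∷
  outer₁ 1082593500 740993916 2 19 ∷ signs 0x210 ∷ signs 0x6678330f ∷ signs 0x16a7c5cde20 ∷ outer₁ 1690716065 197781514 1 7 ∷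
  outer₁ 1745322212 328432148 0 23 ∷ signs 0x2e5e8e50e140fd72a977abfaa1aa753e052fc5a8059a409101ed220 ∷ signs 0x164d939b26c ∷
  outer₁ 792279759 738066138 0 15 ∷ outer₁ 631822364 612146799 2 11 ∷ outer₁ 1666549512 147974874 1 7 ∷
  signs 0x19b2d369124c863926c533e94921dbc3d8c4923936cde6919cfb490006c2776a ∷ outer₁ 400927009 0 0 7 ∷ outer₁ 1657995955 281128859 1 7 ∷
  signs 0x39f25e6b2ccd3359acebbbad6ad220dbd677ffa48a24242ceef2424 ∷ signs 0x491b302646c4ccee7c0c0c00001f10edc3273f24090270a ∷
  outer₁ 1657752407 397426950 1 15 ∷ signs 0x1a50befafb6deb16ca28b2daeba8162defb2fc1fe9f1206d74d2d9a12742cd79 ∷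
  signs 0xf1cebc7eaa0042bd6ae542d500157e00febfebff40559720e0bd0547e83d2700 ∷ outer₁ 1631458497 235639148 1 7 ∷ outer₁ 1683989130 373762736 1 15 ∷
  outer₁ 465181522 0 0 7 ∷ outer₁ 1614173027 351943936 1 7 ∷ signs 0x6ef871f19e9003c3183909ccfff4b073ce7fff318ffdef4e609ccce370ce665e ∷
  signs 0x24b7c445572ad8e44762482087a4d3d80ec2e1f00fd97c3067da070 ∷ outer₁ 1604894931 488754865 0 21 ∷ signs 0x410f9f0f ∷ signs 0x1ffff947aa5 ∷
  signs 0x31f ∷ signs 0x58c270f6c52352a3892f3326189bceba75eed21ef925e32ba7f0b5d9cb718e4d ∷ signs 0x39f ∷ outer₁ 1650979236 246231852 1 7 ∷
  outer₁ 1704581603 368524613 1 23 ∷ inner (at 1174445642 783198078 0 25 ∷ at 289651017 500007488 0 25 ∷ []) ∷ signs 0x35f ∷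
  inner (at 1161130233 843968741 0 15 ∷ at 342631080 379573432 0 15 ∷ []) ∷ signs 0x3df ∷ outer₁ 1629181205 200485873 1 7 ∷
  signs 0xb199699e398df0141f1cba49ad2a8a2ed55dfed9ad46ba6f15ac95af76beb5d5 ∷ inner (at 1232785617 792551992 0 19 ∷ at 481087207 666609845 0 19 ∷ []) ∷
  outer₁ 1611988089 311818867 1 7 ∷ signs 0x1508076215ef58e30af81f ∷ signs 0xef6850b7ed7e0 ∷ outer₁ 1594350602 424033261 1 9 ∷
  signs 0xa955decf2b998f447108c5c6b5f7a8efff399cf318736fb3cc001c73a6f320f3 ∷ signs 0x40873bd5e5454e2aea9d8fff8b878151f1b57f2bf5438278e03e0 ∷
  signs 0x33f ∷ outer₁ 1634063419 399739240 1 13 ∷ signs 0x3bf ∷ outer₁ 1561207039 364722769 1 7 ∷ signs 0x3be2783318f39f4385f077 ∷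
  signs 0x194212cc233dcc031bc301bcc3630001fd80306c0c19e026079d8de67e7fe4e8 ∷ signs 0x37f ∷
  signs 0x6da4966cb3777645b66dbb7aab495933676c7f9c7fbc719e371de7c0830bdf1f ∷ signs 0x3ff ∷ []

certificates : ℕ → List Certificate
certificates 0 = certificates₀
certificates 1 = certificates₁
certificates 2 = certificates₂
certificates 3 = certificates₃
certificates 4 = certificates₄
certificates 5 = certificates₅
certificates 6 = certificates₆
certificates 7 = certificates₇
certificates _ = certificates₈

-- All case checking takes place here: each clause holds because `run` evaluates to `true`.
all-certified : ∀ n → n ℕ.≤ 8 → T (run (words n) (certificates n))
all-certified 0 _ = tt
all-certified 1 _ = tt
all-certified 2 _ = tt
all-certified 3 _ = tt
all-certified 4 _ = tt
all-certified 5 _ = tt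
all-certified 6 _ = tt
all-certified 7 _ = tt
all-certified 8 _ = tt
all-certified (suc (suc (suc (suc (suc (suc (suc (suc (suc _))))))))) (s≤s (s≤s (s≤s (s≤s (s≤s (s≤s (s≤s (s≤s ()))))))))

-- Reduction to constant term 1 and canonical representatives

lifts-canonical : ∀ p → Ternary p → length p ℕ.≤ 8 → lead (1ℤ ∷ p) ≢ 0ℤ → T (canonicalᵇ (1ℤ ∷ p)) → Lifts (1ℤ ∷ p)
lifts-canonical p ternary short = run-sound (words (length p)) (certificates (length p)) (all-certified (length p) short) (∈-words ternary)

Ternary-negate : ∀ {p} → Ternary p → Ternary (negate p)
Ternary-negate []                          = []
Ternary-negate (inj₁ refl ∷ hs)            = inj₂ (inj₂ refl) ∷ Ternary-negate hs
Ternary-negate (inj₂ (inj₁ refl) ∷ hs)     = inj₂ (inj₁ refl) ∷ Ternary-negate hs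
Ternary-negate (inj₂ (inj₂ refl) ∷ hs)     = inj₁ refl ∷ Ternary-negate hs

negate-involutive : ∀ p → negate (negate p) ≡ p
negate-involutive []      = refl
negate-involutive (a ∷ p) = cong₂ _∷_ (-1*-1* a) (negate-involutive p)

lead-negate : ∀ p → lead (negate p) ≡ -1ℤ * lead p
lead-negate []          = refl
lead-negate (a ∷ [])    = refl
lead-negate (a ∷ b ∷ p) = lead-negate (b ∷ p)

-1*≢0 : ∀ {i} → i ≢ 0ℤ → -1ℤ * i ≢ 0ℤ
-1*≢0 {i} i≢0 eq = i≢0 (trans (sym (-1*-1* i)) (cong (-1ℤ *_) eq))

normalise-1 : ∀ p → coeff p 0 ≡ 1ℤ → normalise p ≡ p
normalise-1 p eq rewrite eq = refl

normalise--1 : ∀ p → coeff p 0 ≡ -1ℤ → normalise p ≡ negate p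
normalise--1 p eq rewrite eq = refl

-- What is needed to apply the enumeration to the mirror image in place of P. Involutivity makes the
-- comparison of codes symmetric in the pair.
record Mirrored (P : Poly) : Set where
  field
    tail′      : Poly
    mirror≡    : mirror P ≡ 1ℤ ∷ tail′
    ternary    : Ternary tail′
    length≡    : suc (length tail′) ≡ length P
    lead≢0     : lead (1ℤ ∷ tail′) ≢ 0ℤ
    involutive : mirror (mirror P) ≡ P

mirrored : ∀ p → Ternary p → lead (1ℤ ∷ p) ≢ 0ℤ → Mirrored (1ℤ ∷ p)
mirrored p ternary lead≢0 = by-lead (All-coeff-0 (All-reverse ternary-P) (λ eq → lead≢0 (trans (sym (coeff-reverse-0 P)) eq)))
  where
  P = 1ℤ ∷ p
  ternary-P : Ternary P
  ternary-P = inj₂ (inj₂ refl) ∷ ternary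
  lead-reverse≢0 : lead (reverse P) ≢ 0ℤ
  lead-reverse≢0 eq with trans (sym (lead-reverse P)) eq
  ... | ()
  -- With the mirror image as a variable M, both signs of the leading coefficient share this
  -- argument.
  assemble : ∀ M → mirror P ≡ M → coeff M 0 ≡ 1ℤ → Ternary M → length M ≡ length P → lead M ≢ 0ℤ → mirror M ≡ P → Mirrored P
  assemble []      eq ()
  assemble (_ ∷ m) eq refl (_ ∷ ternary′) length≡ lead≢0′ inv = record
    { tail′ = m ; mirror≡ = eq ; ternary = ternary′ ; length≡ = length≡ ; lead≢0 = lead≢0′ ; involutive = trans (cong mirror eq) inv }
  by-lead : coeff (reverse P) 0 ≡ -1ℤ ⊎ coeff (reverse P) 0 ≡ 0ℤ ⊎ coeff (reverse P) 0 ≡ 1ℤ → Mirrored P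
  by-lead (inj₂ (inj₁ ≡0)) = ⊥-elim (lead≢0 (trans (sym (coeff-reverse-0 P)) ≡0))
  by-lead (inj₂ (inj₂ ≡1)) = assemble (reverse P) (normalise-1 (reverse P) ≡1) ≡1 (All-reverse ternary-P) (List.length-reverse P) lead-reverse≢0
    (trans (cong normalise (List.reverse-involutive P)) (normalise-1 P refl))
  by-lead (inj₁ ≡-1) = assemble (negate (reverse P)) (normalise--1 (reverse P) ≡-1)
    (trans (coeff-map -1ℤ (reverse P) 0) (cong (-1ℤ *_) ≡-1)) (Ternary-negate (All-reverse ternary-P))
    (trans (List.length-map (-1ℤ *_) (reverse P)) (List.length-reverse P))
    (λ eq → -1*≢0 lead-reverse≢0 (trans (sym (lead-negate (reverse P))) eq))
    (trans (cong normalise (trans (sym (List.reverse-map (-1ℤ *_) (reverse P))) (cong negate (List.reverse-involutive P))))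
      (trans (normalise--1 (negate P) refl) (negate-involutive P)))

-- The name refers to the constant term 1. Whichever of P and its mirror image has the smaller code
-- is canonical; if it is the mirror image, then its own mirror is P again.
lifts-monic : ∀ p → Ternary p → length p ℕ.≤ 8 → lead (1ℤ ∷ p) ≢ 0ℤ → Lifts (1ℤ ∷ p)
lifts-monic p ternary short lead≢0 with ℕ.≤-total (code (1ℤ ∷ p)) (code (mirror (1ℤ ∷ p)))
... | inj₁ P≤M = lifts-canonical p ternary short lead≢0 (ℕ.≤⇒≤ᵇ P≤M)
... | inj₂ M≤P = lifts-mirror (1ℤ ∷ p) lead≢0 (λ ()) (subst Lifts (sym mirror≡)
    (lifts-canonical tail′ ternary′ (subst (ℕ._≤ 8) (sym (ℕ.suc-injective length≡)) short) lead≢0′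
      (subst (λ M → T (canonicalᵇ M)) mirror≡ (ℕ.≤⇒≤ᵇ (subst (λ Q → code (mirror (1ℤ ∷ p)) ℕ.≤ code Q) (sym involutive) M≤P)))))
  where open Mirrored (mirrored p ternary lead≢0) renaming (ternary to ternary′; lead≢0 to lead≢0′)

theorem2p1 : (P : Poly) → Borwein P → degree≤ P 8 →
    (∃ λ N → Newman N × P ∣ₚ N) → ∃ λ L → Littlewood L × P ∣ₚ L
theorem2p1 []      (_ , _ , constant≢0) _ = ⊥-elim (constant≢0 refl)
theorem2p1 (_ ∷ p) (inj₂ (inj₂ refl) ∷ ternary , lead≢0 , _) (s≤s short) = lifts-monic p ternary short lead≢0
theorem2p1 (_ ∷ p) (inj₂ (inj₁ refl) ∷ _ , _ , constant≢0) _ = ⊥-elim (constant≢0 refl)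
theorem2p1 (_ ∷ p) (inj₁ refl ∷ ternary , lead≢0 , _) (s≤s short) = lifts-negate (-1ℤ ∷ p)
  (lifts-monic (negate p) (Ternary-negate ternary) (subst (ℕ._≤ 8) (sym (List.length-map (-1ℤ *_) p)) short)
    (λ eq → -1*≢0 lead≢0 (trans (sym (lead-negate (-1ℤ ∷ p))) eq)))
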